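{- For every ordered graph $F$, \[ \rho_{<}(F) = \inf\{\alpha \in [0, 1] : \text{there exists } C \text{ such that every } (\alpha, C)\text{ -rich graph contains } F\}. \]
   Context: An ordered graph is a graph whose vertex set carries a total order. An ordered graph $G$ contains an ordered graph $F$ if there is an injective order-preserving map $V(F)\to V(G)$ sending edges of $F$ to edges of $G$; otherwise $G$ is $F$-free. For ordered graphs $F,G$ (with $e(G)>0$), $\rho_{<}(F,G)=\max\{e(G')/e(G): G'\subseteq G,\ G'\ F\text{ -free}\}$ and $\rho_{<}(F)=\inf_G\rho_{<}(F,G)$ over all ordered graphs $G$. For distinct $x,y\in\{0,1\}^d$, $\delta(x,y)=\min\{i: x_i\ne y_i\}$; $\{0,1\}^d$ is ordered lexicographically ($x<y$ iff $x_{\delta(x,y)}=0$). For a graph $G$ on $\{0,1\}^d$ (with this order), an edge $uv$ is a level-$\ell$ edge if $\delta(u,v)=\ell$, $e_\ell(G)$ is the number of level-$\ell$ edges, and $\tau_{\ell,d}=2^{2d-\ell-1}$ is the number of pairs $\{u,v\}\subseteq\{0,1\}^d$ with $\delta(u,v)=\ell$. A level $\ell\in[d]$ is $\alpha$-rich for $G$ if $e_\ell(G)\ge\alpha\tau_{\ell,d}$, and $G$ is $(\alpha,C)$-rich if at least $C$ levels $\ell\in[d]$ are $\alpha$-rich. "Every $(\alpha,C)$-rich graph" ranges over all $d\in\mathbb{N}$ and all $(\alpha,C)$-rich ordered graphs on $\{0,1\}^d$. -}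

module Defs where

open import Level using (0ℓ; _⊔_) renaming (suc to lsuc)
open import Data.Bool using (Bool; true; false; T; T?)
import Data.Bool as Bool
open import Data.Nat as ℕ using (ℕ; zero; suc; NonZero)
import Data.Nat.Properties as ℕₚ
open import Data.Integer using (+_)
open import Data.Rational as ℚ using (ℚ; 0ℚ; 1ℚ)
import Data.Rational.Properties as ℚₚ
open import Data.Fin as Fin using (Fin; toℕ)
import Data.Fin.Properties as Finₚ
open import Data.Fin.Subset using (Subset; ∣_∣) renaming (_∈_ to _∈ₛ_)
open import Data.Vec using (Vec; []; _∷_; lookup)
open import Data.List using (List; []; _∷_; _++_; map; filter; length; allFin; cartesianProduct)
open import Data.Product using (∃-syntax; Σ-syntax; _×_; _,_; proj₁; proj₂)
open import Data.Sum using (_⊎_; inj₁; inj₂)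
open import Function using (_⇔_; mk⇔)
open import Function.Definitions using (Injective)
open import Relation.Nullary using (¬_; Dec; yes; no; ¬?; _×-dec_; _→-dec_)
open import Relation.Unary using (Pred; Empty; _∈_; _≐_)
open import Relation.Binary using (Rel; Decidable)
open import Relation.Binary.PropositionalEquality using (_≡_; _≢_; refl; subst)

------------------------------------------------------------------------
-- Real numbers and infima

-- Two-sided, located Dedekind cuts:  lower x q  means q < x,  upper x q
-- means x < q.
record ℝ : Set₁ where
  field
    lower           : Pred ℚ 0ℓ
    upper           : Pred ℚ 0ℓ
    lower-inhabited : ∃[ q ] lower q
    upper-inhabited : ∃[ q ] upper q
    lower-rounded   : ∀ q → lower q ⇔ (∃[ r ] q ℚ.< r × lower r)
    upper-rounded   : ∀ q → upper q ⇔ (∃[ r ] r ℚ.< q × upper r)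
    disjoint        : ∀ q → ¬ (lower q × upper q)
    located         : ∀ {q r} → q ℚ.< r → lower q ⊎ upper r

open ℝ public

infix 4 _≤ᵣ_

_≤ᵣ_ : Rel ℝ 0ℓ
x ≤ᵣ y = ∀ q → lower x q → lower y q

private
  q-1<q : ∀ q → q ℚ.+ ℚ.- 1ℚ ℚ.< q
  q-1<q q = subst (q ℚ.+ ℚ.- 1ℚ ℚ.<_) (ℚₚ.+-identityʳ q)
                  (ℚₚ.+-monoʳ-< q (ℚₚ.negative⁻¹ (ℚ.- 1ℚ)))

  q<q+1 : ∀ q → q ℚ.< q ℚ.+ 1ℚ
  q<q+1 q = subst (ℚ._< q ℚ.+ 1ℚ) (ℚₚ.+-identityʳ q)
                  (ℚₚ.+-monoʳ-< q (ℚₚ.positive⁻¹ 1ℚ))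

fromℚ : ℚ → ℝ
fromℚ p = record
  { lower           = ℚ._< p
  ; upper           = p ℚ.<_
  ; lower-inhabited = _ , q-1<q p
  ; upper-inhabited = _ , q<q+1 p
  ; lower-rounded   = λ q → mk⇔ (λ q<p → let r , q<r , r<p = ℚₚ.<-dense q<p in r , q<r , r<p)
                                (λ (r , q<r , r<p) → ℚₚ.<-trans q<r r<p)
  ; upper-rounded   = λ q → mk⇔ (λ p<q → let r , p<r , r<q = ℚₚ.<-dense p<q in r , r<q , p<r)
                                (λ (r , r<q , p<r) → ℚₚ.<-trans p<r r<q)
  ; disjoint        = λ q (q<p , p<q) → ℚₚ.<-asym q<p p<q
  ; located         = loc
  }
  where
  loc : ∀ {q r} → q ℚ.< r → q ℚ.< p ⊎ p ℚ.< r
  loc {q} {r} q<r with q ℚₚ.<? p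
  ... | yes q<p = inj₁ q<p
  ... | no  q≮p = inj₂ (ℚₚ.≤-<-trans (ℚₚ.≮⇒≥ q≮p) q<r)

-- Constructively the infimum of a set of reals need not be a located cut,
-- so it is taken as an upper real, that is, as the set of rationals
-- strictly above it.  Infima are equal when these sets are equal (_≐_);
-- for nonempty sets bounded below this is classically equality of the
-- real infima.
infimum : ∀ {ℓ} → Pred ℝ ℓ → Pred ℚ (lsuc 0ℓ ⊔ ℓ)
infimum S q = ∃[ x ] x ∈ S × upper x q

IsGLB : ∀ {ℓ} → Pred ℝ ℓ → ℝ → Set (lsuc 0ℓ ⊔ ℓ)
IsGLB S x = (∀ y → y ∈ S → x ≤ᵣ y) × (∀ z → (∀ y → y ∈ S → z ≤ᵣ y) → z ≤ᵣ x)

-- A real number with the same upper cut as infimum S is the greatest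
-- lower bound of S.
infimum-isGLB : ∀ {ℓ} (S : Pred ℝ ℓ) (x : ℝ) → upper x ≐ infimum S → IsGLB S x
infimum-isGLB S x (x⊆S , S⊆x) = lb , glb
  where
  lb : ∀ y → y ∈ S → x ≤ᵣ y
  lb y y∈S q q<x with Function.Equivalence.to (lower-rounded x q) q<x
  ... | r , q<r , r<x with located y q<r
  ...   | inj₁ q<y = q<y
  ...   | inj₂ y<r with () ← disjoint x r (r<x , S⊆x (y , y∈S , y<r))

  glb : ∀ z → (∀ y → y ∈ S → z ≤ᵣ y) → z ≤ᵣ x
  glb z z≤S q q<z with Function.Equivalence.to (lower-rounded z q) q<z
  ... | r , q<r , r<z with located x q<r
  ...   | inj₁ q<x = q<x
  ...   | inj₂ x<r with x⊆S x<r
  ...     | y , y∈S , y<r with () ← disjoint y r (z≤S y y∈S r r<z , y<r)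

------------------------------------------------------------------------
-- Ordered graphs

record Graph (V : Set) : Set where
  field
    adj        : V → V → Bool
    adj-sym    : ∀ u v → adj u v ≡ adj v u
    adj-irrefl : ∀ u → adj u u ≡ false

open Graph public

record Embedding {V W : Set} (_<ⱽ_ : Rel V 0ℓ) (_<ᵂ_ : Rel W 0ℓ)
                 (F : Graph V) (G : Graph W) : Set where
  field
    to        : V → W
    injective : Injective _≡_ _≡_ to
    monotone  : ∀ {u v} → u <ⱽ v → to u <ᵂ to v
    edges     : ∀ {u v} → T (adj F u v) → T (adj G (to u) (to v))

-- A finite total order is uniquely isomorphic to some Fin n with its
-- usual order, so finite ordered graphs are taken on these vertex sets.
record OrderedGraph : Set where
  field
    order : ℕ
    graph : Graph (Fin order)

open OrderedGraph public

infix 4 _contains_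

_contains_ : OrderedGraph → OrderedGraph → Set
G contains F = Embedding Fin._<_ Fin._<_ (graph F) (graph G)

e : OrderedGraph → ℕ
e G = length (filter edge? (cartesianProduct (allFin (order G)) (allFin (order G))))
  where
  edge? : (p : Fin (order G) × Fin (order G)) →
          Dec (proj₁ p Fin.< proj₂ p × T (adj (graph G) (proj₁ p) (proj₂ p)))
  edge? (i , j) = (i Finₚ.<? j) ×-dec T? (adj (graph G) i j)

------------------------------------------------------------------------
-- Relative Turán densities

-- The maximum of an empty set of densities is read as 0.
IsMax : Pred ℚ 0ℓ → Pred ℚ 0ℓ
IsMax P m = (m ∈ P × (∀ r → r ∈ P → r ℚ.≤ m)) ⊎ (Empty P × m ≡ 0ℚ)

-- The values e(G')/e(G).  Up to isomorphism the (not necessarily spanning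
-- or induced) subgraphs G' of G are the ordered graphs that G contains.
-- The empty subgraph is F-free unless F has no vertices; in that case no
-- graph is F-free.
FreeDensities : (F G : OrderedGraph) .{{_ : NonZero (e G)}} → Pred ℚ 0ℓ
FreeDensities F G r =
  ∃[ G′ ] G contains G′ × ¬ (G′ contains F) × r ≡ + e G′ ℚ./ e G

-- IsRelativeDensity F G r  says that  ρ_<(F, G) = r.
IsRelativeDensity : (F G : OrderedGraph) .{{_ : NonZero (e G)}} → Pred ℚ 0ℓ
IsRelativeDensity F G = IsMax (FreeDensities F G)

-- x ∈ RelativeDensities F  says that  x = ρ_<(F, G)  for some G with
-- e(G) > 0.
data RelativeDensities (F : OrderedGraph) : Pred ℝ (lsuc 0ℓ) where
  density : ∀ G .{{_ : NonZero (e G)}} r → IsRelativeDensity F G r →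
            fromℚ r ∈ RelativeDensities F

ρ< : OrderedGraph → Pred ℚ (lsuc 0ℓ)
ρ< F = infimum (RelativeDensities F)

------------------------------------------------------------------------
-- Graphs on {0,1}^d

Cube : ℕ → Set
Cube d = Vec Bool d

cube : ∀ d → List (Cube d)
cube zero    = [] ∷ []
cube (suc d) = map (false ∷_) (cube d) ++ map (true ∷_) (cube d)

-- Fin d stands for [d]:  the element i is coordinate (or level) toℕ i + 1.
-- IsDelta x y ℓ  says that  δ(x,y) = ℓ.
IsDelta : ∀ {d} → Cube d → Cube d → Fin d → Set
IsDelta x y ℓ = lookup x ℓ ≢ lookup y ℓ × (∀ i → i Fin.< ℓ → lookup x i ≡ lookup y i)

isDelta? : ∀ {d} (x y : Cube d) (ℓ : Fin d) → Dec (IsDelta x y ℓ)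
isDelta? x y ℓ =
  ¬? (lookup x ℓ Bool.≟ lookup y ℓ) ×-dec
  Finₚ.all? (λ i → (i Finₚ.<? ℓ) →-dec (lookup x i Bool.≟ lookup y i))

infix 4 _≺_ _≺?_

_≺_ : ∀ {d} → Rel (Cube d) 0ℓ
x ≺ y = ∃[ ℓ ] IsDelta x y ℓ × lookup x ℓ ≡ false

_≺?_ : ∀ {d} → Decidable (_≺_ {d})
x ≺? y = Finₚ.any? (λ ℓ → isDelta? x y ℓ ×-dec (lookup x ℓ Bool.≟ false))

infix 4 _containsᶜ_

_containsᶜ_ : ∀ {d} → Graph (Cube d) → OrderedGraph → Set
H containsᶜ F = Embedding Fin._<_ _≺_ (graph F) H

-- e_ℓ(H), each edge uv being counted once, with u ≺ v.
levelEdges : ∀ {d} → Graph (Cube d) → Fin d → ℕ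
levelEdges {d} H ℓ = length (filter levelEdge? (cartesianProduct (cube d) (cube d)))
  where
  levelEdge? : (p : Cube d × Cube d) →
               Dec (proj₁ p ≺ proj₂ p × IsDelta (proj₁ p) (proj₂ p) ℓ ×
                    T (adj H (proj₁ p) (proj₂ p)))
  levelEdge? (u , v) = (u ≺? v) ×-dec isDelta? u v ℓ ×-dec T? (adj H u v)

-- 2^(2d-ℓ-1); the level indexed by i is ℓ = toℕ i + 1.
τ : (d : ℕ) → Fin d → ℕ
τ d i = 2 ℕ.^ (2 ℕ.* d ℕ.∸ suc (toℕ i) ℕ.∸ 1)

τ-nonZero : ∀ d (i : Fin d) → NonZero (τ d i)
τ-nonZero d i = ℕₚ.m^n≢0 2 (2 ℕ.* d ℕ.∸ suc (toℕ i) ℕ.∸ 1)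

-- As τ > 0, the inequality e_ℓ(H) ≥ ατ is stated as α ≤ e_ℓ(H)/τ.
RichLevel : ∀ {d} → ℝ → Graph (Cube d) → Fin d → Set
RichLevel {d} α H ℓ = α ≤ᵣ fromℚ (+ levelEdges H ℓ ℚ./ τ d ℓ)
  where instance _ = τ-nonZero d ℓ

Rich : ∀ {d} → ℝ → ℕ → Graph (Cube d) → Set
Rich {d} α C H =
  Σ[ L ∈ Subset d ] C ℕ.≤ ∣ L ∣ × (∀ ℓ → ℓ ∈ₛ L → RichLevel α H ℓ)

-- If ρ<(F, G) = r < α, then graphs H on the cube with many α-rich levels contain F: group the
-- rich levels into consecutive blocks, one for each vertex of G, and map the vertices of G to
-- the cube at random, splitting off one vertex at a random level of each block and taking all
-- other bits uniform.  Forcing a bit at a random one of 4^k levels changes the mean of a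
-- [0,1]-valued function by at most 2^-k, so each edge of G goes to a nearly uniform pair of
-- points at a random rich level.  Some such copy of G in the cube thus has more than r e(G) of
-- its edges in H, and so already its intersection with H contains F.
--
-- Conversely, let (α, C)-rich graphs contain F and let α < q.  Replace each point x of a large
-- cube by the labels s ∈ {0,1}^K, and join (x, s) to (y, t) when s_k = t_k for all k with
-- π_k x = π_k y.  The maps π_k are such that every level receives the same number of edges.
-- Choosing labels s_k = σ_k (π_k x) with random functions σ_k shows that a subgraph with a
-- fraction q of the edges has a transversal H whose densities on the levels have mean at least q.
-- So H has many α-rich levels and contains F.  A subgraph need not be spanning, so isolated
-- vertices of F might be sent to missing vertices; to leave room for them, vertices close to the
-- ends of their part are discarded first.
module Submission where

open import Defs
open import Level using (0ℓ)
open import Data.Bool using (Bool; true; false; T; T?; _∧_; _∨_; not; _xor_; if_then_else_)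
import Data.Bool as Bool
import Data.Bool.Properties as Boolₚ
open import Data.Nat as ℕ using (ℕ; zero; suc; NonZero)
import Data.Nat.Properties as ℕₚ
import Data.Integer as ℤ
import Data.Integer.Properties as ℤₚ
open import Data.Rational as ℚ using (ℚ; mkℚ; 0ℚ; 1ℚ; ½; _+_; _*_; _-_; -_; _≤_; _<_; _/_)
import Data.Rational.Properties as ℚₚ
import Data.Rational.Unnormalised as ℚᵘ
import Data.Rational.Unnormalised.Properties as ℚᵘₚ
open import Data.Fin as Fin using (Fin; zero; suc; toℕ)
import Data.Fin.Properties as Finₚ
open import Data.Fin.Subset using (Subset; ∣_∣) renaming (_∈_ to _∈ₛ_)
open import Data.Vec as Vec using (Vec; []; _∷_; lookup; _[_]≔_)
import Data.Vec.Properties as Vecₚ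
open import Data.List as List using (List; []; _∷_; _++_; map; filter; length; allFin; cartesianProduct)
import Data.List.Properties as Listₚ
open import Data.List.Relation.Unary.All as All using (All; []; _∷_)
import Data.List.Relation.Unary.All.Properties as Allₚ
open import Data.List.Relation.Unary.AllPairs as AllPairs using (AllPairs; []; _∷_)
import Data.List.Relation.Unary.AllPairs.Properties as AllPairsₚ
open import Data.List.Relation.Unary.Any using (Any; here; there)
open import Data.List.Membership.Propositional.Properties using (∈-allFin; ∈-cartesianProduct⁺; ∈-lookup)
open import Data.Maybe using (Maybe; just; nothing)
open import Data.Maybe.Properties using (just-injective)
open import Data.Product using (∃-syntax; Σ-syntax; _×_; _,_; proj₁; proj₂; uncurry)
import Data.Product.Properties as Productₚ
open import Data.Sum using (_⊎_; inj₁; inj₂; [_,_]′)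
open import Data.Empty using (⊥; ⊥-elim)
open import Data.Unit using (tt)
open import Function using (_∘_; id; _⇔_; mk⇔; case_of_)
open import Function.Bundles using (module Equivalence)
open import Relation.Nullary using (¬_; Dec; yes; no; does; ¬?; _×-dec_; _→-dec_; contradiction)
open import Relation.Nullary.Decidable using (map′; does-⇔; dec⇒maybe; dec-true; dec-false; decidable-stable)
open import Relation.Unary using (Pred; _∈_; _≐_)
open import Relation.Binary using (Rel; tri<; tri≈; tri>)
open import Relation.Binary.PropositionalEquality
  using (_≡_; _≢_; refl; sym; trans; cong; cong₂; subst; subst₂; module ≡-Reasoning)
open import Tactic.RingSolver using (solve-∀)
open import Tactic.RingSolver.Core.AlmostCommutativeRing using (AlmostCommutativeRing; fromCommutativeRing)

-- Arithmetic of ℚ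

-- The cube itself cannot be the host graph of the converse: its first level alone holds more than
-- half of all pairs, so a dense subgraph may have few rich levels. Each condition `s_k = t_k`
-- halves the pairs of labels; imposing `d - ℓ` of them on the pairs at level `ℓ` leaves every level
-- with equally many edges. Expressing the conditions by maps of single points is what allows labels
-- `σ_k (π_k x)` to meet all of them at once, so that a section loses no pair of points. In the
-- other direction `H` is arbitrary, so no particular level is safe for forcing a bit: that bit may
-- decide what lies in `H`. But the coordinate characters are orthonormal, so a bounded function
-- correlates little with the average of many of them. As `α` may not exceed 1, a graph `G` of
-- relative density 1 leaves no room above it. This case is settled by showing that `α = 1` always
-- forces `F`. Everything is constructive. An element of `RelativeDensities` needs a maximum that
-- exists, so containment and free subgraphs are decided by finite search.

ring : AlmostCommutativeRing 0ℓ 0ℓ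
ring = fromCommutativeRing ℚₚ.+-*-commutativeRing (λ x → dec⇒maybe (0ℚ ℚₚ.≟ x))

0≤1 : 0ℚ ≤ 1ℚ
0≤1 = ℚₚ.nonNegative⁻¹ 1ℚ

0≤½ : 0ℚ ≤ ½
0≤½ = ℚₚ.nonNegative⁻¹ ½

≤⇒0≤- : ∀ {p q} → p ≤ q → 0ℚ ≤ q - p
≤⇒0≤- {p} {q} p≤q = subst (_≤ q - p) (ℚₚ.+-inverseʳ p) (ℚₚ.+-monoˡ-≤ (- p) p≤q)

≤-by : ∀ {p q r} → 0ℚ ≤ r → q ≡ p + r → p ≤ q
≤-by {p} {q} {r} 0≤r q≡p+r =
  subst₂ _≤_ (ℚₚ.+-identityʳ p) (sym q≡p+r) (ℚₚ.+-monoʳ-≤ p 0≤r)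

<⇒0<- : ∀ {p q} → p < q → 0ℚ < q - p
<⇒0<- {p} {q} p<q = subst (_< q - p) (ℚₚ.+-inverseʳ p) (ℚₚ.+-monoˡ-< (- p) p<q)

<-by : ∀ {p q r} → 0ℚ < r → q ≡ p + r → p < q
<-by {p} {q} {r} 0<r q≡p+r =
  subst₂ _<_ (ℚₚ.+-identityʳ p) (sym q≡p+r) (ℚₚ.+-monoʳ-< p 0<r)

0≤+ : ∀ {p q} → 0ℚ ≤ p → 0ℚ ≤ q → 0ℚ ≤ p + q
0≤+ = ℚₚ.+-mono-≤

*-mono : ∀ {c p q} → 0ℚ ≤ c → p ≤ q → c * p ≤ c * q
*-mono {c} 0≤c = ℚₚ.*-monoˡ-≤-nonNeg c where instance _ = ℚ.nonNegative 0≤c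

0≤* : ∀ {p q} → 0ℚ ≤ p → 0ℚ ≤ q → 0ℚ ≤ p * q
0≤* {p} {q} 0≤p 0≤q = subst (_≤ p * q) (ℚₚ.*-zeroʳ p) (*-mono 0≤p 0≤q)

*-mono-< : ∀ {c p q} → 0ℚ < c → p < q → c * p < c * q
*-mono-< {c} 0<c = ℚₚ.*-monoʳ-<-pos c where instance _ = ℚ.positive 0<c

0<* : ∀ {p q} → 0ℚ < p → 0ℚ < q → 0ℚ < p * q
0<* {p} {q} 0<p 0<q = subst (_< p * q) (ℚₚ.*-zeroʳ p) (*-mono-< 0<p 0<q)

*-cancel-≤ : ∀ {c p q} → 0ℚ < c → c * p ≤ c * q → p ≤ q
*-cancel-≤ {c} 0<c = ℚₚ.*-cancelˡ-≤-pos c where instance _ = ℚ.positive 0<c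

0≤p² : ∀ p → 0ℚ ≤ p * p
0≤p² p with ℚₚ.≤-total 0ℚ p
... | inj₁ 0≤p = 0≤* 0≤p 0≤p
... | inj₂ p≤0 = subst (0ℚ ≤_) (neg² p) (0≤* 0≤-p 0≤-p)
  where
  0≤-p = ℚₚ.neg-antimono-≤ p≤0
  neg² : ∀ p → - p * - p ≡ p * p
  neg² = solve-∀ ring

≤⇒≯ : ∀ {p q} → p ≤ q → ¬ q < p
≤⇒≯ p≤q q<p = ℚₚ.<-irrefl refl (ℚₚ.<-≤-trans q<p p≤q)

-- The recursion makes `nat (suc n)` unfold to `1ℚ + nat n`, the form in which the ring identities
-- below take it.
nat : ℕ → ℚ
nat zero    = 0ℚ
nat (suc n) = 1ℚ + nat n

nat-+ : ∀ m n → nat (m ℕ.+ n) ≡ nat m + nat n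
nat-+ zero    n = sym (ℚₚ.+-identityˡ (nat n))
nat-+ (suc m) n = trans (cong (1ℚ +_) (nat-+ m n)) (sym (ℚₚ.+-assoc 1ℚ (nat m) (nat n)))

nat-* : ∀ m n → nat (m ℕ.* n) ≡ nat m * nat n
nat-* zero    n = sym (ℚₚ.*-zeroˡ (nat n))
nat-* (suc m) n = trans (nat-+ n (m ℕ.* n)) (trans (cong (nat n +_) (nat-* m n)) (eq (nat m) (nat n)))
  where
  eq : ∀ x y → y + x * y ≡ (1ℚ + x) * y
  eq = solve-∀ ring

0≤nat : ∀ n → 0ℚ ≤ nat n
0≤nat zero    = ℚₚ.≤-refl
0≤nat (suc n) = 0≤+ 0≤1 (0≤nat n)

nat-mono : ∀ {m n} → m ℕ.≤ n → nat m ≤ nat n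
nat-mono {n = n} ℕ.z≤n = 0≤nat n
nat-mono (ℕ.s≤s m≤n) = ℚₚ.+-monoʳ-≤ 1ℚ (nat-mono m≤n)

0<nat : ∀ n .{{_ : NonZero n}} → 0ℚ < nat n
0<nat (suc n) = ℚₚ.<-≤-trans (ℚₚ.positive⁻¹ 1ℚ)
                  (subst (_≤ nat (suc n)) (ℚₚ.+-identityʳ 1ℚ) (ℚₚ.+-monoʳ-≤ 1ℚ (0≤nat n)))

nat-mono-< : ∀ {m n} → m ℕ.< n → nat m < nat n
nat-mono-< {m} {n} m<n = ℚₚ.<-≤-trans
  (subst (_< nat (suc m)) (ℚₚ.+-identityˡ (nat m)) (ℚₚ.+-monoˡ-< (nat m) (ℚₚ.positive⁻¹ 1ℚ)))
  (nat-mono m<n)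

nat-cancel-≤ : ∀ {m n} → nat m ≤ nat n → m ℕ.≤ n
nat-cancel-≤ {m} {n} p with m ℕₚ.≤? n
... | yes m≤n = m≤n
... | no  m≰n = contradiction (nat-mono-< (ℕₚ.≰⇒> m≰n)) (≤⇒≯ p)

nat-cancel-< : ∀ {m n} → nat m < nat n → m ℕ.< n
nat-cancel-< {m} {n} p with m ℕₚ.<? n
... | yes m<n = m<n
... | no  m≮n = contradiction p (≤⇒≯ (nat-mono (ℕₚ.≮⇒≥ m≮n)))

nat≡/1 : ∀ n → nat n ≡ ℤ.+ n / 1
nat≡/1 zero    = refl
nat≡/1 (suc n) = trans (cong (1ℚ +_) (nat≡/1 n)) (ℚₚ.toℚᵘ-injective (begin
  ℚ.toℚᵘ (1ℚ + ℤ.+ n / 1)          ≈⟨ ℚₚ.toℚᵘ-homo-+ 1ℚ (ℤ.+ n / 1) ⟩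
  ℚ.toℚᵘ 1ℚ ℚᵘ.+ ℚ.toℚᵘ (ℤ.+ n / 1) ≈⟨ ℚᵘₚ.+-congʳ (ℚ.toℚᵘ 1ℚ) (ℚₚ.toℚᵘ-fromℚᵘ (ℚᵘ.mkℚᵘ (ℤ.+ n) 0)) ⟩
  ℚ.toℚᵘ 1ℚ ℚᵘ.+ ℚᵘ.mkℚᵘ (ℤ.+ n) 0 ≈⟨ ℚᵘ.*≡* (cong (λ z → (ℤ.+ 1 ℤ.+ z) ℤ.* ℤ.+ 1) (ℤₚ.*-identityʳ (ℤ.+ n))) ⟩
  ℚᵘ.mkℚᵘ (ℤ.+ suc n) 0            ≈⟨ ℚₚ.toℚᵘ-fromℚᵘ (ℚᵘ.mkℚᵘ (ℤ.+ suc n) 0) ⟨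
  ℚ.toℚᵘ (ℤ.+ suc n / 1)           ∎))
  where open import Relation.Binary.Reasoning.Setoid ℚᵘₚ.≃-setoid

/-nat : ∀ a b .{{_ : NonZero b}} → nat b * (ℤ.+ a / b) ≡ nat a
/-nat a b@(suc c) = trans (cong (_* (ℤ.+ a / b)) (nat≡/1 b)) (trans (ℚₚ.toℚᵘ-injective (begin
  ℚ.toℚᵘ ((ℤ.+ b / 1) * (ℤ.+ a / b))             ≈⟨ ℚₚ.toℚᵘ-homo-* (ℤ.+ b / 1) (ℤ.+ a / b) ⟩
  ℚ.toℚᵘ (ℤ.+ b / 1) ℚᵘ.* ℚ.toℚᵘ (ℤ.+ a / b)     ≈⟨ ℚᵘₚ.*-cong (ℚₚ.toℚᵘ-fromℚᵘ (ℚᵘ.mkℚᵘ (ℤ.+ b) 0))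
                                                          (ℚₚ.toℚᵘ-fromℚᵘ (ℚᵘ.mkℚᵘ (ℤ.+ a) c)) ⟩
  ℚᵘ.mkℚᵘ (ℤ.+ b) 0 ℚᵘ.* ℚᵘ.mkℚᵘ (ℤ.+ a) c       ≈⟨ ℚᵘ.*≡* (trans (ℤₚ.*-identityʳ _)
                                                  (trans (ℤₚ.*-comm (ℤ.+ b) (ℤ.+ a)) (cong (ℤ.+ a ℤ.*_) (cong ℤ.+_ (sym (ℕₚ.+-identityʳ b)))))) ⟩
  ℚᵘ.mkℚᵘ (ℤ.+ a) 0                            ≈⟨ ℚₚ.toℚᵘ-fromℚᵘ (ℚᵘ.mkℚᵘ (ℤ.+ a) 0) ⟨
  ℚ.toℚᵘ (ℤ.+ a / 1)                           ∎)) (sym (nat≡/1 a)))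
  where open import Relation.Binary.Reasoning.Setoid ℚᵘₚ.≃-setoid

-- The numerator will do, since the denominator is at least 1.
archimedean : ∀ p → ∃[ n ] p ≤ nat n
archimedean p@(mkℚ (ℤ.-[1+ n ]) d _) = 0 , ℚₚ.<⇒≤ (ℚₚ.negative⁻¹ p)
archimedean p@(mkℚ (ℤ.+ n) d _) = n , subst (_≤ nat n) (ℚₚ.↥p/↧p≡p p)
  (*-cancel-≤ (0<nat (suc d)) (subst (_≤ nat (suc d) * nat n) (sym (/-nat n (suc d)))
    (≤-by (0≤* (0≤nat d) (0≤nat n)) (eq (nat d) (nat n)))))
  where
  eq : ∀ x y → (1ℚ + x) * y ≡ y + x * y
  eq = solve-∀ ring

-- Indicators

⟦_⟧ : Bool → ℚ
⟦ true  ⟧ = 1ℚ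
⟦ false ⟧ = 0ℚ

0≤⟦⟧ : ∀ b → 0ℚ ≤ ⟦ b ⟧
0≤⟦⟧ true  = 0≤1
0≤⟦⟧ false = ℚₚ.≤-refl

⟦⟧≤1 : ∀ b → ⟦ b ⟧ ≤ 1ℚ
⟦⟧≤1 true  = ℚₚ.≤-refl
⟦⟧≤1 false = 0≤1

⟦⟧-mono : ∀ {b c} → (T b → T c) → ⟦ b ⟧ ≤ ⟦ c ⟧
⟦⟧-mono {false} {c}     _ = 0≤⟦⟧ c
⟦⟧-mono {true}  {true}  _ = ℚₚ.≤-refl
⟦⟧-mono {true}  {false} f = ⊥-elim (f tt)

⟦∧⟧ : ∀ b c → ⟦ b ∧ c ⟧ ≡ ⟦ b ⟧ * ⟦ c ⟧
⟦∧⟧ true  c = sym (ℚₚ.*-identityˡ ⟦ c ⟧)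
⟦∧⟧ false c = sym (ℚₚ.*-zeroˡ ⟦ c ⟧)

-- Finite sums

variable
  A B : Set

∑ : List A → (A → ℚ) → ℚ
∑ []       f = 0ℚ
∑ (x ∷ xs) f = f x + ∑ xs f

∑-cong : ∀ (xs : List A) {f g} → (∀ x → f x ≡ g x) → ∑ xs f ≡ ∑ xs g
∑-cong []       f≗g = refl
∑-cong (x ∷ xs) f≗g = cong₂ _+_ (f≗g x) (∑-cong xs f≗g)

∑-mono : ∀ (xs : List A) {f g} → (∀ x → f x ≤ g x) → ∑ xs f ≤ ∑ xs g
∑-mono []       f≤g = ℚₚ.≤-refl
∑-mono (x ∷ xs) f≤g = ℚₚ.+-mono-≤ (f≤g x) (∑-mono xs f≤g)

0≤∑ : ∀ (xs : List A) {f} → (∀ x → 0ℚ ≤ f x) → 0ℚ ≤ ∑ xs f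
0≤∑ []       0≤f = ℚₚ.≤-refl
0≤∑ (x ∷ xs) 0≤f = 0≤+ (0≤f x) (0≤∑ xs 0≤f)

interchange : ∀ p q r s → (p + q) + (r + s) ≡ (p + r) + (q + s)
interchange = solve-∀ ring

∑-+ : ∀ (xs : List A) f g → ∑ xs (λ x → f x + g x) ≡ ∑ xs f + ∑ xs g
∑-+ []       f g = sym (ℚₚ.+-identityˡ 0ℚ)
∑-+ (x ∷ xs) f g = trans (cong (f x + g x +_) (∑-+ xs f g)) (interchange (f x) (g x) (∑ xs f) (∑ xs g))

∑-* : ∀ (xs : List A) c f → ∑ xs (λ x → c * f x) ≡ c * ∑ xs f
∑-* []       c f = sym (ℚₚ.*-zeroʳ c)
∑-* (x ∷ xs) c f = trans (cong (c * f x +_) (∑-* xs c f)) (sym (ℚₚ.*-distribˡ-+ c (f x) (∑ xs f)))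

∑-const : ∀ (xs : List A) c → ∑ xs (λ _ → c) ≡ nat (length xs) * c
∑-const []       c = sym (ℚₚ.*-zeroˡ c)
∑-const (x ∷ xs) c = trans (cong (c +_) (∑-const xs c)) (eq c (nat (length xs)))
  where
  eq : ∀ x y → x + y * x ≡ (1ℚ + y) * x
  eq = solve-∀ ring

∑-zero : ∀ (xs : List A) → ∑ xs (λ _ → 0ℚ) ≡ 0ℚ
∑-zero xs = trans (∑-const xs 0ℚ) (ℚₚ.*-zeroʳ (nat (length xs)))

∑-++ : ∀ (xs ys : List A) f → ∑ (xs ++ ys) f ≡ ∑ xs f + ∑ ys f
∑-++ []       ys f = sym (ℚₚ.+-identityˡ _)
∑-++ (x ∷ xs) ys f = trans (cong (f x +_) (∑-++ xs ys f)) (sym (ℚₚ.+-assoc (f x) (∑ xs f) (∑ ys f)))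

∑-map : ∀ (h : A → B) xs f → ∑ (map h xs) f ≡ ∑ xs (f ∘ h)
∑-map h []       f = refl
∑-map h (x ∷ xs) f = cong (f (h x) +_) (∑-map h xs f)

∑-swap : ∀ (xs : List A) (ys : List B) (f : A → B → ℚ) →
         ∑ xs (λ x → ∑ ys (f x)) ≡ ∑ ys (λ y → ∑ xs (λ x → f x y))
∑-swap []       ys f = sym (∑-zero ys)
∑-swap (x ∷ xs) ys f = trans (cong (∑ ys (f x) +_) (∑-swap xs ys f))
  (sym (∑-+ ys (f x) (λ y → ∑ xs (λ x′ → f x′ y))))

∑-cartesianProduct : ∀ (xs : List A) (ys : List B) f →
  ∑ (cartesianProduct xs ys) f ≡ ∑ xs (λ x → ∑ ys (λ y → f (x , y)))
∑-cartesianProduct []       ys f = refl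
∑-cartesianProduct (x ∷ xs) ys f = trans (∑-++ (map (x ,_) ys) _ f)
  (cong₂ _+_ (∑-map (x ,_) ys f) (∑-cartesianProduct xs ys f))

length-filter : ∀ {P : Pred A 0ℓ} (P? : ∀ x → Dec (P x)) xs →
                nat (length (filter P? xs)) ≡ ∑ xs (λ x → ⟦ does (P? x) ⟧)
length-filter P? [] = refl
length-filter P? (x ∷ xs) with does (P? x)
... | true  = cong (1ℚ +_) (length-filter P? xs)
... | false = trans (length-filter P? xs) (sym (ℚₚ.+-identityˡ _))

-- Finitely supported means

-- A distribution is given by its expectation functional alone, without a sample space. `attained`
-- is the first-moment method: some outcome does at least as well as the average.
record Mean (A : Set) : Set where
  field
    E        : (A → ℚ) → ℚ
    E-mono   : ∀ {f g} → (∀ a → f a ≤ g a) → E f ≤ E g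
    E-+      : ∀ f g → E (λ a → f a + g a) ≡ E f + E g
    E-*      : ∀ c f → E (λ a → c * f a) ≡ c * E f
    E-const  : ∀ c → E (λ _ → c) ≡ c
    attained : ∀ f → ∃[ a ] E f ≤ f a

  E-cong : ∀ {f g} → (∀ a → f a ≡ g a) → E f ≡ E g
  E-cong f≗g = ℚₚ.≤-antisym (E-mono (ℚₚ.≤-reflexive ∘ f≗g)) (E-mono (ℚₚ.≤-reflexive ∘ sym ∘ f≗g))

  E-∑ : ∀ (xs : List B) (f : A → B → ℚ) → E (λ a → ∑ xs (f a)) ≡ ∑ xs (λ x → E (λ a → f a x))
  E-∑ []       f = E-const 0ℚ
  E-∑ (x ∷ xs) f = trans (E-+ (λ a → f a x) (λ a → ∑ xs (f a))) (cong (E (λ a → f a x) +_) (E-∑ xs f))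

  0≤E : ∀ {f} → (∀ a → 0ℚ ≤ f a) → 0ℚ ≤ E f
  0≤E {f} 0≤f = subst (_≤ E f) (E-const 0ℚ) (E-mono 0≤f)

  E-- : ∀ f c → E (λ a → f a - c) ≡ E f - c
  E-- f c = trans (E-+ f (λ _ → - c)) (cong (E f +_) (E-const (- c)))

open Mean public

dirac : A → Mean A
dirac a = record
  { E = λ f → f a ; E-mono = λ f≤g → f≤g a ; E-+ = λ _ _ → refl ; E-* = λ _ _ → refl
  ; E-const = λ _ → refl ; attained = λ f → a , ℚₚ.≤-refl }

bind : Mean A → (A → Mean B) → Mean B
bind m k = record
  { E        = λ f → E m (λ a → E (k a) f)
  ; E-mono   = λ f≤g → E-mono m (λ a → E-mono (k a) f≤g)
  ; E-+      = λ f g → trans (E-cong m (λ a → E-+ (k a) f g)) (E-+ m (λ a → E (k a) f) (λ a → E (k a) g))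
  ; E-*      = λ c f → trans (E-cong m (λ a → E-* (k a) c f)) (E-* m c (λ a → E (k a) f))
  ; E-const  = λ c → trans (E-cong m (λ a → E-const (k a) c)) (E-const m c)
  ; attained = λ f → let a , p = attained m (λ a → E (k a) f)
                         b , q = attained (k a) f
                     in  b , ℚₚ.≤-trans p q }

mapᴹ : (A → B) → Mean A → Mean B
mapᴹ h m = bind m (dirac ∘ h)

½+½ : ∀ p → ½ * (p + p) ≡ p
½+½ = solve-∀ ring

coin : Mean Bool
coin = record
  { E        = λ f → ½ * (f false + f true)
  ; E-mono   = λ f≤g → *-mono 0≤½ (ℚₚ.+-mono-≤ (f≤g false) (f≤g true))
  ; E-+      = λ f g → eq₁ (f false) (f true) (g false) (g true)
  ; E-*      = λ c f → eq₂ c (f false) (f true)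
  ; E-const  = ½+½
  ; attained = att }
  where
  eq₁ : ∀ p q r s → ½ * ((p + r) + (q + s)) ≡ ½ * (p + q) + ½ * (r + s)
  eq₁ = solve-∀ ring
  eq₂ : ∀ c p q → ½ * (c * p + c * q) ≡ c * (½ * (p + q))
  eq₂ = solve-∀ ring
  att : ∀ f → ∃[ b ] ½ * (f false + f true) ≤ f b
  att f with ℚₚ.≤-total (f false) (f true)
  ... | inj₁ p = true  , subst (½ * (f false + f true) ≤_) (½+½ (f true))
                           (*-mono 0≤½ (ℚₚ.+-monoˡ-≤ (f true) p))
  ... | inj₂ p = false , subst (½ * (f false + f true) ≤_) (½+½ (f false))
                           (*-mono 0≤½ (ℚₚ.+-monoʳ-≤ (f false) p))

-- Fubini. A coin is an explicit combination of two values, so linearity of the other mean suffices;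
-- `uniform-swap` iterates this over the coordinates.
coin-swap : ∀ (m : Mean A) (f : Bool → A → ℚ) → E coin (λ b → E m (f b)) ≡ E m (λ a → E coin (λ b → f b a))
coin-swap m f = sym (trans (E-* m ½ (λ a → f false a + f true a))
  (cong (½ *_) (E-+ m (f false) (f true))))

uniform : ∀ d → Mean (Cube d)
uniform zero    = dirac []
uniform (suc d) = bind coin (λ b → mapᴹ (b ∷_) (uniform d))

uniform-swap : ∀ d (m : Mean A) (f : Cube d → A → ℚ) →
  E (uniform d) (λ x → E m (f x)) ≡ E m (λ a → E (uniform d) (λ x → f x a))
uniform-swap zero    m f = refl
uniform-swap (suc d) m f = trans
  (E-cong coin {g = λ b → E m (λ a → E (uniform d) (λ x → f (b ∷ x) a))}
    (λ b → uniform-swap d m (λ x → f (b ∷ x))))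
  (coin-swap m (λ b a → E (uniform d) (λ x → f (b ∷ x) a)))

∑-cube-suc : ∀ d f → ∑ (cube (suc d)) f ≡ ∑ (cube d) (f ∘ (false ∷_)) + ∑ (cube d) (f ∘ (true ∷_))
∑-cube-suc d f = trans (∑-++ (map (false ∷_) (cube d)) _ f)
  (cong₂ _+_ (∑-map (false ∷_) (cube d) f) (∑-map (true ∷_) (cube d) f))

pow : ℕ → ℚ
pow k = nat (2 ℕ.^ k)

pow-suc : ∀ k → pow (suc k) ≡ pow k + pow k
pow-suc k = trans (cong nat (cong (2 ℕ.^ k ℕ.+_) (ℕₚ.+-identityʳ (2 ℕ.^ k)))) (nat-+ (2 ℕ.^ k) (2 ℕ.^ k))

0<pow : ∀ k → 0ℚ < pow k
0<pow k = 0<nat (2 ℕ.^ k) {{ℕₚ.m^n≢0 2 k}}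

∑-cube : ∀ d f → ∑ (cube d) f ≡ pow d * E (uniform d) f
∑-cube zero    f = eq (f [])
  where
  eq : ∀ x → x + 0ℚ ≡ (1ℚ + 0ℚ) * x
  eq = solve-∀ ring
∑-cube (suc d) f = begin
  ∑ (cube (suc d)) f
    ≡⟨ ∑-cube-suc d f ⟩
  ∑ (cube d) (f ∘ (false ∷_)) + ∑ (cube d) (f ∘ (true ∷_))
    ≡⟨ cong₂ _+_ (∑-cube d _) (∑-cube d _) ⟩
  pow d * E₀ + pow d * E₁
    ≡⟨ eq (pow d) E₀ E₁ ⟩
  (pow d + pow d) * (½ * (E₀ + E₁))
    ≡⟨ cong (_* (½ * (E₀ + E₁))) (pow-suc d) ⟨
  pow (suc d) * E (uniform (suc d)) f
    ∎
  where
  open ≡-Reasoning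
  E₀ = E (uniform d) (f ∘ (false ∷_))
  E₁ = E (uniform d) (f ∘ (true ∷_))
  eq : ∀ p x y → p * x + p * y ≡ (p + p) * (½ * (x + y))
  eq = solve-∀ ring

-- Pairs of points of the cube at a given level

-- The uniform distribution on the pairs at level `ℓ`, smaller point first; `∑∑-precedes` confirms
-- this.
levelMean : ∀ {d} → Fin d → Mean (Cube d × Cube d)
levelMean {suc d} zero    =
  bind (uniform d) (λ x → mapᴹ (λ y → false ∷ x , true ∷ y) (uniform d))
levelMean {suc d} (suc ℓ) =
  bind coin (λ b → mapᴹ (λ p → b ∷ proj₁ p , b ∷ proj₂ p) (levelMean ℓ))

-- Combines `x ≺ y` and `IsDelta x y ℓ` in one Boolean that computes coordinate by coordinate, which
-- suits induction on the dimension.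
precedes : ∀ {d} → Fin d → Cube d → Cube d → Bool
precedes zero    (b ∷ x) (c ∷ y) = not b ∧ c
precedes (suc ℓ) (b ∷ x) (c ∷ y) = not (b xor c) ∧ precedes ℓ x y

precedes⇒IsDelta : ∀ {d} (ℓ : Fin d) x y → T (precedes ℓ x y) → IsDelta x y ℓ × lookup x ℓ ≡ false
precedes⇒IsDelta zero (false ∷ x) (true ∷ y) _ = ((λ ()) , λ _ ()) , refl
precedes⇒IsDelta (suc ℓ) (b ∷ x) (c ∷ y) p with b | c
... | false | false = let (≢ , agree) , eq = precedes⇒IsDelta ℓ x y p
                      in  (≢ , λ { zero _ → refl ; (suc i) (ℕ.s≤s i<ℓ) → agree i i<ℓ }) , eq
... | true  | true  = let (≢ , agree) , eq = precedes⇒IsDelta ℓ x y p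
                      in  (≢ , λ { zero _ → refl ; (suc i) (ℕ.s≤s i<ℓ) → agree i i<ℓ }) , eq

IsDelta⇒precedes : ∀ {d} (ℓ : Fin d) x y → IsDelta x y ℓ → lookup x ℓ ≡ false → T (precedes ℓ x y)
IsDelta⇒precedes zero (false ∷ x) (false ∷ y) (≢ , _) _ = ≢ refl
IsDelta⇒precedes zero (false ∷ x) (true ∷ y) _ _ = tt
IsDelta⇒precedes (suc ℓ) (b ∷ x) (c ∷ y) (≢ , agree) eq
  with b | c | agree zero (ℕ.s≤s ℕ.z≤n)
... | false | .false | refl = IsDelta⇒precedes ℓ x y (≢ , λ i i<ℓ → agree (suc i) (ℕ.s≤s i<ℓ)) eq
... | true  | .true  | refl = IsDelta⇒precedes ℓ x y (≢ , λ i i<ℓ → agree (suc i) (ℕ.s≤s i<ℓ)) eq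

IsDelta-unique : ∀ {d} (x y : Cube d) {k ℓ} → IsDelta x y k → IsDelta x y ℓ → k ≡ ℓ
IsDelta-unique x y {k} {ℓ} (≢ₖ , agreeₖ) (≢ₗ , agreeₗ) with Finₚ.<-cmp k ℓ
... | tri< k<ℓ _ _ = contradiction (agreeₗ k k<ℓ) ≢ₖ
... | tri≈ _ k≡ℓ _ = k≡ℓ
... | tri> _ _ ℓ<k = contradiction (agreeₖ ℓ ℓ<k) ≢ₗ

precedes⇔ : ∀ {d} (ℓ : Fin d) x y → T (precedes ℓ x y) ⇔ (x ≺ y × IsDelta x y ℓ)
precedes⇔ ℓ x y = mk⇔
  (λ p → let δ , eq = precedes⇒IsDelta ℓ x y p in (ℓ , δ , eq) , δ)
  (λ { ((k , δₖ , eq) , δ) → IsDelta⇒precedes ℓ x y δ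
         (subst (λ i → lookup x i ≡ false) (IsDelta-unique x y δₖ δ) eq) })

τ-zero : ∀ d → nat (τ (suc d) zero) ≡ pow d * pow d
τ-zero d = trans (cong (λ k → nat (2 ℕ.^ k)) eq)
  (trans (cong nat (ℕₚ.^-distribˡ-+-* 2 d d)) (nat-* (2 ℕ.^ d) (2 ℕ.^ d)))
  where
  eq : 2 ℕ.* suc d ℕ.∸ 1 ℕ.∸ 1 ≡ d ℕ.+ d
  eq = trans (cong (ℕ._∸ 1) (ℕₚ.+-suc d (d ℕ.+ 0))) (cong (d ℕ.+_) (ℕₚ.+-identityʳ d))

τ-suc : ∀ d (ℓ : Fin d) → nat (τ (suc d) (suc ℓ)) ≡ nat (τ d ℓ) + nat (τ d ℓ)
τ-suc d ℓ = trans (cong (λ k → nat (2 ℕ.^ k)) eq) (pow-suc (2 ℕ.* d ℕ.∸ suc (toℕ ℓ) ℕ.∸ 1))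
  where
  -- `τ` is written with truncated subtraction. By this inequality nothing is cut off, and raising
  -- both `d` and the level by one raises the exponent by exactly one.
  ℓ+2≤2d : suc (toℕ ℓ) ℕ.+ 1 ℕ.≤ 2 ℕ.* d
  ℓ+2≤2d = ℕₚ.+-mono-≤ (Finₚ.toℕ<n ℓ)
    (ℕₚ.≤-trans (ℕ.s≤s ℕ.z≤n) (ℕₚ.≤-trans (Finₚ.toℕ<n ℓ) (ℕₚ.m≤m+n d 0)))
  eq : 2 ℕ.* suc d ℕ.∸ suc (suc (toℕ ℓ)) ℕ.∸ 1 ≡ suc (2 ℕ.* d ℕ.∸ suc (toℕ ℓ) ℕ.∸ 1)
  eq = begin
    2 ℕ.* suc d ℕ.∸ suc (suc (toℕ ℓ)) ℕ.∸ 1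
      ≡⟨ cong (λ k → k ℕ.∸ suc (toℕ ℓ) ℕ.∸ 1) (ℕₚ.+-suc d (d ℕ.+ 0)) ⟩
    suc (2 ℕ.* d) ℕ.∸ suc (toℕ ℓ) ℕ.∸ 1
      ≡⟨ ℕₚ.∸-+-assoc (suc (2 ℕ.* d)) (suc (toℕ ℓ)) 1 ⟩
    suc (2 ℕ.* d) ℕ.∸ (suc (toℕ ℓ) ℕ.+ 1)
      ≡⟨ ℕₚ.+-∸-assoc 1 ℓ+2≤2d ⟩
    suc (2 ℕ.* d ℕ.∸ (suc (toℕ ℓ) ℕ.+ 1))
      ≡⟨ cong suc (ℕₚ.∸-+-assoc (2 ℕ.* d) (suc (toℕ ℓ)) 1) ⟨
    suc (2 ℕ.* d ℕ.∸ suc (toℕ ℓ) ℕ.∸ 1)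
      ∎
    where open ≡-Reasoning

∑∑ : ∀ d → (Cube d → Cube d → ℚ) → ℚ
∑∑ d h = ∑ (cube d) (λ x → ∑ (cube d) (h x))

∑∑-cong : ∀ d {g h} → (∀ x y → g x y ≡ h x y) → ∑∑ d g ≡ ∑∑ d h
∑∑-cong d g≗h = ∑-cong (cube d) (λ x → ∑-cong (cube d) (g≗h x))

∑∑-zero : ∀ d {h} → (∀ x y → h x y ≡ 0ℚ) → ∑∑ d h ≡ 0ℚ
∑∑-zero d h≗0 = trans (∑-cong (cube d) (λ x → trans (∑-cong (cube d) (h≗0 x)) (∑-zero (cube d))))
                      (∑-zero (cube d))

∑∑-suc : ∀ d h → ∑∑ (suc d) h ≡
  (∑∑ d (λ x y → h (false ∷ x) (false ∷ y)) + ∑∑ d (λ x y → h (false ∷ x) (true ∷ y))) +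
  (∑∑ d (λ x y → h (true ∷ x) (false ∷ y)) + ∑∑ d (λ x y → h (true ∷ x) (true ∷ y)))
∑∑-suc d h = trans (∑-cube-suc d (λ x → ∑ (cube (suc d)) (h x))) (cong₂ _+_ (row false) (row true))
  where
  row : ∀ b → ∑ (cube d) (λ x → ∑ (cube (suc d)) (h (b ∷ x))) ≡
        ∑∑ d (λ x y → h (b ∷ x) (false ∷ y)) + ∑∑ d (λ x y → h (b ∷ x) (true ∷ y))
  row b = trans (∑-cong (cube d) (λ x → ∑-cube-suc d (h (b ∷ x))))
    (∑-+ (cube d) (λ x → ∑ (cube d) (λ y → h (b ∷ x) (false ∷ y)))
                  (λ x → ∑ (cube d) (λ y → h (b ∷ x) (true ∷ y))))

∑∑-uniform : ∀ d h → ∑∑ d h ≡ pow d * pow d * E (uniform d) (λ x → E (uniform d) (h x))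
∑∑-uniform d h = begin
  ∑∑ d h
    ≡⟨ ∑-cong (cube d) (λ x → ∑-cube d (h x)) ⟩
  ∑ (cube d) (λ x → pow d * E (uniform d) (h x))
    ≡⟨ ∑-* (cube d) (pow d) (λ x → E (uniform d) (h x)) ⟩
  pow d * ∑ (cube d) (λ x → E (uniform d) (h x))
    ≡⟨ cong (pow d *_) (∑-cube d (λ x → E (uniform d) (h x))) ⟩
  pow d * (pow d * E (uniform d) (λ x → E (uniform d) (h x)))
    ≡⟨ ℚₚ.*-assoc (pow d) (pow d) (E (uniform d) (λ x → E (uniform d) (h x))) ⟨
  pow d * pow d * E (uniform d) (λ x → E (uniform d) (h x))
    ∎
  where open ≡-Reasoning

0+p : ∀ p q r s → p ≡ 0ℚ → q ≡ 0ℚ → s ≡ 0ℚ → (p + r) + (q + s) ≡ r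
0+p .0ℚ .0ℚ r .0ℚ refl refl refl = eq r
  where
  eq : ∀ r → (0ℚ + r) + (0ℚ + 0ℚ) ≡ r
  eq = solve-∀ ring

-- The first bits divide the pairs into four quadrants. At level zero only the quadrant (false,
-- true) contributes, at later levels only the two diagonal ones.
∑∑-precedes : ∀ {d} (ℓ : Fin d) h →
  ∑∑ d (λ x y → ⟦ precedes ℓ x y ⟧ * h x y) ≡ nat (τ d ℓ) * E (levelMean ℓ) (uncurry h)
∑∑-precedes {suc d} zero h = begin
  ∑∑ (suc d) g
    ≡⟨ ∑∑-suc d g ⟩
  (∑∑ d (λ x y → g (false ∷ x) (false ∷ y)) + ∑∑ d (λ x y → g (false ∷ x) (true ∷ y))) +
  (∑∑ d (λ x y → g (true ∷ x) (false ∷ y)) + ∑∑ d (λ x y → g (true ∷ x) (true ∷ y)))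
    ≡⟨ 0+p (∑∑ d (λ x y → g (false ∷ x) (false ∷ y))) (∑∑ d (λ x y → g (true ∷ x) (false ∷ y)))
           (∑∑ d (λ x y → g (false ∷ x) (true ∷ y))) (∑∑ d (λ x y → g (true ∷ x) (true ∷ y)))
           (∑∑-zero d (λ x y → ℚₚ.*-zeroˡ (h (false ∷ x) (false ∷ y))))
           (∑∑-zero d (λ x y → ℚₚ.*-zeroˡ (h (true ∷ x) (false ∷ y))))
           (∑∑-zero d (λ x y → ℚₚ.*-zeroˡ (h (true ∷ x) (true ∷ y)))) ⟩
  ∑∑ d (λ x y → g (false ∷ x) (true ∷ y))
    ≡⟨ ∑∑-cong d (λ x y → ℚₚ.*-identityˡ (h (false ∷ x) (true ∷ y))) ⟩
  ∑∑ d (λ x y → h (false ∷ x) (true ∷ y))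
    ≡⟨ ∑∑-uniform d (λ x y → h (false ∷ x) (true ∷ y)) ⟩
  pow d * pow d * E (levelMean zero) (uncurry h)
    ≡⟨ cong (_* E (levelMean zero) (uncurry h)) (τ-zero d) ⟨
  nat (τ (suc d) zero) * E (levelMean zero) (uncurry h)
    ∎
  where
  open ≡-Reasoning
  g = λ x y → ⟦ precedes zero x y ⟧ * h x y
∑∑-precedes {suc d} (suc ℓ) h = begin
  ∑∑ (suc d) g
    ≡⟨ ∑∑-suc d g ⟩
  (∑∑ d (λ x y → g (false ∷ x) (false ∷ y)) + ∑∑ d (λ x y → g (false ∷ x) (true ∷ y))) +
  (∑∑ d (λ x y → g (true ∷ x) (false ∷ y)) + ∑∑ d (λ x y → g (true ∷ x) (true ∷ y)))
    ≡⟨ eq₁ (∑∑-zero d (λ x y → ℚₚ.*-zeroˡ (h (false ∷ x) (true ∷ y))))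
           (∑∑-zero d (λ x y → ℚₚ.*-zeroˡ (h (true ∷ x) (false ∷ y))))
           (∑∑-precedes ℓ (λ x y → h (false ∷ x) (false ∷ y)))
           (∑∑-precedes ℓ (λ x y → h (true ∷ x) (true ∷ y))) ⟩
  (t * E₀ + 0ℚ) + (0ℚ + t * E₁)
    ≡⟨ eq₂ t E₀ E₁ ⟩
  (t + t) * (½ * (E₀ + E₁))
    ≡⟨ cong (_* (½ * (E₀ + E₁))) (τ-suc d ℓ) ⟨
  nat (τ (suc d) (suc ℓ)) * (½ * (E₀ + E₁))
    ∎
  where
  open ≡-Reasoning
  g = λ x y → ⟦ precedes (suc ℓ) x y ⟧ * h x y
  t  = nat (τ d ℓ)
  E₀ = E (levelMean ℓ) (λ p → h (false ∷ proj₁ p) (false ∷ proj₂ p))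
  E₁ = E (levelMean ℓ) (λ p → h (true ∷ proj₁ p) (true ∷ proj₂ p))
  eq₁ : ∀ {p q r s p′ q′ r′ s′} → q ≡ q′ → r ≡ r′ → p ≡ p′ → s ≡ s′ →
        (p + q) + (r + s) ≡ (p′ + q′) + (r′ + s′)
  eq₁ refl refl refl refl = refl
  eq₂ : ∀ t p q → (t * p + 0ℚ) + (0ℚ + t * q) ≡ (t + t) * (½ * (p + q))
  eq₂ = solve-∀ ring

density-level : ∀ {d} → Graph (Cube d) → Fin d → ℚ
density-level H ℓ = E (levelMean ℓ) (λ p → ⟦ adj H (proj₁ p) (proj₂ p) ⟧)

levelEdges≡ : ∀ {d} (H : Graph (Cube d)) ℓ →
              nat (levelEdges H ℓ) ≡ nat (τ d ℓ) * density-level H ℓ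
levelEdges≡ {d} H ℓ = begin
  nat (levelEdges H ℓ)
    ≡⟨ length-filter (λ p → (proj₁ p ≺? proj₂ p) ×-dec isDelta? (proj₁ p) (proj₂ p) ℓ ×-dec
                            T? (adj H (proj₁ p) (proj₂ p))) (cartesianProduct (cube d) (cube d)) ⟩
  ∑ (cartesianProduct (cube d) (cube d)) _
    ≡⟨ ∑-cartesianProduct (cube d) (cube d) _ ⟩
  ∑∑ d (λ x y → ⟦ does (x ≺? y) ∧ does (isDelta? x y ℓ) ∧ adj H x y ⟧)
    ≡⟨ ∑∑-cong d indicator ⟩
  ∑∑ d (λ x y → ⟦ precedes ℓ x y ⟧ * ⟦ adj H x y ⟧)
    ≡⟨ ∑∑-precedes ℓ (λ x y → ⟦ adj H x y ⟧) ⟩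
  nat (τ d ℓ) * density-level H ℓ
    ∎
  where
  open ≡-Reasoning
  indicator : ∀ x y → ⟦ does (x ≺? y) ∧ does (isDelta? x y ℓ) ∧ adj H x y ⟧ ≡
                      ⟦ precedes ℓ x y ⟧ * ⟦ adj H x y ⟧
  indicator x y = trans (cong ⟦_⟧ (trans
      (sym (Boolₚ.∧-assoc (does (x ≺? y)) (does (isDelta? x y ℓ)) (adj H x y)))
      (cong (_∧ adj H x y) (does-⇔ (mk⇔ (Equivalence.from (precedes⇔ ℓ x y)) (Equivalence.to (precedes⇔ ℓ x y)))
                                   ((x ≺? y) ×-dec isDelta? x y ℓ) (T? (precedes ℓ x y))))))
    (⟦∧⟧ (precedes ℓ x y) (adj H x y))

levelEdges/τ : ∀ {d} (H : Graph (Cube d)) ℓ →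
  (ℤ.+ levelEdges H ℓ / τ d ℓ) {{τ-nonZero d ℓ}} ≡ density-level H ℓ
levelEdges/τ {d} H ℓ = ℚₚ.≤-antisym
  (*-cancel-≤ (0<nat (τ d ℓ)) (ℚₚ.≤-reflexive eq)) (*-cancel-≤ (0<nat (τ d ℓ)) (ℚₚ.≤-reflexive (sym eq)))
  where
  instance _ = τ-nonZero d ℓ
  eq = trans (/-nat (levelEdges H ℓ) (τ d ℓ)) (levelEdges≡ H ℓ)

-- Forcing a bit at a random level

-- The point that branches off from `x` to the left at level `ℓ`; its later bits are the fresh ones
-- of `z`.
splice : ∀ {d} → Fin d → Cube d → Cube d → Cube d
splice zero    (b ∷ x) (c ∷ z) = false ∷ z
splice (suc ℓ) (b ∷ x) (c ∷ z) = b ∷ splice ℓ x z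

coin-const : ∀ p → E coin (λ _ → p) ≡ p
coin-const = ½+½

-- The bits of a uniform point after `ℓ` are independent of those before, so exchanging them for the
-- bits of `z` does not alter the distribution.
uniform-splice : ∀ {d} (ℓ : Fin d) g →
  E (uniform d) (λ x → E (uniform d) (λ z → g (splice ℓ x z))) ≡ E (uniform d) (λ x → g (x [ ℓ ]≔ false))
uniform-splice {suc d} zero g = trans
  (trans (E-cong (uniform (suc d)) {f = λ x → E (uniform (suc d)) (λ z → g (splice zero x z))} {g = λ _ → G}
    (λ { (b ∷ x) → coin-const G })) (E-const (uniform (suc d)) G))
  (sym (coin-const G))
  where G = E (uniform d) (λ z → g (false ∷ z))
uniform-splice {suc d} (suc ℓ) g = E-cong coin
  {f = λ b → E (uniform d) (λ x → E coin (λ _ → E (uniform d) (λ z → g (b ∷ splice ℓ x z))))}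
  (λ b → trans (E-cong (uniform d) (λ x → coin-const (E (uniform d) (λ z → g (b ∷ splice ℓ x z)))))
               (uniform-splice ℓ (λ x → g (b ∷ x))))

-- The two points share the bits before `ℓ`, differ at `ℓ` and have independent bits afterwards,
-- exactly as in `levelMean`. Hence the mean over a level becomes the mean of a function of a single
-- uniform point `x`.
levelMean-splice : ∀ {d} (ℓ : Fin d) h →
  E (uniform d) (λ x → E (uniform d) (λ z → h (splice ℓ x z) (x [ ℓ ]≔ true))) ≡
  E (levelMean ℓ) (uncurry h)
levelMean-splice {suc d} zero h = trans (coin-const G)
  (trans (E-cong (uniform d) (λ x → coin-const (E (uniform d) (λ z → h (false ∷ z) (true ∷ x)))))
         (uniform-swap d (uniform d) (λ x z → h (false ∷ z) (true ∷ x))))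
  where G = E (uniform d) (λ x → E coin (λ _ → E (uniform d) (λ z → h (false ∷ z) (true ∷ x))))
levelMean-splice {suc d} (suc ℓ) h = E-cong coin
  {f = λ b → E (uniform d) (λ x → E coin (λ _ → E (uniform d) (λ z → h (b ∷ splice ℓ x z) (b ∷ x [ ℓ ]≔ true))))}
  (λ b → trans
    (E-cong (uniform d) (λ x → coin-const (E (uniform d) (λ z → h (b ∷ splice ℓ x z) (b ∷ x [ ℓ ]≔ true)))))
    (levelMean-splice ℓ (λ x y → h (b ∷ x) (b ∷ y))))

sign : Bool → ℚ
sign true  = 1ℚ
sign false = - 1ℚ

-- The Rademacher function of coordinate `ℓ`, that is, the Walsh character of a single bit.
χ : ∀ {d} → Fin d → Cube d → ℚ
χ ℓ x = sign (lookup x ℓ)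

sign² : ∀ b → sign b * sign b ≡ 1ℚ
sign² true  = refl
sign² false = refl

-- A Fourier coefficient at level ℓ measures the effect of forcing the bit ℓ.
E-χ : ∀ {d} (ℓ : Fin d) c f →
  sign c * E (uniform d) (λ x → f x * χ ℓ x) ≡ E (uniform d) (λ x → f (x [ ℓ ]≔ c)) - E (uniform d) f
E-χ {suc d} zero c f = trans
  (cong (λ p → sign c * (½ * p))
    (cong₂ _+_ (scale false) (scale true)))
  (case c)
  where
  F₀ = E (uniform d) (λ x → f (false ∷ x))
  F₁ = E (uniform d) (λ x → f (true ∷ x))
  scale : ∀ b → E (uniform d) (λ x → f (b ∷ x) * sign b) ≡ sign b * E (uniform d) (λ x → f (b ∷ x))
  scale b = trans (E-cong (uniform d) (λ x → ℚₚ.*-comm (f (b ∷ x)) (sign b)))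
                  (E-* (uniform d) (sign b) (λ x → f (b ∷ x)))
  eq₁ : ∀ p q → 1ℚ * (½ * (- 1ℚ * p + 1ℚ * q)) ≡ ½ * (q + q) - ½ * (p + q)
  eq₁ = solve-∀ ring
  eq₀ : ∀ p q → - 1ℚ * (½ * (- 1ℚ * p + 1ℚ * q)) ≡ ½ * (p + p) - ½ * (p + q)
  eq₀ = solve-∀ ring
  case : ∀ c → sign c * (½ * (sign false * F₀ + sign true * F₁)) ≡
         E (uniform (suc d)) (λ x → f (x [ zero ]≔ c)) - ½ * (F₀ + F₁)
  case true  = eq₁ F₀ F₁
  case false = eq₀ F₀ F₁
E-χ {suc d} (suc ℓ) c f = trans (eq (sign c) (F false) (F true))
  (trans (cong₂ (λ p q → ½ * (p + q)) (E-χ ℓ c (λ x → f (false ∷ x))) (E-χ ℓ c (λ x → f (true ∷ x))))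
         (eq′ (G false) (E (uniform d) (λ x → f (false ∷ x))) (G true) (E (uniform d) (λ x → f (true ∷ x)))))
  where
  F G : Bool → ℚ
  F b = E (uniform d) (λ x → f (b ∷ x) * χ ℓ x)
  G b = E (uniform d) (λ x → f (b ∷ x [ ℓ ]≔ c))
  eq : ∀ s p q → s * (½ * (p + q)) ≡ ½ * (s * p + s * q)
  eq = solve-∀ ring
  eq′ : ∀ p q r s → ½ * ((p - q) + (r - s)) ≡ ½ * (p + r) - ½ * (q + s)
  eq′ = solve-∀ ring

-- By `E-χ` the correlation is the effect on `χ k` of forcing the bit `ℓ`, which `χ k` does not see.
χ-orthogonal : ∀ {d} {k ℓ : Fin d} → k ≢ ℓ → E (uniform d) (λ x → χ k x * χ ℓ x) ≡ 0ℚ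
χ-orthogonal {d} {k} {ℓ} k≢ℓ = begin
  E (uniform d) (λ x → χ k x * χ ℓ x)
    ≡⟨ ℚₚ.*-identityˡ _ ⟨
  1ℚ * E (uniform d) (λ x → χ k x * χ ℓ x)
    ≡⟨ E-χ ℓ true (χ k) ⟩
  E (uniform d) (λ x → χ k (x [ ℓ ]≔ true)) - E (uniform d) (χ k)
    ≡⟨ cong (_- E (uniform d) (χ k)) (E-cong (uniform d) (λ x → cong sign (Vecₚ.lookup∘update′ k≢ℓ x true))) ⟩
  E (uniform d) (χ k) - E (uniform d) (χ k)
    ≡⟨ ℚₚ.+-inverseʳ (E (uniform d) (χ k)) ⟩
  0ℚ
    ∎
  where open ≡-Reasoning

half : ℕ → ℚ
half zero    = 1ℚ
half (suc k) = ½ * half k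

half-+ : ∀ j k → half (j ℕ.+ k) ≡ half j * half k
half-+ zero    k = sym (ℚₚ.*-identityˡ (half k))
half-+ (suc j) k = trans (cong (½ *_) (half-+ j k)) (sym (ℚₚ.*-assoc ½ (half j) (half k)))

0<half : ∀ k → 0ℚ < half k
0<half zero    = ℚₚ.positive⁻¹ 1ℚ
0<half (suc k) = 0<* (ℚₚ.positive⁻¹ ½) (0<half k)

-- An average of Rademacher functions. Forcing a bit at a random one of the levels `lev a` changes
-- the mean of `g` by the correlation of `g` with this one function, up to sign.
bias : ∀ {d} j → (Cube j → Fin d) → Cube d → ℚ
bias j lev x = E (uniform j) (λ a → χ (lev a) x)

bias-orthogonal : ∀ {d} i j (k : Cube i → Fin d) (ℓ : Cube j → Fin d) → (∀ a b → k a ≢ ℓ b) →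
  E (uniform d) (λ x → bias i k x * bias j ℓ x) ≡ 0ℚ
bias-orthogonal {d} i j k ℓ k≢ℓ = begin
  E (uniform d) (λ x → bias i k x * bias j ℓ x)
    ≡⟨ E-cong (uniform d) (λ x → trans (ℚₚ.*-comm (bias i k x) (bias j ℓ x))
                                       (sym (E-* (uniform i) (bias j ℓ x) (λ a → χ (k a) x)))) ⟩
  E (uniform d) (λ x → E (uniform i) (λ a → bias j ℓ x * χ (k a) x))
    ≡⟨ uniform-swap d (uniform i) (λ x a → bias j ℓ x * χ (k a) x) ⟩
  E (uniform i) (λ a → E (uniform d) (λ x → bias j ℓ x * χ (k a) x))
    ≡⟨ E-cong (uniform i) inner ⟩
  E (uniform i) (λ _ → 0ℚ)
    ≡⟨ E-const (uniform i) 0ℚ ⟩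
  0ℚ
    ∎
  where
  open ≡-Reasoning
  inner : ∀ a → E (uniform d) (λ x → bias j ℓ x * χ (k a) x) ≡ 0ℚ
  inner a = begin
    E (uniform d) (λ x → bias j ℓ x * χ (k a) x)
      ≡⟨ E-cong (uniform d) (λ x → trans (ℚₚ.*-comm (bias j ℓ x) (χ (k a) x))
                                         (sym (E-* (uniform j) (χ (k a) x) (λ b → χ (ℓ b) x)))) ⟩
    E (uniform d) (λ x → E (uniform j) (λ b → χ (k a) x * χ (ℓ b) x))
      ≡⟨ uniform-swap d (uniform j) (λ x b → χ (k a) x * χ (ℓ b) x) ⟩
    E (uniform j) (λ b → E (uniform d) (λ x → χ (k a) x * χ (ℓ b) x))
      ≡⟨ E-cong (uniform j) (λ b → χ-orthogonal (k≢ℓ a b)) ⟩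
    E (uniform j) (λ _ → 0ℚ)
      ≡⟨ E-const (uniform j) 0ℚ ⟩
    0ℚ
      ∎

-- The variance of an average of `2^j` orthonormal functions. Halving the index cube gives two
-- orthogonal averages, each of mean square `half j`.
E-bias² : ∀ {d} j (lev : Cube j → Fin d) → (∀ {a b} → lev a ≡ lev b → a ≡ b) →
  E (uniform d) (λ x → bias j lev x * bias j lev x) ≡ half j
E-bias² {d} zero    lev inj = trans (E-cong (uniform d) (λ x → sign² (lookup x (lev [])))) (E-const (uniform d) 1ℚ)
E-bias² {d} (suc j) lev inj = begin
  E U (λ x → bias (suc j) lev x * bias (suc j) lev x)
    ≡⟨ E-cong U (λ x → expand (s₀ x) (s₁ x)) ⟩
  E U (λ x → ½ * ½ * ((s₀ x * s₀ x + s₁ x * s₁ x) + (s₀ x * s₁ x + s₀ x * s₁ x)))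
    ≡⟨ E-* U (½ * ½) (λ x → (s₀ x * s₀ x + s₁ x * s₁ x) + (s₀ x * s₁ x + s₀ x * s₁ x)) ⟩
  ½ * ½ * E U (λ x → (s₀ x * s₀ x + s₁ x * s₁ x) + (s₀ x * s₁ x + s₀ x * s₁ x))
    ≡⟨ cong (½ * ½ *_) (trans (E-+ U (λ x → s₀ x * s₀ x + s₁ x * s₁ x) (λ x → s₀ x * s₁ x + s₀ x * s₁ x))
         (cong₂ _+_ (trans (E-+ U (λ x → s₀ x * s₀ x) (λ x → s₁ x * s₁ x))
                           (cong₂ _+_ (E-bias² j _ (λ e → ∷-inj (inj e))) (E-bias² j _ (λ e → ∷-inj (inj e)))))
                    (trans (E-+ U (λ x → s₀ x * s₁ x) (λ x → s₀ x * s₁ x)) (cong₂ _+_ cross cross)))) ⟩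
  ½ * ½ * ((half j + half j) + (0ℚ + 0ℚ))
    ≡⟨ collapse (half j) ⟩
  half (suc j)
    ∎
  where
  open ≡-Reasoning
  U = uniform d
  s₀ = bias j (lev ∘ (false ∷_))
  s₁ = bias j (lev ∘ (true ∷_))
  ∷-inj : ∀ {n} {b c : Bool} {x y : Cube n} → b ∷ x ≡ c ∷ y → x ≡ y
  ∷-inj refl = refl
  cross : E U (λ x → s₀ x * s₁ x) ≡ 0ℚ
  cross = bias-orthogonal j j (lev ∘ (false ∷_)) (lev ∘ (true ∷_)) (λ a b e → case inj e of λ ())
  expand : ∀ p q → (½ * (p + q)) * (½ * (p + q)) ≡ ½ * ½ * ((p * p + q * q) + (p * q + p * q))
  expand = solve-∀ ring
  collapse : ∀ p → ½ * ½ * ((p + p) + (0ℚ + 0ℚ)) ≡ ½ * p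
  collapse = solve-∀ ring

-- The loss is E (g · bias), which Cauchy-Schwarz bounds by the standard deviation of bias.
force-bit : ∀ {d} k (lev : Cube (k ℕ.+ k) → Fin d) → (∀ {a b} → lev a ≡ lev b → a ≡ b) →
  ∀ c (g : Cube d → ℚ) → (∀ x → 0ℚ ≤ g x) → (∀ x → g x ≤ 1ℚ) →
  E (uniform d) g - half k ≤ E (uniform (k ℕ.+ k)) (λ a → E (uniform d) (λ x → g (x [ lev a ]≔ c)))
force-bit {d} k lev inj c g 0≤g g≤1 = ≤-by (≤⇒0≤- -ε≤W) (trans (p≡q+[p-q] _ (E U g)) (trans (cong (E U g +_) (sym W≡)) (eq (E U g) ε W)))
  where
  U = uniform d
  ε = half k
  -- With `4^k` levels the mean square of `s` is `ε * ε`, the square of a rational.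
  j = k ℕ.+ k
  s = bias j lev
  W = sign c * E U (λ x → g x * s x)
  p≡q+[p-q] : ∀ p q → p ≡ q + (p - q)
  p≡q+[p-q] = solve-∀ ring
  eq : ∀ p e w → p + w ≡ (p - e) + (w - - e)
  eq = solve-∀ ring
  W≡ : W ≡ E (uniform j) (λ a → E U (λ x → g (x [ lev a ]≔ c))) - E U g
  W≡ = begin
    sign c * E U (λ x → g x * s x)
      ≡⟨ cong (sign c *_) (E-cong U (λ x → sym (E-* (uniform j) (g x) (λ a → χ (lev a) x)))) ⟩
    sign c * E U (λ x → E (uniform j) (λ a → g x * χ (lev a) x))
      ≡⟨ cong (sign c *_) (uniform-swap d (uniform j) (λ x a → g x * χ (lev a) x)) ⟩
    sign c * E (uniform j) (λ a → E U (λ x → g x * χ (lev a) x))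
      ≡⟨ E-* (uniform j) (sign c) (λ a → E U (λ x → g x * χ (lev a) x)) ⟨
    E (uniform j) (λ a → sign c * E U (λ x → g x * χ (lev a) x))
      ≡⟨ E-cong (uniform j) (λ a → E-χ (lev a) c g) ⟩
    E (uniform j) (λ a → E U (λ x → g (x [ lev a ]≔ c)) - E U g)
      ≡⟨ E-- (uniform j) (λ a → E U (λ x → g (x [ lev a ]≔ c))) (E U g) ⟩
    E (uniform j) (λ a → E U (λ x → g (x [ lev a ]≔ c))) - E U g
      ∎
    where open ≡-Reasoning
  σ = sign c
  -- Cauchy-Schwarz without square roots: as `σ² = 1`, the difference of the two sides is
  -- `(ε + σgs)² + (1 - g²)s²`. Taking means leaves `-2ε² ≤ 2εW`.
  pointwise : ∀ x → - 1ℚ * (ε * ε + s x * s x) ≤ (ε + ε) * (σ * (g x * s x))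
  pointwise x = ≤-by (0≤+ (0≤p² (ε + σ * (g x * s x)))
                          (0≤* (0≤* (≤⇒0≤- (g≤1 x)) (0≤+ 0≤1 (0≤g x))) (0≤p² (s x))))
    (trans (expand ε (g x) (s x) σ) (cong (λ w → - 1ℚ * (ε * ε + s x * s x) +
              ((ε + σ * (g x * s x)) * (ε + σ * (g x * s x)) + (1ℚ - g x) * (1ℚ + g x) * (s x * s x)) +
              (1ℚ - w) * (g x * s x * (g x * s x)))
            (sign² c)) ⟨trans⟩ drop (- 1ℚ * (ε * ε + s x * s x)) _ (g x * s x * (g x * s x)))
    where
    _⟨trans⟩_ = trans
    expand : ∀ e g s σ → (e + e) * (σ * (g * s)) ≡ - 1ℚ * (e * e + s * s) +
               ((e + σ * (g * s)) * (e + σ * (g * s)) + (1ℚ - g) * (1ℚ + g) * (s * s)) +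
               (1ℚ - σ * σ) * (g * s * (g * s))
    expand = solve-∀ ring
    drop : ∀ p q r → p + q + (1ℚ - 1ℚ) * r ≡ p + q
    drop = solve-∀ ring
  integrated : - 1ℚ * (ε * ε + ε * ε) ≤ (ε + ε) * W
  integrated = subst₂ _≤_ left right (E-mono U pointwise)
    where
    left = trans (E-* U (- 1ℚ) (λ x → ε * ε + s x * s x)) (cong (- 1ℚ *_)
             (trans (E-+ U (λ _ → ε * ε) (λ x → s x * s x))
                    (cong₂ _+_ (E-const U (ε * ε)) (trans (E-bias² j lev inj) (half-+ k k)))))
    right = trans (E-* U (ε + ε) (λ x → σ * (g x * s x))) (cong ((ε + ε) *_) (E-* U σ (λ x → g x * s x)))
  0<ε = 0<half k
  -ε≤W : - ε ≤ W
  -ε≤W = *-cancel-≤ (subst (_< ε + ε) (ℚₚ.+-identityʳ 0ℚ) (ℚₚ.+-mono-< 0<ε 0<ε))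
           (subst (_≤ (ε + ε) * W) (eq′ ε) integrated)
    where
    eq′ : ∀ e → - 1ℚ * (e * e + e * e) ≡ (e + e) * - e
    eq′ = solve-∀ ring

-- Random combs

precedes-splice : ∀ {d} (ℓ : Fin d) x z → T (precedes ℓ (splice ℓ x z) (x [ ℓ ]≔ true))
precedes-splice zero    (b ∷ x)     (c ∷ z) = tt
precedes-splice (suc ℓ) (false ∷ x) (c ∷ z) = precedes-splice ℓ x z
precedes-splice (suc ℓ) (true ∷ x)  (c ∷ z) = precedes-splice ℓ x z

precedes-update : ∀ {d} {k ℓ : Fin d} {c} x y → k Fin.< ℓ → T (precedes ℓ x y) →
                  T (precedes ℓ (x [ k ]≔ c) (y [ k ]≔ c))
precedes-update {k = zero}  {suc ℓ} {false} (false ∷ x) (false ∷ y) _ p = p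
precedes-update {k = zero}  {suc ℓ} {true}  (false ∷ x) (false ∷ y) _ p = p
precedes-update {k = zero}  {suc ℓ} {false} (true ∷ x)  (true ∷ y)  _ p = p
precedes-update {k = zero}  {suc ℓ} {true}  (true ∷ x)  (true ∷ y)  _ p = p
precedes-update {k = suc k} {suc ℓ} (false ∷ x) (false ∷ y) (ℕ.s≤s k<ℓ) p = precedes-update x y k<ℓ p
precedes-update {k = suc k} {suc ℓ} (true ∷ x)  (true ∷ y)  (ℕ.s≤s k<ℓ) p = precedes-update x y k<ℓ p

-- Points that part only after level `k` share the bits that `splice k` takes from them.
splice-agree : ∀ {d} {k ℓ : Fin d} x y z → k Fin.< ℓ → T (precedes ℓ x y) → splice k x z ≡ splice k y z
splice-agree {k = zero}  {suc ℓ} (b ∷ x) (c ∷ y) (e ∷ z) _ p = refl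
splice-agree {k = suc k} {suc ℓ} (false ∷ x) (false ∷ y) (e ∷ z) (ℕ.s≤s k<ℓ) p =
  cong (false ∷_) (splice-agree x y z k<ℓ p)
splice-agree {k = suc k} {suc ℓ} (true ∷ x) (true ∷ y) (e ∷ z) (ℕ.s≤s k<ℓ) p =
  cong (true ∷_) (splice-agree x y z k<ℓ p)

splice-update : ∀ {d} {k ℓ : Fin d} {c} x z → k Fin.< ℓ → splice ℓ x z [ k ]≔ c ≡ splice ℓ (x [ k ]≔ c) z
splice-update {k = zero}  {suc ℓ} (b ∷ x) (e ∷ z) _ = refl
splice-update {k = suc k} {suc ℓ} (b ∷ x) (e ∷ z) (ℕ.s≤s k<ℓ) = cong (b ∷_) (splice-update x z k<ℓ)

-- The levels of a block are indexed by a cube, so that a random level of the block is a uniform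
-- point of `Cube j`.
Blocks : ℕ → ℕ → ℕ → Set
Blocks n j d = Fin n → Cube j → Fin d

record Comb {n j d} (lev : Blocks n j d) : Set where
  field
    point    : Fin (suc n) → Cube d
    separate : ∀ {u v} → u Fin.< v → ∃[ i ] ∃[ a ] T (precedes (lev i a) (point u) (point v))
open Comb public

Separated : ∀ {n j d} → Blocks n j d → Set
Separated lev = ∀ {i k} → i Fin.< k → ∀ a b → lev i a Fin.< lev k b

-- The points of `C` part at later levels, so each of them yields the same new point. Paired with
-- any `point C v`, the new point is thus a function of that point and `z`.
splice-point : ∀ {n j d} (lev : Blocks (suc n) j d) → Separated lev → ∀ a (C : Comb (lev ∘ suc)) z v →
               splice (lev zero a) (point C zero) z ≡ splice (lev zero a) (point C v) z
splice-point lev sep a C z zero    = refl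
splice-point lev sep a C z (suc v) = let i , b , p = separate C {zero} {suc v} (ℕ.s≤s ℕ.z≤n) in
  splice-agree (point C zero) (point C (suc v)) z (sep {zero} {suc i} (ℕ.s≤s ℕ.z≤n) a b) p

-- The new first point leaves the path common to the points of `C` at level `lev zero a`, going
-- left, and all of `C` is sent right there. This level precedes those of the later blocks, so the
-- old separations survive. Iterated, it gives a caterpillar in the binary tree.
grow : ∀ {n j d} (lev : Blocks (suc n) j d) → Separated lev →
       Cube j → Comb (lev ∘ suc) → Cube d → Comb lev
grow {n} lev sep a C z = record { point = pt ; separate = λ {u} {v} → separated u v }
  where
  ℓ = lev zero a
  pt : Fin (suc (suc n)) → _
  pt zero    = splice ℓ (point C zero) z
  pt (suc v) = point C v [ ℓ ]≔ true
  separated : ∀ u v → u Fin.< v → ∃[ i ] ∃[ b ] T (precedes (lev i b) (pt u) (pt v))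
  separated zero (suc v) _ = zero , a ,
    subst (λ x → T (precedes ℓ x (pt (suc v)))) (sym (splice-point lev sep a C z v))
      (precedes-splice ℓ (point C v) z)
  separated (suc u) (suc v) (ℕ.s≤s u<v) = let i , b , p = separate C u<v in
    suc i , b , precedes-update (point C u) (point C v) (sep {zero} {suc i} (ℕ.s≤s ℕ.z≤n) a b) p

comb : ∀ {n j d} (lev : Blocks n j d) → Separated lev → Mean (Comb lev)
comb {zero}  {d = d} lev sep =
  mapᴹ (λ x → record { point = λ _ → x ; separate = λ { {zero} {zero} () } }) (uniform d)
comb {suc n} {j} {d} lev sep =
  bind (uniform j) (λ a →
  bind (comb (lev ∘ suc) (λ i<k → sep (ℕ.s≤s i<k))) (λ C →
  mapᴹ (grow lev sep a C) (uniform d)))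

module _ (k : ℕ) {d : ℕ} where
  private
    j = k ℕ.+ k
    ε = half k
    U = uniform d
    0≤ε = ℚₚ.<⇒≤ (0<half k)

  Injective-blocks : ∀ {n} → Blocks n j d → Set
  Injective-blocks lev = ∀ i {a b} → lev i a ≡ lev i b → a ≡ b

  drop-loss : ∀ n p → p - ε - nat n * ε ≡ p - nat (suc n) * ε
  drop-loss n p = eq p (nat n) ε
    where
    eq : ∀ p m e → p - e - m * e ≡ p - (1ℚ + m) * e
    eq = solve-∀ ring

  -‿mono : ∀ {p q r} → p ≤ q → p - r ≤ q - r
  -‿mono {r = r} = ℚₚ.+-monoˡ-≤ (- r)

  -- Every block either forces one bit at a random level, at a cost of at most `ε` by `force-bit`,
  -- or comes after the point has left the path and no longer affects it.
  comb-point : ∀ {n} (lev : Blocks n j d) (sep : Separated lev) → Injective-blocks lev →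
    ∀ (g : Cube d → ℚ) → (∀ x → 0ℚ ≤ g x) → (∀ x → g x ≤ 1ℚ) → ∀ v →
    E U g - nat n * ε ≤ E (comb lev sep) (λ C → g (point C v))
  comb-point {zero} lev sep inj g 0≤g g≤1 v = ℚₚ.≤-reflexive (eq (E U g) ε)
    where
    eq : ∀ p e → p - 0ℚ * e ≡ p
    eq = solve-∀ ring
  comb-point {suc n} lev sep inj g 0≤g g≤1 v = begin
    E U g - nat (suc n) * ε
      ≡⟨ drop-loss n (E U g) ⟨
    E U g - ε - nat n * ε
      ≤⟨ -‿mono {r = nat n * ε} (force-bit k (lev zero) (inj zero) (bit v) g 0≤g g≤1) ⟩
    E (uniform j) (λ a → E U (λ x → g (x [ lev zero a ]≔ bit v))) - nat n * ε
      ≡⟨ E-- (uniform j) (λ a → E U (λ x → g (x [ lev zero a ]≔ bit v))) (nat n * ε) ⟨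
    E (uniform j) (λ a → E U (λ x → g (x [ lev zero a ]≔ bit v)) - nat n * ε)
      ≤⟨ E-mono (uniform j) (λ a → conditional a v) ⟩
    E (comb lev sep) (λ C → g (point C v))
      ∎
    where
    open ℚₚ.≤-Reasoning
    bit : Fin (suc (suc n)) → Bool
    bit zero    = false
    bit (suc _) = true
    sep′ : Separated (lev ∘ suc)
    sep′ i<k = sep (ℕ.s≤s i<k)
    conditional : ∀ a v → E U (λ x → g (x [ lev zero a ]≔ bit v)) - nat n * ε ≤
      E (comb (lev ∘ suc) sep′) (λ C → E U (λ z → g (point (grow lev sep a C z) v)))
    -- Averaging over the fresh bits `z` first turns the new point into a function `g′` of
    -- `point C zero`, to which the induction applies.
    conditional a zero = begin
      E U (λ x → g (x [ ℓ ]≔ false)) - nat n * ε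
        ≡⟨ cong (_- nat n * ε) (uniform-splice ℓ g) ⟨
      E U g′ - nat n * ε
        ≤⟨ comb-point (lev ∘ suc) sep′ (inj ∘ suc) g′
             (λ x → 0≤E U (λ z → 0≤g (splice ℓ x z)))
             (λ x → subst (g′ x ≤_) (E-const U 1ℚ) (E-mono U (λ z → g≤1 (splice ℓ x z)))) zero ⟩
      E (comb (lev ∘ suc) sep′) (λ C → g′ (point C zero))
        ∎
      where
      ℓ = lev zero a
      g′ : Cube d → ℚ
      g′ x = E U (λ z → g (splice ℓ x z))
    conditional a (suc v) = begin
      E U (λ x → g (x [ ℓ ]≔ true)) - nat n * ε
        ≤⟨ comb-point (lev ∘ suc) sep′ (inj ∘ suc) (λ x → g (x [ ℓ ]≔ true))
             (λ x → 0≤g _) (λ x → g≤1 _) v ⟩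
      E (comb (lev ∘ suc) sep′) (λ C → g (point C v [ ℓ ]≔ true))
        ≡⟨ E-cong (comb (lev ∘ suc) sep′) (λ C → E-const U (g (point C v [ ℓ ]≔ true))) ⟨
      E (comb (lev ∘ suc) sep′) (λ C → E U (λ _ → g (point C v [ ℓ ]≔ true)))
        ∎
      where ℓ = lev zero a

  -- The number `u` itself, read as a block: a pair parts where its smaller point leaves the path.
  block : ∀ {n} (u v : Fin (suc n)) → u Fin.< v → Fin n
  block {suc n} zero    (suc v) _           = zero
  block {suc n} (suc u) (suc v) (ℕ.s≤s u<v) = suc (block u v u<v)

  block-density : ∀ {n} → Blocks n j d → Fin n → (Cube d → Cube d → ℚ) → ℚ
  block-density lev i h = E (uniform j) (λ a → E (levelMean (lev i a)) (uncurry h))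

  -- If `u` is the new point, `splice-point` and `levelMean-splice` reduce the pair to a function of
  -- one later point, and `comb-point` applies. Otherwise the first block forces the same bit in
  -- both points, and the induction hypothesis takes care of the remaining blocks.
  comb-pair : ∀ {n} (lev : Blocks n j d) (sep : Separated lev) → Injective-blocks lev →
    ∀ (h : Cube d → Cube d → ℚ) → (∀ x y → 0ℚ ≤ h x y) → (∀ x y → h x y ≤ 1ℚ) →
    ∀ u v (u<v : u Fin.< v) → block-density lev (block u v u<v) h - nat n * ε ≤
    E (comb lev sep) (λ C → h (point C u) (point C v))
  comb-pair {zero} lev sep inj h 0≤h h≤1 zero zero ()
  comb-pair {suc n} lev sep inj h 0≤h h≤1 zero (suc v) _ = begin
    block-density lev zero h - nat (suc n) * ε
      ≡⟨ drop-loss n (block-density lev zero h) ⟨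
    block-density lev zero h - ε - nat n * ε
      ≤⟨ -‿mono {block-density lev zero h - ε} {block-density lev zero h} {nat n * ε} (≤-by 0≤ε (eq (block-density lev zero h) ε)) ⟩
    block-density lev zero h - nat n * ε
      ≡⟨ E-- (uniform j) (λ a → E (levelMean (lev zero a)) (uncurry h)) (nat n * ε) ⟨
    E (uniform j) (λ a → E (levelMean (lev zero a)) (uncurry h) - nat n * ε)
      ≤⟨ E-mono (uniform j) conditional ⟩
    E (comb lev sep) (λ C → h (point C zero) (point C (suc v)))
      ∎
    where
    open ℚₚ.≤-Reasoning
    eq : ∀ p e → p ≡ p - e + e
    eq = solve-∀ ring
    sep′ : Separated (lev ∘ suc)
    sep′ i<k = sep (ℕ.s≤s i<k)
    conditional : ∀ a → E (levelMean (lev zero a)) (uncurry h) - nat n * ε ≤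
      E (comb (lev ∘ suc) sep′) (λ C → E U (λ z →
        h (splice (lev zero a) (point C zero) z) (point C v [ lev zero a ]≔ true)))
    conditional a = begin
      E (levelMean ℓ) (uncurry h) - nat n * ε
        ≡⟨ cong (_- nat n * ε) (levelMean-splice ℓ h) ⟨
      E U g - nat n * ε
        ≤⟨ comb-point (lev ∘ suc) sep′ (inj ∘ suc) g (λ x → 0≤E U (λ z → 0≤h _ _))
             (λ x → subst (g x ≤_) (E-const U 1ℚ) (E-mono U (λ z → h≤1 _ _))) v ⟩
      E (comb (lev ∘ suc) sep′) (λ C → g (point C v))
        ≡⟨ E-cong (comb (lev ∘ suc) sep′) (λ C → E-cong U (λ z →
             cong (λ x → h x (point C v [ ℓ ]≔ true)) (splice-point lev sep a C z v))) ⟨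
      E (comb (lev ∘ suc) sep′) (λ C → E U (λ z → h (splice ℓ (point C zero) z) (point C v [ ℓ ]≔ true)))
        ∎
      where
      ℓ = lev zero a
      g : Cube d → ℚ
      g x = E U (λ z → h (splice ℓ x z) (x [ ℓ ]≔ true))
  comb-pair {suc n} lev sep inj h 0≤h h≤1 (suc u) (suc v) (ℕ.s≤s u<v) = begin
    block-density lev (suc i) h - nat (suc n) * ε
      ≡⟨ drop-loss n (block-density lev (suc i) h) ⟨
    block-density lev (suc i) h - ε - nat n * ε
      ≤⟨ -‿mono {r = nat n * ε} forced ⟩
    E (uniform j) (λ a → block-density (lev ∘ suc) i (h′ a)) - nat n * ε
      ≡⟨ E-- (uniform j) (λ a → block-density (lev ∘ suc) i (h′ a)) (nat n * ε) ⟨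
    E (uniform j) (λ a → block-density (lev ∘ suc) i (h′ a) - nat n * ε)
      ≤⟨ E-mono (uniform j) (λ a → comb-pair (lev ∘ suc) sep′ (inj ∘ suc) (h′ a)
           (λ _ _ → 0≤h _ _) (λ _ _ → h≤1 _ _) u v u<v) ⟩
    E (uniform j) (λ a → E (comb (lev ∘ suc) sep′) (λ C → h′ a (point C u) (point C v)))
      ≡⟨ E-cong (uniform j) (λ a → E-cong (comb (lev ∘ suc) sep′) (λ C →
           E-const U (h′ a (point C u) (point C v)))) ⟨
    E (comb lev sep) (λ C → h (point C (suc u)) (point C (suc v)))
      ∎
    where
    open ℚₚ.≤-Reasoning
    i = block u v u<v
    sep′ : Separated (lev ∘ suc)
    sep′ i<k = sep (ℕ.s≤s i<k)
    h′ : Cube j → Cube d → Cube d → ℚ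
    h′ a x y = h (x [ lev zero a ]≔ true) (y [ lev zero a ]≔ true)
    -- The mean over the pairs at level `lev (suc i) b`, as a function of one uniform point. Forcing
    -- an earlier bit of `x` forces it in both points of the pair, so one use of `force-bit` covers
    -- the pair.
    G : Cube j → Cube d → ℚ
    G b x = E U (λ z → h (splice (lev (suc i) b) x z) (x [ lev (suc i) b ]≔ true))
    level : ∀ a b → E U (λ x → G b (x [ lev zero a ]≔ true)) ≡ E (levelMean (lev (suc i) b)) (uncurry (h′ a))
    level a b = trans
      (E-cong U (λ x → E-cong U (λ z → cong₂ h
        (sym (splice-update x z k<ℓ))
        (Vecₚ.[]≔-commutes x (lev zero a) (lev (suc i) b) λ e → Finₚ.<-irrefl e k<ℓ))))
      (levelMean-splice (lev (suc i) b) (h′ a))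
      where k<ℓ = sep {zero} {suc i} (ℕ.s≤s ℕ.z≤n) a b
    forced : block-density lev (suc i) h - ε ≤ E (uniform j) (λ a → block-density (lev ∘ suc) i (h′ a))
    forced = begin
      block-density lev (suc i) h - ε
        ≡⟨ E-- (uniform j) (λ b → E (levelMean (lev (suc i) b)) (uncurry h)) ε ⟨
      E (uniform j) (λ b → E (levelMean (lev (suc i) b)) (uncurry h) - ε)
        ≡⟨ E-cong (uniform j) (λ b → cong (_- ε) (levelMean-splice (lev (suc i) b) h)) ⟨
      E (uniform j) (λ b → E U (G b) - ε)
        ≤⟨ E-mono (uniform j) (λ b → force-bit k (lev zero) (inj zero) true (G b)
             (λ x → 0≤E U (λ z → 0≤h _ _))
             (λ x → subst (G b x ≤_) (E-const U 1ℚ) (E-mono U (λ z → h≤1 _ _)))) ⟩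
      E (uniform j) (λ b → E (uniform j) (λ a → E U (λ x → G b (x [ lev zero a ]≔ true))))
        ≡⟨ uniform-swap j (uniform j) (λ b a → E U (λ x → G b (x [ lev zero a ]≔ true))) ⟩
      E (uniform j) (λ a → E (uniform j) (λ b → E U (λ x → G b (x [ lev zero a ]≔ true))))
        ≡⟨ E-cong (uniform j) (λ a → E-cong (uniform j) (level a)) ⟩
      E (uniform j) (λ a → block-density (lev ∘ suc) i (h′ a))
        ∎

-- Dense copies in graphs with many rich levels

nat*half≤1 : ∀ k → nat k * half k ≤ 1ℚ
nat*half≤1 zero    = subst (_≤ 1ℚ) (sym (ℚₚ.*-zeroˡ 1ℚ)) 0≤1
nat*half≤1 (suc k) = ≤-by (*-mono 0≤½ (0≤+ (≤⇒0≤- (nat*half≤1 k)) (≤⇒0≤- (half≤1 k)))) (eq (nat k) (half k))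
  where
  half≤1 : ∀ k → half k ≤ 1ℚ
  half≤1 zero    = ℚₚ.≤-refl
  half≤1 (suc k) = ≤-by (0≤+ 0≤½ (*-mono 0≤½ (≤⇒0≤- (half≤1 k)))) (eq (half k))
    where
    eq : ∀ h → 1ℚ ≡ ½ * h + (½ + ½ * (1ℚ - h))
    eq = solve-∀ ring
  eq : ∀ n h → 1ℚ ≡ (1ℚ + n) * (½ * h) + ½ * ((1ℚ - n * h) + (1ℚ - h))
  eq = solve-∀ ring

archimedean-* : ∀ M δ → 0ℚ < δ → ∃[ k ] M ≤ δ * nat k
archimedean-* M δ 0<δ = proj₁ bound , (begin
    M                              ≡⟨ ℚₚ.*-identityˡ M ⟨
    1ℚ * M                         ≡⟨ cong (_* M) (ℚₚ.*-inverseʳ δ) ⟨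
    δ * ℚ.1/ δ * M                 ≡⟨ eq δ (ℚ.1/ δ) M ⟩
    δ * (M * ℚ.1/ δ)               ≤⟨ *-mono (ℚₚ.<⇒≤ 0<δ) (proj₂ bound) ⟩
    δ * nat (proj₁ bound)          ∎)
  where
  open ℚₚ.≤-Reasoning
  instance _ = ℚ.>-nonZero 0<δ
  bound = archimedean (M * ℚ.1/ δ)
  eq : ∀ a b c → a * b * c ≡ a * (c * b)
  eq = solve-∀ ring

half-small : ∀ M δ → 0ℚ < δ → ∃[ k ] M * half k ≤ δ
half-small M δ 0<δ = small (archimedean-* M δ 0<δ)
  where
  open ℚₚ.≤-Reasoning
  small : ∃[ k ] M ≤ δ * nat k → ∃[ k ] M * half k ≤ δ
  small (k , M≤δk) = k , (begin
    M * half k                ≤⟨ ℚₚ.*-monoʳ-≤-nonNeg (half k) M≤δk ⟩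
    δ * nat k * half k        ≡⟨ ℚₚ.*-assoc δ (nat k) (half k) ⟩
    δ * (nat k * half k)      ≤⟨ *-mono (ℚₚ.<⇒≤ 0<δ) (nat*half≤1 k) ⟩
    δ * 1ℚ                    ≡⟨ ℚₚ.*-identityʳ δ ⟩
    δ                         ∎)
    where instance _ = ℚ.nonNegative (ℚₚ.<⇒≤ (0<half k))

element : ∀ {d} (L : Subset d) → Fin ∣ L ∣ → Fin d
element (false ∷ L) i       = suc (element L i)
element (true ∷ L)  zero    = zero
element (true ∷ L)  (suc i) = suc (element L i)

element∈ : ∀ {d} (L : Subset d) i → element L i ∈ₛ L
element∈ (false ∷ L) i       = Vec.there (element∈ L i)
element∈ (true ∷ L)  zero    = Vec.here
element∈ (true ∷ L)  (suc i) = Vec.there (element∈ L i)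

element-mono : ∀ {d} (L : Subset d) {i k} → i Fin.< k → element L i Fin.< element L k
element-mono (false ∷ L) i<k = ℕ.s≤s (element-mono L i<k)
element-mono (true ∷ L) {zero}  {suc k} _ = ℕ.s≤s ℕ.z≤n
element-mono (true ∷ L) {suc i} {suc k} (ℕ.s≤s i<k) = ℕ.s≤s (element-mono L i<k)

index : ∀ {j} → Cube j → Fin (2 ℕ.^ j)
index []          = zero
index (false ∷ x) = Fin.combine {2} zero (index x)
index (true ∷ x)  = Fin.combine {2} (suc zero) (index x)

index-injective : ∀ {j} (x y : Cube j) → index x ≡ index y → x ≡ y
index-injective []          []          _ = refl
index-injective (false ∷ x) (false ∷ y) e =
  cong (false ∷_) (index-injective x y (proj₂ (Finₚ.combine-injective {2} zero (index x) zero (index y) e)))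
index-injective (true ∷ x)  (true ∷ y)  e =
  cong (true ∷_) (index-injective x y (proj₂ (Finₚ.combine-injective {2} (suc zero) (index x) (suc zero) (index y) e)))
index-injective (false ∷ x) (true ∷ y)  e
  with () ← proj₁ (Finₚ.combine-injective {2} zero (index x) (suc zero) (index y) e)
index-injective (true ∷ x)  (false ∷ y) e
  with () ← proj₁ (Finₚ.combine-injective {2} (suc zero) (index x) zero (index y) e)

strict⇒injective : ∀ {m n} (f : Fin m → Fin n) → (∀ {i k} → i Fin.< k → f i Fin.< f k) →
                   ∀ {i k} → f i ≡ f k → i ≡ k
strict⇒injective f mono {i} {k} e with Finₚ.<-cmp i k
... | tri< i<k _ _ = contradiction (mono i<k) (Finₚ.<-irrefl e)
... | tri≈ _ i≡k _ = i≡k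
... | tri> _ _ k<i = contradiction (mono k<i) (Finₚ.<-irrefl (sym e))

module _ {d} (L : Subset d) {n j} (many : n ℕ.* 2 ℕ.^ j ℕ.≤ ∣ L ∣) where

  pick : Fin (n ℕ.* 2 ℕ.^ j) → Fin d
  pick i = element L (Fin.inject≤ i many)

  pick-mono : ∀ {i k} → i Fin.< k → pick i Fin.< pick k
  pick-mono {i} {k} i<k = element-mono L
    (subst₂ ℕ._<_ (sym (Finₚ.toℕ-inject≤ i many)) (sym (Finₚ.toℕ-inject≤ k many)) i<k)

  -- `Fin.combine` is lexicographic, so block `i` is the `i`-th run of `2^j` elements of `L`.
  blocks : Blocks n j d
  blocks i a = pick (Fin.combine i (index a))

  blocks-separated : Separated blocks
  blocks-separated i<k a b = pick-mono (Finₚ.combine-monoˡ-< (index a) (index b) i<k)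

  blocks-injective : ∀ i {a b} → blocks i a ≡ blocks i b → a ≡ b
  blocks-injective i {a} {b} e = index-injective a b
    (proj₂ (Finₚ.combine-injective i (index a) i (index b) (strict⇒injective pick pick-mono e)))

edge : (G : OrderedGraph) → Fin (order G) × Fin (order G) → Bool
edge G (u , v) = does (u Finₚ.<? v) ∧ adj (graph G) u v

pairs : (G : OrderedGraph) → List (Fin (order G) × Fin (order G))
pairs G = cartesianProduct (allFin (order G)) (allFin (order G))

e≡∑ : ∀ G → nat (e G) ≡ ∑ (pairs G) (λ p → ⟦ edge G p ⟧)
e≡∑ G = length-filter (λ p → (proj₁ p Finₚ.<? proj₂ p) ×-dec T? (adj (graph G) (proj₁ p) (proj₂ p))) (pairs G)

pullback : ∀ {d} (G : OrderedGraph) → (Fin (order G) → Cube d) → Graph (Cube d) → OrderedGraph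
pullback G φ H = record { order = order G ; graph = record
  { adj        = λ u v → adj (graph G) u v ∧ adj H (φ u) (φ v)
  ; adj-sym    = λ u v → cong₂ _∧_ (adj-sym (graph G) u v) (adj-sym H (φ u) (φ v))
  ; adj-irrefl = λ u → cong (_∧ adj H (φ u) (φ u)) (adj-irrefl (graph G) u) } }

precedes⇒≺ : ∀ {d} (ℓ : Fin d) x y → T (precedes ℓ x y) → x ≺ y
precedes⇒≺ ℓ x y p = ℓ , precedes⇒IsDelta ℓ x y p

dense-copy : ∀ G β δ → 0ℚ < δ → ∃[ C ] ∀ {d} (H : Graph (Cube d)) (L : Subset d) → C ℕ.≤ ∣ L ∣ →
  (∀ ℓ → ℓ ∈ₛ L → β ≤ density-level H ℓ) →
  ∃[ φ ] (∀ {u v} → u Fin.< v → φ u ≺ φ v) × nat (e G) * β - δ ≤ nat (e (pullback G φ H))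
dense-copy G β δ 0<δ = n ℕ.* 2 ℕ.^ (k ℕ.+ k) , copy
  where
  n = order G
  M = nat (e G) * nat n
  -- Each of the `e G` edges loses at most `n * half k` in probability, so this `k` keeps the total
  -- loss within `δ`.
  k = proj₁ (half-small M δ 0<δ)
  η = nat n * half k
  copy : ∀ {d} (H : Graph (Cube d)) (L : Subset d) → n ℕ.* 2 ℕ.^ (k ℕ.+ k) ℕ.≤ ∣ L ∣ →
    (∀ ℓ → ℓ ∈ₛ L → β ≤ density-level H ℓ) →
    ∃[ φ ] (∀ {u v} → u Fin.< v → φ u ≺ φ v) × nat (e G) * β - δ ≤ nat (e (pullback G φ H))
  copy {d} H L many dense = φ C₀ , mono , (begin
    nat (e G) * β - δ
      ≤⟨ ℚₚ.+-monoʳ-≤ (nat (e G) * β) (ℚₚ.neg-antimono-≤ (proj₂ (half-small M δ 0<δ))) ⟩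
    nat (e G) * β - M * half k
      ≡⟨ eq (nat (e G)) β (nat n) (half k) ⟩
    (β - η) * nat (e G)
      ≡⟨ cong ((β - η) *_) (e≡∑ G) ⟩
    (β - η) * ∑ (pairs G) (λ p → ⟦ edge G p ⟧)
      ≡⟨ ∑-* (pairs G) (β - η) (λ p → ⟦ edge G p ⟧) ⟨
    ∑ (pairs G) (λ p → (β - η) * ⟦ edge G p ⟧)
      ≤⟨ ∑-mono (pairs G) (λ { (u , v) → pointwise u v }) ⟩
    ∑ (pairs G) (λ p → E μ (λ C → ⟦ edge (copyOf C) p ⟧))
      ≡⟨ E-∑ μ (pairs G) (λ C p → ⟦ edge (copyOf C) p ⟧) ⟨
    E μ (λ C → ∑ (pairs G) (λ p → ⟦ edge (copyOf C) p ⟧))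
      ≤⟨ proj₂ best ⟩
    ∑ (pairs G) (λ p → ⟦ edge (copyOf C₀) p ⟧)
      ≡⟨ e≡∑ (copyOf C₀) ⟨
    nat (e (copyOf C₀))
      ∎)
    where
    open ℚₚ.≤-Reasoning
    eq : ∀ g b n h → g * b - g * n * h ≡ (b - n * h) * g
    eq = solve-∀ ring
    lev = blocks L {n} {k ℕ.+ k} many
    sep = blocks-separated L {n} {k ℕ.+ k} many
    μ = comb lev sep
    -- A comb with `n` blocks has `n + 1` points; the last is left out, which also covers `n = 0`.
    φ : Comb lev → Fin n → Cube d
    φ C u = point C (Fin.inject₁ u)
    copyOf : Comb lev → OrderedGraph
    copyOf C = pullback G (φ C) H
    best = attained μ (λ C → ∑ (pairs G) (λ p → ⟦ edge (copyOf C) p ⟧))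
    C₀ = proj₁ best
    inject₁-< : ∀ {u v : Fin n} → u Fin.< v → Fin.inject₁ u Fin.< Fin.inject₁ v
    inject₁-< {u} {v} = subst₂ ℕ._<_ (sym (Finₚ.toℕ-inject₁ u)) (sym (Finₚ.toℕ-inject₁ v))
    mono : ∀ {u v} → u Fin.< v → φ C₀ u ≺ φ C₀ v
    mono {u} {v} u<v = let i , a , p = separate C₀ (inject₁-< u<v) in
      precedes⇒≺ (lev i a) (φ C₀ u) (φ C₀ v) p
    h : Cube d → Cube d → ℚ
    h x y = ⟦ adj H x y ⟧
    β≤block : ∀ i → β ≤ block-density k lev i h
    β≤block i = subst (_≤ block-density k lev i h) (E-const (uniform (k ℕ.+ k)) β)
      (E-mono (uniform (k ℕ.+ k)) (λ a → dense (lev i a) (element∈ L _)))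
    guarded : ∀ b c (f : Comb lev → Bool) → (T b → β - η ≤ E μ (λ C → ⟦ f C ⟧)) →
              (β - η) * ⟦ b ∧ c ⟧ ≤ E μ (λ C → ⟦ b ∧ c ∧ f C ⟧)
    guarded true  true  f p = subst (_≤ E μ (λ C → ⟦ f C ⟧)) (sym (ℚₚ.*-identityʳ (β - η))) (p tt)
    guarded true  false f p = subst (_≤ E μ (λ _ → 0ℚ)) (sym (ℚₚ.*-zeroʳ (β - η))) (0≤E μ (λ _ → ℚₚ.≤-refl))
    guarded false c     f p = subst (_≤ E μ (λ _ → 0ℚ)) (sym (ℚₚ.*-zeroʳ (β - η))) (0≤E μ (λ _ → ℚₚ.≤-refl))
    pointwise : ∀ u v → (β - η) * ⟦ edge G (u , v) ⟧ ≤ E μ (λ C → ⟦ edge (copyOf C) (u , v) ⟧)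
    pointwise u v = guarded (does (u Finₚ.<? v)) (adj (graph G) u v) (λ C → adj H (φ C u) (φ C v))
      (λ t → let u<v = inject₁-< {u} {v} (ℕₚ.<ᵇ⇒< (toℕ u) (toℕ v) t) in
        ℚₚ.≤-trans
          (ℚₚ.+-monoˡ-≤ (- η) (β≤block (block k {d} (Fin.inject₁ u) (Fin.inject₁ v) u<v)))
          (comb-pair k lev sep (λ i → blocks-injective L {n} {k ℕ.+ k} many i) h
            (λ x y → 0≤⟦⟧ (adj H x y)) (λ x y → ⟦⟧≤1 (adj H x y)) (Fin.inject₁ u) (Fin.inject₁ v) u<v))

-- Deciding containment, and the existence of relative densities

-- Exhaustive search stands in for excluded middle: it will decide containment and the existence of
-- free subgraphs with a given number of edges.
Searchable : Set → Set₁
Searchable A = ∀ {P : Pred A 0ℓ} → (∀ a → Dec (P a)) → Dec (∃[ a ] P a)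

search-Bool : Searchable Bool
search-Bool P? with P? false | P? true
... | yes p | _     = yes (false , p)
... | no _  | yes q = yes (true , q)
... | no ¬p | no ¬q = no λ { (false , p) → ¬p p ; (true , q) → ¬q q }

search-Vec : Searchable A → ∀ n → Searchable (Vec A n)
search-Vec s zero    P? = map′ ([] ,_) (λ { ([] , p) → p }) (P? [])
search-Vec s (suc n) P? = map′ (λ { (a , v , p) → a ∷ v , p }) (λ { (a ∷ v , p) → a , v , p })
  (s (λ a → search-Vec s n (λ v → P? (a ∷ v))))

module _ {m n : ℕ} {F : Graph (Fin m)} {G : Graph (Fin n)} where

  Preserving : (Fin m → Fin n) → Set
  Preserving f = (∀ u v → u Fin.< v → f u Fin.< f v) × (∀ u v → T (adj F u v) → T (adj G (f u) (f v)))

  preserving⇒embedding : ∀ f → Preserving f → Embedding Fin._<_ Fin._<_ F G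
  preserving⇒embedding f (mono , edges) = record
    { to = f ; injective = strict⇒injective f (mono _ _) ; monotone = mono _ _ ; edges = edges _ _ }

  preserving? : ∀ f → Dec (Preserving f)
  preserving? f =
    Finₚ.all? (λ u → Finₚ.all? (λ v → (u Finₚ.<? v) →-dec (f u Finₚ.<? f v))) ×-dec
    Finₚ.all? (λ u → Finₚ.all? (λ v → T? (adj F u v) →-dec T? (adj G (f u) (f v))))

-- Maps are searched as vectors of values; injectivity comes from strict monotonicity.
contains? : ∀ G F → Dec (G contains F)
contains? G F = map′ (λ { (f , p) → preserving⇒embedding (lookup f) p }) tabulated
  (search-Vec Finₚ.any? (order F) (λ f → preserving? {F = graph F} {graph G} (lookup f)))
  where
  tabulated : G contains F → ∃[ f ] Preserving {F = graph F} {graph G} (lookup f)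
  tabulated ι = Vec.tabulate to ,
    (λ u v u<v → subst₂ Fin._<_ (sym (Vecₚ.lookup∘tabulate to u)) (sym (Vecₚ.lookup∘tabulate to v)) (monotone u<v)) ,
    (λ u v uv → subst₂ (λ x y → T (adj (graph G) x y))
      (sym (Vecₚ.lookup∘tabulate to u)) (sym (Vecₚ.lookup∘tabulate to v)) (edges uv))
    where open Embedding ι

contains-trans : ∀ {F G H} → G contains F → H contains G → H contains F
contains-trans ι κ = record
  { to        = Embedding.to κ ∘ Embedding.to ι
  ; injective = Embedding.injective ι ∘ Embedding.injective κ
  ; monotone  = Embedding.monotone κ ∘ Embedding.monotone ι
  ; edges     = Embedding.edges κ ∘ Embedding.edges ι }

on : ∀ {n} → Graph (Fin n) → OrderedGraph
on {n} g = record { order = n ; graph = g }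

infix 4 _⊑_

_⊑_ : ∀ {n} → Graph (Fin n) → Graph (Fin n) → Set
g ⊑ h = ∀ u v → T (adj g u v) → T (adj h u v)

⊑⇒contains : ∀ {n} {g h : Graph (Fin n)} → g ⊑ h → on h contains on g
⊑⇒contains g⊑h = record { to = id ; injective = id ; monotone = id ; edges = g⊑h _ _ }

∧-map : ∀ a b b′ → (T b → T b′) → T (a ∧ b) → T (a ∧ b′)
∧-map true b b′ f = f

e-mono : ∀ {n} {g h : Graph (Fin n)} → g ⊑ h → e (on g) ℕ.≤ e (on h)
e-mono {g = g} {h} g⊑h = nat-cancel-≤ (subst₂ _≤_ (sym (e≡∑ (on g))) (sym (e≡∑ (on h)))
  (∑-mono (pairs (on g)) (λ { (u , v) →
    ⟦⟧-mono (∧-map (does (u Finₚ.<? v)) (adj g u v) (adj h u v) (g⊑h u v)) })))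

Matrix : ℕ → Set
Matrix n = Vec (Vec Bool n) n

entry : ∀ {n} → Matrix n → Fin n → Fin n → Bool
entry M u v = lookup (lookup M u) v

-- Imposes symmetry and an empty diagonal, so every matrix gives a graph and graphs can be searched
-- through arbitrary matrices.
fromMatrix : ∀ {n} → Matrix n → Graph (Fin n)
fromMatrix M = record
  { adj        = λ u v → (entry M u v ∧ entry M v u) ∧ not (does (u Finₚ.≟ v))
  ; adj-sym    = λ u v → cong₂ _∧_ (Boolₚ.∧-comm (entry M u v) (entry M v u))
                   (cong not (does-⇔ (mk⇔ sym sym) (u Finₚ.≟ v) (v Finₚ.≟ u)))
  ; adj-irrefl = λ u → trans (cong (λ b → (entry M u u ∧ entry M u u) ∧ not b) (dec-true (u Finₚ.≟ u) refl))
                             (Boolₚ.∧-zeroʳ _) }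

toMatrix : ∀ {n} → Graph (Fin n) → Matrix n
toMatrix g = Vec.tabulate (λ u → Vec.tabulate (adj g u))

fromMatrix∘toMatrix : ∀ {n} (g : Graph (Fin n)) u v → adj (fromMatrix (toMatrix g)) u v ≡ adj g u v
fromMatrix∘toMatrix g u v = begin
  (entry (toMatrix g) u v ∧ entry (toMatrix g) v u) ∧ not (does (u Finₚ.≟ v))
    ≡⟨ cong (_∧ not (does (u Finₚ.≟ v))) (cong₂ _∧_ (entry≡ u v) (trans (entry≡ v u) (adj-sym g v u))) ⟩
  (adj g u v ∧ adj g u v) ∧ not (does (u Finₚ.≟ v))
    ≡⟨ cong (_∧ not (does (u Finₚ.≟ v))) (Boolₚ.∧-idem (adj g u v)) ⟩
  adj g u v ∧ not (does (u Finₚ.≟ v))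
    ≡⟨ off-diagonal (u Finₚ.≟ v) ⟩
  adj g u v
    ∎
  where
  open ≡-Reasoning
  entry≡ : ∀ u v → entry (toMatrix g) u v ≡ adj g u v
  entry≡ u v = trans (cong (λ r → lookup r v) (Vecₚ.lookup∘tabulate (λ u → Vec.tabulate (adj g u)) u))
                     (Vecₚ.lookup∘tabulate (adj g u) v)
  off-diagonal : (u≟v : Dec (u ≡ v)) → adj g u v ∧ not (does u≟v) ≡ adj g u v
  off-diagonal (yes refl) = trans (Boolₚ.∧-zeroʳ (adj g u u)) (sym (adj-irrefl g u))
  off-diagonal (no _)     = Boolₚ.∧-identityʳ (adj g u v)

FreeSubgraph : (F G : OrderedGraph) → ℕ → Set
FreeSubgraph F G k = ∃[ G′ ] G contains G′ × ¬ (G′ contains F) × e G′ ≡ k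

-- An embedding into `G` bounds the order by `order G`, so the search is finite. Decoding a matrix
-- restores adjacency pointwise; the properties are therefore carried over by `_⊑_` in both
-- directions.
freeSubgraph? : ∀ F G k → Dec (FreeSubgraph F G k)
freeSubgraph? F G k = map′ (λ { (m , M , p) → on (fromMatrix M) , p }) encode
  (Finₚ.any? {n = suc (order G)} (λ m → search-Vec (search-Vec search-Bool (toℕ m)) (toℕ m)
    (λ M → let G′ = on (fromMatrix M) in
           contains? G G′ ×-dec ¬? (contains? G′ F) ×-dec (e G′ ℕₚ.≟ k))))
  where
  Free : ∀ {m} → Matrix m → Set
  Free M = let G′ = on (fromMatrix M) in G contains G′ × ¬ (G′ contains F) × e G′ ≡ k
  encode : FreeSubgraph F G k → ∃[ m ] ∃[ M ] Free {toℕ {suc (order G)} m} M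
  encode (record { order = n ; graph = g } , ι , free , eq) =
    Fin.fromℕ< n<  , subst (λ m → ∃[ M ] Free {m} M) (sym (Finₚ.toℕ-fromℕ< n<)) (toMatrix g ,
      contains-trans (⊑⇒contains g′⊑g) ι , (λ κ → free (contains-trans κ (⊑⇒contains g′⊑g))) ,
      trans (ℕₚ.≤-antisym (e-mono {g = fromMatrix (toMatrix g)} {g} g′⊑g) (e-mono {g = g} {fromMatrix (toMatrix g)} g⊑g′)) eq)
    where
    n< = ℕ.s≤s (Finₚ.injective⇒≤ (Embedding.injective ι))
    g′⊑g : fromMatrix (toMatrix g) ⊑ g
    g′⊑g u v = subst T (fromMatrix∘toMatrix g u v)
    g⊑g′ : g ⊑ fromMatrix (toMatrix g)
    g⊑g′ u v = subst T (sym (fromMatrix∘toMatrix g u v))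

∑-allFin-const : ∀ n c → ∑ (allFin n) (λ _ → c) ≡ nat n * c
∑-allFin-const n c = trans (∑-const (allFin n) c)
  (cong (λ k → nat k * c) (Listₚ.length-tabulate {n = n} id))

e≤order² : ∀ G → e G ℕ.≤ order G ℕ.* order G
e≤order² G = nat-cancel-≤ (begin
  nat (e G)
    ≡⟨ e≡∑ G ⟩
  ∑ (pairs G) (λ p → ⟦ edge G p ⟧)
    ≤⟨ ∑-mono (pairs G) (λ p → ⟦⟧≤1 (edge G p)) ⟩
  ∑ (pairs G) (λ _ → 1ℚ)
    ≡⟨ ∑-cartesianProduct (allFin n) (allFin n) (λ _ → 1ℚ) ⟩
  ∑ (allFin n) (λ _ → ∑ (allFin n) (λ _ → 1ℚ))
    ≡⟨ ∑-allFin-const n (∑ (allFin n) (λ _ → 1ℚ)) ⟩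
  nat n * ∑ (allFin n) (λ _ → 1ℚ)
    ≡⟨ cong (nat n *_) (trans (∑-allFin-const n 1ℚ) (ℚₚ.*-identityʳ (nat n))) ⟩
  nat n * nat n
    ≡⟨ nat-* n n ⟨
  nat (n ℕ.* n)
    ∎)
  where
  open ℚₚ.≤-Reasoning
  n = order G

greatest : ∀ {Q : ℕ → Set} → (∀ k → Dec (Q k)) → ∀ b →
  (∃[ k ] Q k × (∀ {i} → i ℕ.≤ b → Q i → i ℕ.≤ k)) ⊎ (∀ {i} → i ℕ.≤ b → ¬ Q i)
greatest Q? b with Q? b
... | yes q = inj₁ (b , q , λ i≤b _ → i≤b)
greatest Q? zero | no ¬q = inj₂ λ { ℕ.z≤n → ¬q }
greatest {Q} Q? (suc b) | no ¬q = extend (greatest Q? b)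
  where
  below : ∀ {i} → i ℕ.≤ suc b → Q i → i ℕ.≤ b
  below i≤ qᵢ with ℕₚ.m≤n⇒m<n∨m≡n i≤
  ... | inj₁ (ℕ.s≤s i≤b) = i≤b
  ... | inj₂ refl        = contradiction qᵢ ¬q
  extend : (∃[ k ] Q k × (∀ {i} → i ℕ.≤ b → Q i → i ℕ.≤ k)) ⊎ (∀ {i} → i ℕ.≤ b → ¬ Q i) →
    (∃[ k ] Q k × (∀ {i} → i ℕ.≤ suc b → Q i → i ℕ.≤ k)) ⊎ (∀ {i} → i ℕ.≤ suc b → ¬ Q i)
  extend (inj₁ (k , q , max)) = inj₁ (k , q , λ i≤ qᵢ → max (below i≤ qᵢ) qᵢ)
  extend (inj₂ none)          = inj₂ λ i≤ qᵢ → none (below i≤ qᵢ) qᵢ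

/-mono : ∀ {i k} n .{{_ : NonZero n}} → i ℕ.≤ k → ℤ.+ i / n ≤ ℤ.+ k / n
/-mono {i} {k} n i≤k = *-cancel-≤ (0<nat n) (subst₂ _≤_ (sym (/-nat i n)) (sym (/-nat k n)) (nat-mono i≤k))

contains⇒e≤order² : ∀ {G G′} → G contains G′ → e G′ ℕ.≤ order G ℕ.* order G
contains⇒e≤order² {G} {G′} ι = ℕₚ.≤-trans (e≤order² G′) (ℕₚ.*-mono-≤ n≤ n≤)
  where n≤ = Finₚ.injective⇒≤ (Embedding.injective ι)

relativeDensity : ∀ F G .{{_ : NonZero (e G)}} → ∃[ r ] IsRelativeDensity F G r
relativeDensity F G = maximum (greatest (freeSubgraph? F G) b)
  where
  b = order G ℕ.* order G
  maximum : (∃[ k ] FreeSubgraph F G k × (∀ {i} → i ℕ.≤ b → FreeSubgraph F G i → i ℕ.≤ k)) ⊎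
            (∀ {i} → i ℕ.≤ b → ¬ FreeSubgraph F G i) → ∃[ r ] IsRelativeDensity F G r
  maximum (inj₁ (k , (G′ , ι , free , eq) , max)) =
    ℤ.+ k / e G , inj₁ ((G′ , ι , free , cong (λ i → ℤ.+ i / e G) (sym eq)) ,
      λ { r (G″ , κ , free″ , eq″) → subst (_≤ ℤ.+ k / e G) (sym eq″)
            (/-mono {e G″} {k} (e G) (max {e G″} (contains⇒e≤order² {G} {G″} κ) (G″ , κ , free″ , refl))) })
  maximum (inj₂ none) =
    0ℚ , inj₂ ((λ { r (G″ , κ , free″ , _) → none {e G″} (contains⇒e≤order² {G} {G″} κ) (G″ , κ , free″ , refl) }) , refl)

0≤/ : ∀ k n .{{_ : NonZero n}} → 0ℚ ≤ ℤ.+ k / n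
0≤/ k n = *-cancel-≤ (0<nat n) (subst₂ _≤_ (sym (ℚₚ.*-zeroʳ (nat n))) (sym (/-nat k n)) (0≤nat k))

0≤relativeDensity : ∀ {F G r} .{{_ : NonZero (e G)}} → IsRelativeDensity F G r → 0ℚ ≤ r
0≤relativeDensity {G = G} (inj₁ ((G′ , _ , _ , refl) , _)) = 0≤/ (e G′) (e G)
0≤relativeDensity (inj₂ (_ , refl)) = ℚₚ.≤-refl

dense⇒contains : ∀ {F G r} .{{_ : NonZero (e G)}} → IsRelativeDensity F G r →
  ∀ G′ → G contains G′ → nat (e G) * r < nat (e G′) → G′ contains F
dense⇒contains {F} {G} {r} max G′ ι p = decidable-stable (contains? G′ F) (λ free → absurd free max)
  where
  absurd : ¬ (G′ contains F) → IsRelativeDensity F G r → ⊥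
  absurd free (inj₁ (_ , max)) = ≤⇒≯ (*-mono (0≤nat (e G)) (max _ (G′ , ι , free , refl)))
    (subst (nat (e G) * r <_) (sym (/-nat (e G′) (e G))) p)
  absurd free (inj₂ (empty , _)) = empty _ (G′ , ι , free , refl)


term≤∑ : ∀ {A : Set} {xs : List A} {f x} → (∀ x → 0ℚ ≤ f x) → Any (x ≡_) xs → f x ≤ ∑ xs f
term≤∑ {xs = y ∷ xs} {f} 0≤f (here refl) = ≤-by (0≤∑ xs 0≤f) refl
term≤∑ {xs = y ∷ xs} {f} {x} 0≤f (there x∈) = ≤-by (0≤+ (0≤f y) (≤⇒0≤- (term≤∑ {xs = xs} 0≤f x∈))) (eq (f x) (f y) (∑ xs f))
  where
  eq : ∀ p q r → q + r ≡ p + (q + (r - p))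
  eq = solve-∀ ring

-- Edge counts are integers: a missing edge would cost 1, more than the permitted `½`.
edges-complete : ∀ {n} {g h : Graph (Fin n)} → g ⊑ h → nat (e (on h)) * 1ℚ - ½ ≤ nat (e (on g)) →
  ∀ u v → u Fin.< v → T (adj h u v) → T (adj g u v)
edges-complete {n} {g} {h} g⊑h p u v u<v huv = missing (adj g u v) refl
  where
  eg = edge (on g)
  eh = edge (on h)
  eh≡true : eh (u , v) ≡ true
  eh≡true = cong₂ _∧_ (dec-true (u Finₚ.<? v) u<v) (T⇒≡ (adj h u v) huv)
    where
    T⇒≡ : ∀ b → T b → b ≡ true
    T⇒≡ true _ = refl
  f : Fin n × Fin n → ℚ
  f p = ⟦ eh p ⟧ - ⟦ eg p ⟧
  0≤f : ∀ p → 0ℚ ≤ f p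
  0≤f (i , k) = ≤⇒0≤- (⟦⟧-mono (∧-map (does (i Finₚ.<? k)) (adj g i k) (adj h i k) (g⊑h i k)))
  total : ∑ (pairs (on h)) f ≡ nat (e (on h)) - nat (e (on g))
  total = trans (∑-+ (pairs (on h)) (λ p → ⟦ eh p ⟧) (λ p → - ⟦ eg p ⟧))
    (cong₂ _+_ (sym (e≡∑ (on h))) (begin
      ∑ (pairs (on h)) (λ p → - ⟦ eg p ⟧)
        ≡⟨ ∑-cong (pairs (on h)) (λ p → neg ⟦ eg p ⟧) ⟩
      ∑ (pairs (on h)) (λ p → - 1ℚ * ⟦ eg p ⟧)
        ≡⟨ ∑-* (pairs (on h)) (- 1ℚ) (λ p → ⟦ eg p ⟧) ⟩
      - 1ℚ * ∑ (pairs (on g)) (λ p → ⟦ eg p ⟧)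
        ≡⟨ cong (- 1ℚ *_) (e≡∑ (on g)) ⟨
      - 1ℚ * nat (e (on g))
        ≡⟨ neg (nat (e (on g))) ⟨
      - nat (e (on g))
        ∎))
    where
    open ≡-Reasoning
    neg : ∀ p → - p ≡ - 1ℚ * p
    neg = solve-∀ ring
  missing : ∀ b → adj g u v ≡ b → T b
  missing true  _  = tt
  missing false eq = ⊥-elim (≤⇒≯ 1≤½ (ℚ.*<* (ℤ.+<+ (ℕ.s≤s (ℕ.s≤s ℕ.z≤n)))))
    where
    f≡1 : f (u , v) ≡ 1ℚ
    f≡1 = cong₂ (λ b c → ⟦ b ⟧ - ⟦ c ⟧) eh≡true
      (trans (cong (does (u Finₚ.<? v) ∧_) eq) (Boolₚ.∧-zeroʳ (does (u Finₚ.<? v))))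
    eq′ : ∀ x y → ½ ≡ (x - y) + (y - (x * 1ℚ - ½))
    eq′ = solve-∀ ring
    1≤½ : 1ℚ ≤ ½
    1≤½ = ℚₚ.≤-trans (subst₂ _≤_ f≡1 total (term≤∑ {xs = pairs (on h)} 0≤f
            (∈-cartesianProduct⁺ (∈-allFin u) (∈-allFin v))))
          (≤-by (≤⇒0≤- p) (eq′ (nat (e (on h))) (nat (e (on g)))))

-- The upper bound on the threshold

≺-irrefl : ∀ {d} {x y : Cube d} → x ≡ y → ¬ x ≺ y
≺-irrefl refl (ℓ , (≢ , _) , _) = ≢ refl

strict⇒injectiveᶜ : ∀ {m d} (f : Fin m → Cube d) → (∀ {i k} → i Fin.< k → f i ≺ f k) →
                    ∀ {i k} → f i ≡ f k → i ≡ k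
strict⇒injectiveᶜ f mono {i} {k} eq with Finₚ.<-cmp i k
... | tri< i<k _ _ = contradiction (mono i<k) (≺-irrefl eq)
... | tri≈ _ i≡k _ = i≡k
... | tri> _ _ k<i = contradiction (mono k<i) (≺-irrefl (sym eq))

∧-proj₂ : ∀ a {b} → T (a ∧ b) → T b
∧-proj₂ true t = t

pullback-contains : ∀ {d} F G (H : Graph (Cube d)) φ → (∀ {u v} → u Fin.< v → φ u ≺ φ v) →
                    pullback G φ H contains F → H containsᶜ F
pullback-contains F G H φ mono ι = record
  { to        = φ ∘ to
  ; injective = injective ∘ strict⇒injectiveᶜ φ mono
  ; monotone  = mono ∘ monotone
  ; edges     = λ {u} {v} uv → ∧-proj₂ (adj (graph G) (to u) (to v)) (edges uv) }
  where open Embedding ι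

fromℚ-mono : ∀ {p q} → p ≤ q → fromℚ p ≤ᵣ fromℚ q
fromℚ-mono p≤q r r<p = ℚₚ.<-≤-trans r<p p≤q

fromℚ-cancel : ∀ {p q} → fromℚ p ≤ᵣ fromℚ q → p ≤ q
fromℚ-cancel {p} {q} p≤q = ℚₚ.≮⇒≥ (λ q<p → ℚₚ.<-irrefl refl (p≤q q q<p))

Forcing : OrderedGraph → Pred ℝ 0ℓ
Forcing F α = ∃[ C ] (∀ (d : ℕ) (H : Graph (Cube d)) → Rich α C H → H containsᶜ F)

rich-density : ∀ {d p} {H : Graph (Cube d)} {ℓ} → RichLevel (fromℚ p) H ℓ → p ≤ density-level H ℓ
rich-density {d} {p} {H} {ℓ} rich = subst (p ≤_) (levelEdges/τ H ℓ) (fromℚ-cancel rich)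

∧-proj₁ : ∀ a {b} → T (a ∧ b) → T a
∧-proj₁ true _ = tt

forcing : ∀ F G α δ → 0ℚ < δ →
  (∀ G′ → G contains G′ → nat (e G) * α - δ ≤ nat (e G′) → G′ contains F) → Forcing F (fromℚ α)
forcing F G α δ 0<δ dense = proj₁ copies , λ { d H (L , C≤L , rich) →
  let φ , mono , e≥ = proj₂ copies H L C≤L (λ ℓ ℓ∈L → rich-density {H = H} (rich ℓ ℓ∈L)) in
  pullback-contains F G H φ mono (dense (pullback G φ H)
    (⊑⇒contains {g = graph (pullback G φ H)} {graph G} (λ u v → ∧-proj₁ (adj (graph G) u v))) e≥) }
  where
  copies = dense-copy G α δ 0<δ

forcing-above : ∀ F G r α .{{_ : NonZero (e G)}} → IsRelativeDensity F G r → r < α → Forcing F (fromℚ α)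
forcing-above F G r α max r<α = forcing F G α δ 0<δ
  (λ G′ ι e≥ → dense⇒contains {F} {G} {r} max G′ ι (ℚₚ.<-≤-trans (<-by 0<δ (eq (nat (e G)) α r)) e≥))
  where
  -- Half of the gap between `r * e G` and `α * e G`; after losing it, strictly more than `r * e G`
  -- edges remain.
  δ = ½ * (nat (e G) * (α - r))
  0<δ : 0ℚ < δ
  0<δ = 0<* (ℚₚ.positive⁻¹ ½) (0<* (0<nat (e G)) (<⇒0<- r<α))
  eq : ∀ m a r → m * a - ½ * (m * (a - r)) ≡ m * r + ½ * (m * (a - r))
  eq = solve-∀ ring

symmetrize : ∀ {n} (g h : Graph (Fin n)) →
             (∀ u v → u Fin.< v → T (adj g u v) → T (adj h u v)) → g ⊑ h
symmetrize g h f u v uv with Finₚ.<-cmp u v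
... | tri< u<v _ _  = f u v u<v uv
... | tri≈ _ refl _ = ⊥-elim (subst T (adj-irrefl g u) uv)
... | tri> _ _ v<u  = subst T (adj-sym h v u) (f v u v<u (subst T (adj-sym g u v) uv))

-- For graphs `G` of relative density 1, which no `α ≤ 1` exceeds. Here `F` itself is mapped into
-- the cube, and since a loss of at most `½` is less than one edge, all of its edges land in `H`.
forcing-one : ∀ F → Forcing F (fromℚ 1ℚ)
forcing-one F = let C , copy = dense-copy F 1ℚ ½ (ℚₚ.positive⁻¹ ½) in C , λ { d H (L , C≤L , rich) →
  let φ , mono , e≥ = copy H L C≤L (λ ℓ ℓ∈L → rich-density {H = H} (rich ℓ ℓ∈L))
      F∩H = graph (pullback F φ H)
      complete : ∀ u v → u Fin.< v → T (adj (graph F) u v) → T (adj F∩H u v)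
      complete = edges-complete {g = F∩H} {graph F} (λ u v → ∧-proj₁ (adj (graph F) u v)) e≥
  in  pullback-contains F F H φ mono (⊑⇒contains {g = graph F} {F∩H} (symmetrize (graph F) F∩H complete)) }

<-⊓ : ∀ {p q r} → p < q → p < r → p < q ℚ.⊓ r
<-⊓ {p} {q} {r} p<q p<r =
  [ (λ eq → subst (p <_) (sym eq) p<q) , (λ eq → subst (p <_) (sym eq) p<r) ]′ (ℚₚ.⊓-sel q r)

ForcingRange : OrderedGraph → Pred ℝ 0ℓ
ForcingRange F α = fromℚ 0ℚ ≤ᵣ α × α ≤ᵣ fromℚ 1ℚ × Forcing F α

forcing-infimum : ∀ F q α → 0ℚ ≤ α → α ≤ 1ℚ → Forcing F (fromℚ α) → α < q → infimum (ForcingRange F) q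
forcing-infimum F q α 0≤α α≤1 f α<q = fromℚ α , (fromℚ-mono 0≤α , fromℚ-mono α≤1 , f) , α<q

r<1∨1≤r : ∀ r → r < 1ℚ ⊎ 1ℚ ≤ r
r<1∨1≤r r with r ℚₚ.<? 1ℚ
... | yes r<1 = inj₁ r<1
... | no  r≮1 = inj₂ (ℚₚ.≮⇒≥ r≮1)

density-below-one : ∀ F G .{{_ : NonZero (e G)}} q r → IsRelativeDensity F G r →
  (∃[ α ] r < α × α < q ℚ.⊓ 1ℚ) → infimum (ForcingRange F) q
density-below-one F G q r max (α , r<α , α<q⊓1) = forcing-infimum F q α
  (ℚₚ.≤-trans (0≤relativeDensity {F} {G} {r} max) (ℚₚ.<⇒≤ r<α))
  (ℚₚ.<⇒≤ (ℚₚ.<-≤-trans α<q⊓1 (ℚₚ.p⊓q≤q q 1ℚ)))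
  (forcing-above F G r α max r<α)
  (ℚₚ.<-≤-trans α<q⊓1 (ℚₚ.p⊓q≤p q 1ℚ))

density-above : ∀ F G .{{_ : NonZero (e G)}} q r → IsRelativeDensity F G r → r < q →
                infimum (ForcingRange F) q
density-above F G q r max r<q = [
  (λ r<1 → density-below-one F G q r max (ℚₚ.<-dense (<-⊓ r<q r<1))) ,
  (λ 1≤r → forcing-infimum F q 1ℚ 0≤1 ℚₚ.≤-refl (forcing-one F) (ℚₚ.≤-<-trans 1≤r r<q)) ]′
  (r<1∨1≤r r)

ρ<⊆ : ∀ F {q} → ρ< F q → infimum (ForcingRange F) q
ρ<⊆ F {q} (_ , density G r max , r<q) = density-above F G q r max r<q

-- Random sections of the blow-up

branch : ∀ {d} → (Cube d → Bool) → (Cube d → Bool) → Cube (suc d) → Bool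
branch σ τ (false ∷ x) = σ x
branch σ τ (true ∷ x)  = τ x

randomFunction : ∀ d → Mean (Cube d → Bool)
randomFunction zero    = mapᴹ (λ b _ → b) coin
randomFunction (suc d) = bind (randomFunction d) (λ σ → mapᴹ (branch σ) (randomFunction d))

randomFunction-at : ∀ d x (f : Bool → ℚ) → E (randomFunction d) (λ σ → f (σ x)) ≡ E coin f
randomFunction-at zero    []          f = refl
randomFunction-at (suc d) (false ∷ x) f = trans
  (E-cong (randomFunction d) (λ σ → E-const (randomFunction d) (f (σ x)))) (randomFunction-at d x f)
randomFunction-at (suc d) (true ∷ x)  f = trans
  (E-const (randomFunction d) (E (randomFunction d) (λ τ → f (τ x)))) (randomFunction-at d x f)

-- Pairwise independence of the values. An edge involves only two labels, so this is what the
-- computation of means over sections rests on.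
randomFunction-pair : ∀ d x y (f : Bool → Bool → ℚ) → x ≢ y →
  E (randomFunction d) (λ σ → f (σ x) (σ y)) ≡ E coin (λ b → E coin (f b))
randomFunction-pair zero [] [] f x≢y = contradiction refl x≢y
randomFunction-pair (suc d) (false ∷ x) (false ∷ y) f x≢y = trans
  (E-cong (randomFunction d) (λ σ → E-const (randomFunction d) (f (σ x) (σ y))))
  (randomFunction-pair d x y f (λ { refl → x≢y refl }))
randomFunction-pair (suc d) (true ∷ x) (true ∷ y) f x≢y = trans
  (E-const (randomFunction d) (E (randomFunction d) (λ τ → f (τ x) (τ y))))
  (randomFunction-pair d x y f (λ { refl → x≢y refl }))
randomFunction-pair (suc d) (false ∷ x) (true ∷ y) f _ = trans
  (E-cong (randomFunction d) (λ σ → randomFunction-at d y (f (σ x))))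
  (randomFunction-at d x (λ b → E coin (f b)))
randomFunction-pair (suc d) (true ∷ x) (false ∷ y) f _ = trans
  (E-cong (randomFunction d) (λ σ → randomFunction-at d x (λ b → f b (σ y))))
  (trans (randomFunction-at d y (λ c → E coin (λ b → f b c)))
         (coin-swap coin (λ c b → f b c)))

UU : ∀ {K} → (Cube K → Cube K → ℚ) → ℚ
UU {K} h = E (uniform K) (λ s → E (uniform K) (h s))

UU-suc : ∀ {K} (h : Cube (suc K) → Cube (suc K) → ℚ) →
  UU h ≡ E coin (λ b → E coin (λ c → UU (λ s t → h (b ∷ s) (c ∷ t))))
UU-suc {K} h = E-cong coin {f = λ b → E (uniform K) (λ s → E coin (λ c → E (uniform K) (λ t → h (b ∷ s) (c ∷ t))))}
  (λ b → sym (coin-swap (uniform K) (λ c s → E (uniform K) (λ t → h (b ∷ s) (c ∷ t)))))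

∏ : List A → (A → ℚ) → ℚ
∏ []       f = 1ℚ
∏ (x ∷ xs) f = f x * ∏ xs f

_≟ᶜ_ : ∀ {d} (x y : Cube d) → Dec (x ≡ y)
_≟ᶜ_ = Vecₚ.≡-dec Bool._≟_

-- The fraction of pairs of bits that one map allows: half of them if the images coincide and the
-- bits must agree, otherwise all.
factor : Bool → ℚ
factor true  = ½
factor false = 1ℚ

Maps : ℕ → Set
Maps d = List (Cube d → Cube d)

module _ {d : ℕ} where

  section : (πs : Maps d) → Mean (Cube d → Cube (length πs))
  section []       = dirac (λ _ → [])
  section (π ∷ πs) = bind (randomFunction d) (λ σ → mapᴹ (λ s x → σ (π x) ∷ s x) (section πs))

  weight : Maps d → Cube d → Cube d → ℚ
  weight πs x y = ∏ πs (λ π → factor (does (π x ≟ᶜ π y)))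

  compatible : (πs : Maps d) → Cube d → Cube d → Cube (length πs) → Cube (length πs) → Bool
  compatible []       x y []      []      = true
  compatible (π ∷ πs) x y (b ∷ s) (c ∷ t) =
    not (does (π x ≟ᶜ π y) ∧ (b xor c)) ∧ compatible πs x y s t

  -- Any two values of a random section are uniform among compatible pairs of labels, a set
  -- of density weight πs x y.
  section-pair : ∀ πs x y (f : Cube (length πs) → Cube (length πs) → ℚ) →
    weight πs x y * E (section πs) (λ s → f (s x) (s y)) ≡
    UU (λ s t → ⟦ compatible πs x y s t ⟧ * f s t)
  section-pair []       x y f = refl
  section-pair (π ∷ πs) x y f = step (π x ≟ᶜ π y)
    where
    w = weight πs x y
    G R : Bool → Bool → ℚ
    G b c = E (section πs) (λ s → f (b ∷ s x) (c ∷ s y))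
    R b c = UU (λ s t → ⟦ compatible πs x y s t ⟧ * f (b ∷ s) (c ∷ t))
    wG≡R : ∀ b c → w * G b c ≡ R b c
    wG≡R b c = section-pair πs x y (λ s t → f (b ∷ s) (c ∷ t))
    zero-UU : ∀ b c → UU (λ s t → 0ℚ * f (b ∷ s) (c ∷ t)) ≡ 0ℚ
    zero-UU b c = trans (E-cong (uniform K) (λ s → trans (E-cong (uniform K) (λ t → ℚₚ.*-zeroˡ (f (b ∷ s) (c ∷ t))))
                                                        (E-const (uniform K) 0ℚ)))
                        (E-const (uniform K) 0ℚ)
      where K = length πs
    eq₁ : ∀ w p q → ½ * w * (½ * (p + q)) ≡ ½ * (½ * (w * p + 0ℚ) + ½ * (0ℚ + w * q))
    eq₁ = solve-∀ ring
    eq₂ : ∀ w p q r s → 1ℚ * w * (½ * (½ * (p + q) + ½ * (r + s))) ≡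
                        ½ * (½ * (w * p + w * q) + ½ * (w * r + w * s))
    eq₂ = solve-∀ ring
    cong₄ : ∀ {p q r s p′ q′ r′ s′} → p ≡ p′ → q ≡ q′ → r ≡ r′ → s ≡ s′ →
            ½ * (½ * (p + q) + ½ * (r + s)) ≡ ½ * (½ * (p′ + q′) + ½ * (r′ + s′))
    cong₄ refl refl refl refl = refl
    step : (π≟ : Dec (π x ≡ π y)) →
      factor (does π≟) * w * E (randomFunction d) (λ σ → G (σ (π x)) (σ (π y))) ≡
      UU (λ s t → ⟦ not (does π≟ ∧ (Vec.head s xor Vec.head t)) ∧ compatible πs x y (Vec.tail s) (Vec.tail t) ⟧ * f s t)
    step (yes eq) = begin
      -- Equal images receive the same bit, so only the two diagonal choices of bits occur; on the
      -- right compatibility removes the other two.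
      ½ * w * E (randomFunction d) (λ σ → G (σ (π x)) (σ (π y)))
        ≡⟨ cong (½ * w *_) (trans
             (E-cong (randomFunction d) (λ σ → cong (λ z → G (σ (π x)) (σ z)) (sym eq)))
             (randomFunction-at d (π x) (λ b → G b b))) ⟩
      ½ * w * (½ * (G false false + G true true))
        ≡⟨ eq₁ w (G false false) (G true true) ⟩
      ½ * (½ * (w * G false false + 0ℚ) + ½ * (0ℚ + w * G true true))
        ≡⟨ cong₄ (wG≡R false false) (sym (zero-UU false true)) (sym (zero-UU true false)) (wG≡R true true) ⟩
      ½ * (½ * (R false false + UU (λ s t → 0ℚ * f (false ∷ s) (true ∷ t))) +
           ½ * (UU (λ s t → 0ℚ * f (true ∷ s) (false ∷ t)) + R true true))
        ≡⟨ UU-suc h ⟨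
      UU h
        ∎
      where
      open ≡-Reasoning
      h : Cube (suc (length πs)) → Cube (suc (length πs)) → ℚ
      h s t = ⟦ not (true ∧ (Vec.head s xor Vec.head t)) ∧ compatible πs x y (Vec.tail s) (Vec.tail t) ⟧ * f s t
    step (no π≢) = begin
      1ℚ * w * E (randomFunction d) (λ σ → G (σ (π x)) (σ (π y)))
        ≡⟨ cong (1ℚ * w *_) (randomFunction-pair d (π x) (π y) G π≢) ⟩
      1ℚ * w * (½ * (½ * (G false false + G false true) + ½ * (G true false + G true true)))
        ≡⟨ eq₂ w (G false false) (G false true) (G true false) (G true true) ⟩
      ½ * (½ * (w * G false false + w * G false true) + ½ * (w * G true false + w * G true true))
        ≡⟨ cong₄ (wG≡R false false) (wG≡R false true) (wG≡R true false) (wG≡R true true) ⟩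
      ½ * (½ * (R false false + R false true) + ½ * (R true false + R true true))
        ≡⟨ UU-suc h ⟨
      UU h
        ∎
      where
      open ≡-Reasoning
      h : Cube (suc (length πs)) → Cube (suc (length πs)) → ℚ
      h s t = ⟦ not (false ∧ (Vec.head s xor Vec.head t)) ∧ compatible πs x y (Vec.tail s) (Vec.tail t) ⟧ * f s t

  section-∑∑ : ∀ πs (k : Cube d → Cube d → ℚ) (h : Cube d → Cube d → Cube (length πs) → Cube (length πs) → ℚ) →
    E (section πs) (λ s → ∑∑ d (λ x y → k x y * (weight πs x y * h x y (s x) (s y)))) ≡
    ∑∑ d (λ x y → k x y * UU (λ s t → ⟦ compatible πs x y s t ⟧ * h x y s t))
  section-∑∑ πs k h = begin
    E S (λ s → ∑∑ d (λ x y → k x y * (weight πs x y * h x y (s x) (s y))))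
      ≡⟨ E-∑ S (cube d) (λ s x → ∑ (cube d) (λ y → k x y * (weight πs x y * h x y (s x) (s y)))) ⟩
    ∑ (cube d) (λ x → E S (λ s → ∑ (cube d) (λ y → k x y * (weight πs x y * h x y (s x) (s y)))))
      ≡⟨ ∑-cong (cube d) (λ x → E-∑ S (cube d) (λ s y → k x y * (weight πs x y * h x y (s x) (s y)))) ⟩
    ∑∑ d (λ x y → E S (λ s → k x y * (weight πs x y * h x y (s x) (s y))))
      ≡⟨ ∑∑-cong d (λ x y → trans (E-* S (k x y) (λ s → weight πs x y * h x y (s x) (s y)))
           (cong (k x y *_) (trans (E-* S (weight πs x y) (λ s → h x y (s x) (s y))) (section-pair πs x y (h x y))))) ⟩
    ∑∑ d (λ x y → k x y * UU (λ s t → ⟦ compatible πs x y s t ⟧ * h x y s t))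
      ∎
    where
    open ≡-Reasoning
    S = section πs

-- Maps for which all levels of the cube get the same total weight

precedesᵇ : ∀ {d} → Cube d → Cube d → Bool
precedesᵇ []      []      = false
precedesᵇ (b ∷ x) (c ∷ y) = (not b ∧ c) ∨ (not (b xor c) ∧ precedesᵇ x y)

precedesᵇ⇒≢ : ∀ {d} (x y : Cube d) → T (precedesᵇ x y) → x ≢ y
precedesᵇ⇒≢ (false ∷ x) (.false ∷ .x) p refl = precedesᵇ⇒≢ x x p refl
precedesᵇ⇒≢ (true ∷ x)  (.true ∷ .x)  p refl = precedesᵇ⇒≢ x x p refl

lift : ∀ {d} → (Cube d → Cube d) → Cube (suc d) → Cube (suc d)
lift π (b ∷ x) = b ∷ π x

infixl 6 _⊕_

_⊕_ : ∀ {d} → Cube d → Cube d → Cube d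
_⊕_ = Vec.zipWith _xor_

-- Folds the two halves of the cube together with a translation by `z`. It is injective on each
-- half, and for given `x` and `y` exactly one `z` identifies `false ∷ x` with `true ∷ y`.
shift : ∀ {d} → Cube d → Cube (suc d) → Cube (suc d)
shift z (false ∷ x) = false ∷ x
shift z (true ∷ x)  = false ∷ x ⊕ z

-- Two points separated at level ℓ (counted from 0) are identified by d - 1 - ℓ of these maps.
maps : ∀ d → Maps d
maps zero    = []
maps (suc d) = map lift (maps d) ++ List.concat (List.replicate d (map shift (cube d)))

∏-++ : ∀ (xs ys : List A) f → ∏ (xs ++ ys) f ≡ ∏ xs f * ∏ ys f
∏-++ []       ys f = sym (ℚₚ.*-identityˡ (∏ ys f))
∏-++ (x ∷ xs) ys f = trans (cong (f x *_) (∏-++ xs ys f)) (sym (ℚₚ.*-assoc (f x) (∏ xs f) (∏ ys f)))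

∏-map : ∀ (h : A → B) xs f → ∏ (map h xs) f ≡ ∏ xs (f ∘ h)
∏-map h []       f = refl
∏-map h (x ∷ xs) f = cong (f (h x) *_) (∏-map h xs f)

∏-cong : ∀ (xs : List A) {f g} → (∀ x → f x ≡ g x) → ∏ xs f ≡ ∏ xs g
∏-cong []       f≗g = refl
∏-cong (x ∷ xs) f≗g = cong₂ _*_ (f≗g x) (∏-cong xs f≗g)

∏-one : ∀ (xs : List A) {f} → (∀ x → f x ≡ 1ℚ) → ∏ xs f ≡ 1ℚ
∏-one []       f≗1 = refl
∏-one (x ∷ xs) {f} f≗1 = cong₂ _*_ (f≗1 x) (∏-one xs f≗1)

∏-concat-replicate : ∀ n (xs : List A) f → ∏ xs f ≡ ½ → ∏ (List.concat (List.replicate n xs)) f ≡ half n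
∏-concat-replicate zero    xs f eq = refl
∏-concat-replicate (suc n) xs f eq = trans (∏-++ xs (List.concat (List.replicate n xs)) f)
  (cong₂ _*_ eq (∏-concat-replicate n xs f eq))

factor-≢ : ∀ {d} (x y : Cube d) → x ≢ y → factor (does (x ≟ᶜ y)) ≡ 1ℚ
factor-≢ x y x≢y = cong factor (dec-false (x ≟ᶜ y) x≢y)

factor-∷ : ∀ {d} b (x y : Cube d) → factor (does ((b ∷ x) ≟ᶜ (b ∷ y))) ≡ factor (does (x ≟ᶜ y))
factor-∷ b x y = cong factor (does-⇔ (mk⇔ (λ { refl → refl }) (cong (b ∷_))) ((b ∷ x) ≟ᶜ (b ∷ y)) (x ≟ᶜ y))

⊕-cancel : ∀ {d} (x y z : Cube d) → x ⊕ z ≡ y ⊕ z → x ≡ y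
⊕-cancel []      []      []      _  = refl
⊕-cancel (a ∷ x) (b ∷ y) (c ∷ z) eq = cong₂ _∷_ (xor-cancel a b c (cong Vec.head eq)) (⊕-cancel x y z (cong Vec.tail eq))
  where
  xor-cancel : ∀ a b c → a xor c ≡ b xor c → a ≡ b
  xor-cancel false false c     _ = refl
  xor-cancel true  true  c     _ = refl
  xor-cancel false true  true  ()
  xor-cancel false true  false ()
  xor-cancel true  false true  ()
  xor-cancel true  false false ()

∏-cube-suc : ∀ d f → ∏ (cube (suc d)) f ≡ ∏ (cube d) (f ∘ (false ∷_)) * ∏ (cube d) (f ∘ (true ∷_))
∏-cube-suc d f = trans (∏-++ (map (false ∷_) (cube d)) _ f)
  (cong₂ _*_ (∏-map (false ∷_) (cube d) f) (∏-map (true ∷_) (cube d) f))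

-- x = y ⊕ z for exactly one z.
∏-shifts : ∀ d (x y : Cube d) → ∏ (cube d) (λ z → factor (does (x ≟ᶜ (y ⊕ z)))) ≡ ½
∏-shifts zero [] [] = refl
∏-shifts (suc d) (b ∷ x) (c ∷ y) = trans (∏-cube-suc d (λ z → factor (does ((b ∷ x) ≟ᶜ ((c ∷ y) ⊕ z))))) (halves b c)
  where
  equal : ∀ a → ∏ (cube d) (λ z → factor (does ((a ∷ x) ≟ᶜ (a ∷ y ⊕ z)))) ≡ ½
  equal a = trans (∏-cong (cube d) (λ z → factor-∷ a x (y ⊕ z))) (∏-shifts d x y)
  unequal : ∀ a a′ → a ≢ a′ → ∏ (cube d) (λ z → factor (does ((a ∷ x) ≟ᶜ (a′ ∷ y ⊕ z)))) ≡ 1ℚ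
  unequal a a′ a≢a′ = ∏-one (cube d) (λ z → factor-≢ (a ∷ x) (a′ ∷ y ⊕ z) (λ eq → a≢a′ (cong Vec.head eq)))
  halves : ∀ b c → ∏ (cube d) (λ z → factor (does ((b ∷ x) ≟ᶜ ((c xor false) ∷ y ⊕ z)))) *
                   ∏ (cube d) (λ z → factor (does ((b ∷ x) ≟ᶜ ((c xor true) ∷ y ⊕ z)))) ≡ ½
  halves false false = cong₂ _*_ (equal false) (unequal false true λ ())
  halves true  true  = cong₂ _*_ (equal true) (unequal true false λ ())
  halves false true  = cong₂ _*_ (unequal false true λ ()) (equal false)
  halves true  false = cong₂ _*_ (unequal true false λ ()) (equal true)

-- Shifts are injective on each half and contribute factors 1; the lifted maps see only the tails.
weight-same : ∀ d b {x y : Cube d} → x ≢ y → weight (maps (suc d)) (b ∷ x) (b ∷ y) ≡ weight (maps d) x y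
weight-same d b {x} {y} x≢y = trans (∏-++ (map lift (maps d)) _ f) (trans (cong₂ _*_
    (trans (∏-map lift (maps d) f) (∏-cong (maps d) (λ π → factor-∷ b (π x) (π y))))
    (shifts d))
  (ℚₚ.*-identityʳ (weight (maps d) x y)))
  where
  f : (Cube (suc d) → Cube (suc d)) → ℚ
  f π = factor (does (π (b ∷ x) ≟ᶜ π (b ∷ y)))
  moved : ∀ b z → shift z (b ∷ x) ≢ shift z (b ∷ y)
  moved false z eq = x≢y (cong Vec.tail eq)
  moved true  z eq = x≢y (⊕-cancel x y z (cong Vec.tail eq))
  once : ∏ (map shift (cube d)) f ≡ 1ℚ
  once = trans (∏-map shift (cube d) f) (∏-one (cube d) (λ z → factor-≢ (shift z (b ∷ x)) (shift z (b ∷ y)) (moved b z)))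
  shifts : ∀ n → ∏ (List.concat (List.replicate n (map shift (cube d)))) f ≡ 1ℚ
  shifts zero    = refl
  shifts (suc n) = trans (∏-++ (map shift (cube d)) _ f) (cong₂ _*_ once (shifts n))

-- Lifted maps keep the first bit and identify nothing here, while each of the `d` rounds of shifts
-- contributes one factor `½`.
weight-split : ∀ d (x y : Cube d) → weight (maps (suc d)) (false ∷ x) (true ∷ y) ≡ half d
weight-split d x y = trans (∏-++ (map lift (maps d)) _ f) (trans (cong₂ _*_
    (trans (∏-map lift (maps d) f) (∏-one (maps d) (λ π → factor-≢ (false ∷ π x) (true ∷ π y) (λ eq → case cong Vec.head eq of λ ()))))
    (∏-concat-replicate d (map shift (cube d)) f (trans (∏-map shift (cube d) f)
      (trans (∏-cong (cube d) (λ z → factor-∷ false x (y ⊕ z))) (∏-shifts d x y)))))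
  (ℚₚ.*-identityˡ (half d)))
  where
  f : (Cube (suc d) → Cube (suc d)) → ℚ
  f π = factor (does (π (false ∷ x) ≟ᶜ π (true ∷ y)))

pow*half : ∀ d → pow d * half d ≡ 1ℚ
pow*half zero    = refl
pow*half (suc d) = trans (cong (_* (½ * half d)) (pow-suc d)) (trans (eq (pow d) (half d)) (pow*half d))
  where
  eq : ∀ p h → (p + p) * (½ * h) ≡ p * h
  eq = solve-∀ ring

∑-allFin-suc : ∀ n f → ∑ (allFin (suc n)) f ≡ f zero + ∑ (allFin n) (f ∘ suc)
∑-allFin-suc n f = cong (f zero +_)
  (trans (cong (λ xs → ∑ xs f) (sym (Listₚ.map-tabulate {n = n} id suc))) (∑-map suc (allFin n) f))

levelSum : ∀ {d} → (Cube d → Cube d → ℚ) → ℚ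
levelSum {d} h = ∑ (allFin d) (λ ℓ → E (levelMean ℓ) (uncurry h))

guard-cong : ∀ b {p q} → (T b → p ≡ q) → ⟦ b ⟧ * p ≡ ⟦ b ⟧ * q
guard-cong true          eq = cong (1ℚ *_) (eq tt)
guard-cong false {p} {q} _  = trans (ℚₚ.*-zeroˡ p) (sym (ℚₚ.*-zeroˡ q))

-- Counting levels from 0, level `ℓ` has `2^(2d-ℓ-2)` pairs of weight `2^-(d-1-ℓ)` each. The total
-- `2^(d-1)` does not depend on `ℓ`, so the sum of all weighted pairs is a multiple of the plain sum
-- of the level densities.
weighted-sum : ∀ d (h : Cube d → Cube d → ℚ) →
  ∑∑ d (λ x y → ⟦ precedesᵇ x y ⟧ * (weight (maps d) x y * h x y)) ≡ ½ * pow d * levelSum h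
weighted-sum zero h = eq (weight (maps zero) [] [] * h [] [])
  where
  eq : ∀ p → (0ℚ * p + 0ℚ) + 0ℚ ≡ ½ * (1ℚ + 0ℚ) * 0ℚ
  eq = solve-∀ ring
weighted-sum (suc d) h = begin
  ∑∑ (suc d) g
    ≡⟨ ∑∑-suc d g ⟩
  (∑∑ d (λ x y → g (false ∷ x) (false ∷ y)) + ∑∑ d (λ x y → g (false ∷ x) (true ∷ y))) +
  (∑∑ d (λ x y → g (true ∷ x) (false ∷ y)) + ∑∑ d (λ x y → g (true ∷ x) (true ∷ y)))
    ≡⟨ cong₂ _+_ (cong₂ _+_ (same false) split) (cong₂ _+_ (∑∑-zero d (λ x y → ℚₚ.*-zeroˡ
         (weight (maps (suc d)) (true ∷ x) (false ∷ y) * h (true ∷ x) (false ∷ y)))) (same true)) ⟩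
  (½ * p * levelSum h₀ + p * E₀) + (0ℚ + ½ * p * levelSum h₁)
    ≡⟨ eq p E₀ (levelSum h₀) (levelSum h₁) ⟩
  ½ * (p + p) * (E₀ + ½ * (levelSum h₀ + levelSum h₁))
    ≡⟨ cong₂ (λ a b → ½ * a * b) (pow-suc d) sum ⟨
  ½ * pow (suc d) * levelSum h
    ∎
  where
  open ≡-Reasoning
  p = pow d
  g : Cube (suc d) → Cube (suc d) → ℚ
  g x y = ⟦ precedesᵇ x y ⟧ * (weight (maps (suc d)) x y * h x y)
  h₀ h₁ h₀₁ : Cube d → Cube d → ℚ
  h₀ x y = h (false ∷ x) (false ∷ y)
  h₁ x y = h (true ∷ x) (true ∷ y)
  h₀₁ x y = h (false ∷ x) (true ∷ y)
  E₀ = UU h₀₁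
  same : ∀ b → ∑∑ d (λ x y → ⟦ (not b ∧ b) ∨ (not (b xor b) ∧ precedesᵇ x y) ⟧ *
                               (weight (maps (suc d)) (b ∷ x) (b ∷ y) * h (b ∷ x) (b ∷ y))) ≡
               ½ * p * levelSum (λ x y → h (b ∷ x) (b ∷ y))
  same false = trans (∑∑-cong d (λ x y → guard-cong (precedesᵇ x y)
    (λ lt → cong (_* h₀ x y) (weight-same d false (precedesᵇ⇒≢ x y lt))))) (weighted-sum d h₀)
  same true  = trans (∑∑-cong d (λ x y → guard-cong (precedesᵇ x y)
    (λ lt → cong (_* h₁ x y) (weight-same d true (precedesᵇ⇒≢ x y lt))))) (weighted-sum d h₁)
  split : ∑∑ d (λ x y → 1ℚ * (weight (maps (suc d)) (false ∷ x) (true ∷ y) * h₀₁ x y)) ≡ p * E₀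
  split = begin
    ∑∑ d (λ x y → 1ℚ * (weight (maps (suc d)) (false ∷ x) (true ∷ y) * h₀₁ x y))
      ≡⟨ ∑∑-cong d (λ x y → trans (ℚₚ.*-identityˡ (weight (maps (suc d)) (false ∷ x) (true ∷ y) * h₀₁ x y))
                                  (cong (_* h₀₁ x y) (weight-split d x y))) ⟩
    ∑∑ d (λ x y → half d * h₀₁ x y)
      ≡⟨ ∑-cong (cube d) (λ x → ∑-* (cube d) (half d) (h₀₁ x)) ⟩
    ∑ (cube d) (λ x → half d * ∑ (cube d) (h₀₁ x))
      ≡⟨ ∑-* (cube d) (half d) (λ x → ∑ (cube d) (h₀₁ x)) ⟩
    half d * ∑∑ d h₀₁
      ≡⟨ cong (half d *_) (∑∑-uniform d h₀₁) ⟩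
    half d * (p * p * E₀)
      ≡⟨ eq′ (half d) p E₀ ⟩
    (p * half d) * (p * E₀)
      ≡⟨ cong (_* (p * E₀)) (pow*half d) ⟩
    1ℚ * (p * E₀)
      ≡⟨ ℚₚ.*-identityˡ (p * E₀) ⟩
    p * E₀
      ∎
    where
    eq′ : ∀ h p e → h * (p * p * e) ≡ (p * h) * (p * e)
    eq′ = solve-∀ ring
  sum : levelSum h ≡ E₀ + ½ * (levelSum h₀ + levelSum h₁)
  sum = trans (∑-allFin-suc d (λ ℓ → E (levelMean ℓ) (uncurry h))) (cong (E₀ +_)
    (trans (∑-* (allFin d) ½ (λ ℓ → E (levelMean ℓ) (uncurry h₀) + E (levelMean ℓ) (uncurry h₁)))
           (cong (½ *_) (∑-+ (allFin d) (λ ℓ → E (levelMean ℓ) (uncurry h₀)) (λ ℓ → E (levelMean ℓ) (uncurry h₁))))))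
  eq : ∀ p e a b → (½ * p * a + p * e) + (0ℚ + ½ * p * b) ≡ ½ * (p + p) * (e + ½ * (a + b))
  eq = solve-∀ ring

-- The identity maps do not affect the weights of distinct points; the longer the labels, the
-- smaller the fraction of edges lost with a bounded number of vertices.
padded : ∀ d → ℕ → Maps d
padded d k = maps d ++ List.replicate k id

weight-padded : ∀ d k {x y : Cube d} → x ≢ y → weight (padded d k) x y ≡ weight (maps d) x y
weight-padded d k {x} {y} x≢y = trans (∏-++ (maps d) (List.replicate k id) f)
  (trans (cong (∏ (maps d) f *_) (ids k)) (ℚₚ.*-identityʳ (∏ (maps d) f)))
  where
  f : (Cube d → Cube d) → ℚ
  f π = factor (does (π x ≟ᶜ π y))
  ids : ∀ k → ∏ (List.replicate k id) f ≡ 1ℚ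
  ids zero    = refl
  ids (suc k) = cong₂ _*_ (factor-≢ x y x≢y) (ids k)

weighted-sum-padded : ∀ d k (h : Cube d → Cube d → ℚ) →
  ∑∑ d (λ x y → ⟦ precedesᵇ x y ⟧ * (weight (padded d k) x y * h x y)) ≡ ½ * pow d * levelSum h
weighted-sum-padded d k h = trans (∑∑-cong d (λ x y → guard-cong (precedesᵇ x y)
  (λ lt → cong (_* h x y) (weight-padded d k (precedesᵇ⇒≢ x y lt))))) (weighted-sum d h)

-- The blow-up of the cube

precedesᵇ-asym : ∀ {d} (x y : Cube d) → T (precedesᵇ x y) → ¬ T (precedesᵇ y x)
precedesᵇ-asym []          []          ()
precedesᵇ-asym (false ∷ x) (false ∷ y) = precedesᵇ-asym x y
precedesᵇ-asym (true ∷ x)  (true ∷ y)  = precedesᵇ-asym x y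
precedesᵇ-asym (false ∷ x) (true ∷ y)  = λ _ ()

cube-sorted : ∀ d → AllPairs (λ x y → T (precedesᵇ x y)) (cube d)
cube-sorted zero    = [] ∷ []
cube-sorted (suc d) = AllPairsₚ.++⁺ (AllPairsₚ.map⁺ (cube-sorted d)) (AllPairsₚ.map⁺ (cube-sorted d))
  (Allₚ.map⁺ (All.universal (λ x → Allₚ.map⁺ (All.universal (λ y → tt) (cube d))) (cube d)))

lookup-AllPairs : ∀ {R : Rel A 0ℓ} {xs : List A} → AllPairs R xs →
                  ∀ {i k} → i Fin.< k → R (List.lookup xs i) (List.lookup xs k)
lookup-AllPairs {xs = x ∷ xs} (rs ∷ _) {zero} {suc k} _ = All.lookup rs (∈-lookup k)
lookup-AllPairs (_ ∷ rs) {suc i} {suc k} (ℕ.s≤s i<k) = lookup-AllPairs rs i<k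

∑-lookup : ∀ (xs : List A) f → ∑ (allFin (length xs)) (f ∘ List.lookup xs) ≡ ∑ xs f
∑-lookup xs f = trans (sym (∑-map (List.lookup xs) (allFin (length xs)) f))
  (cong (λ ys → ∑ ys f) (trans (Listₚ.map-tabulate id (List.lookup xs)) (Listₚ.tabulate-lookup xs)))

module BlowUp {d : ℕ} (πs : Maps d) where

  K = length πs

  Vertex : Set
  Vertex = Cube d × Cube K

  vertices : List Vertex
  vertices = cartesianProduct (cube d) (cube K)

  N = length vertices

  vertex : Fin N → Vertex
  vertex = List.lookup vertices

  part : Fin N → Cube d
  part = proj₁ ∘ vertex

  -- Between parts this is the order of the cube. Inside a part, where the blow-up has no edges, it
  -- records only distinctness, enough for `vertex` to be injective.
  _◁_ : Rel Vertex 0ℓ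
  (x , s) ◁ (y , t) = T (precedesᵇ x y) ⊎ (x ≡ y × s ≢ t)

  sorted : ∀ xs → AllPairs (λ x y → T (precedesᵇ x y)) xs → AllPairs _◁_ (cartesianProduct xs (cube K))
  sorted []       []         = []
  sorted (x ∷ xs) (rs ∷ rss) = AllPairsₚ.++⁺
    (AllPairsₚ.map⁺ (AllPairs.map (λ {s} {t} st → inj₂ (refl , precedesᵇ⇒≢ s t st)) (cube-sorted K)))
    (sorted xs rss)
    (Allₚ.map⁺ (All.universal (λ s → before s rs) (cube K)))
    where
    before : ∀ s {ys} → All (λ y → T (precedesᵇ x y)) ys → All ((x , s) ◁_) (cartesianProduct ys (cube K))
    before s []       = []
    before s (r ∷ rs) = Allₚ.++⁺ (Allₚ.map⁺ (All.universal (λ t → inj₁ r) (cube K))) (before s rs)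

  vertex-◁ : ∀ {i k} → i Fin.< k → vertex i ◁ vertex k
  vertex-◁ = lookup-AllPairs (sorted (cube d) (cube-sorted d))

  ◁-irrefl : ∀ {p q} → p ≡ q → ¬ p ◁ q
  ◁-irrefl {p = x , s} refl (inj₁ lt)        = precedesᵇ⇒≢ x x lt refl
  ◁-irrefl {p = x , s} refl (inj₂ (_ , s≢s)) = s≢s refl

  vertex-injective : ∀ {i k} → vertex i ≡ vertex k → i ≡ k
  vertex-injective {i} {k} eq with Finₚ.<-cmp i k
  ... | tri< i<k _ _ = contradiction (vertex-◁ i<k) (◁-irrefl eq)
  ... | tri≈ _ i≡k _ = i≡k
  ... | tri> _ _ k<i = contradiction (vertex-◁ k<i) (◁-irrefl (sym eq))

  part-reflects : ∀ i k → T (precedesᵇ (part i) (part k)) → i Fin.< k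
  part-reflects i k lt with Finₚ.<-cmp i k
  ... | tri< i<k _ _  = i<k
  ... | tri≈ _ refl _ = contradiction refl (precedesᵇ⇒≢ (part i) (part i) lt)
  ... | tri> _ _ k<i with vertex-◁ k<i
  ...   | inj₁ gt       = contradiction gt (precedesᵇ-asym (part i) (part k) lt)
  ...   | inj₂ (eq , _) = contradiction (sym eq) (precedesᵇ⇒≢ (part i) (part k) lt)

  linked : Vertex → Vertex → Bool
  linked (x , s) (y , t) = not (does (x ≟ᶜ y)) ∧ compatible πs x y s t

  linked-part : ∀ p q → proj₁ p ≡ proj₁ q → linked p q ≡ false
  linked-part (x , s) (y , t) eq = cong (λ b → not b ∧ compatible πs x y s t) (dec-true (x ≟ᶜ y) eq)

  linked⇒precedes : ∀ i k → i Fin.< k → T (linked (vertex i) (vertex k)) → T (precedesᵇ (part i) (part k))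
  linked⇒precedes i k i<k l with vertex-◁ i<k
  ... | inj₁ lt       = lt
  ... | inj₂ (eq , _) = ⊥-elim (subst T (linked-part (vertex i) (vertex k) eq) l)

  compatible-sym : ∀ (πs : Maps d) x y s t → compatible πs x y s t ≡ compatible πs y x t s
  compatible-sym []       x y []      []      = refl
  compatible-sym (π ∷ πs) x y (b ∷ s) (c ∷ t) = cong₂ (λ a e → not a ∧ e)
    (cong₂ _∧_ (does-⇔ (mk⇔ sym sym) (π x ≟ᶜ π y) (π y ≟ᶜ π x)) (Boolₚ.xor-comm b c))
    (compatible-sym πs x y s t)

  blowUp : OrderedGraph
  blowUp = record { order = N ; graph = record
    { adj        = λ i k → linked (vertex i) (vertex k)
    ; adj-sym    = λ i k → symmetric (vertex i) (vertex k)
    ; adj-irrefl = λ i → linked-part (vertex i) (vertex i) refl } }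
    where
    symmetric : ∀ p q → linked p q ≡ linked q p
    symmetric (x , s) (y , t) = cong₂ (λ a e → not a ∧ e)
      (does-⇔ (mk⇔ sym sym) (x ≟ᶜ y) (y ≟ᶜ x)) (compatible-sym πs x y s t)

  ∑∑-vertices : ∀ (h : Cube d → Cube d → Cube K → Cube K → ℚ) →
    ∑ vertices (λ p → ∑ vertices (λ q →
      ⟦ precedesᵇ (proj₁ p) (proj₁ q) ⟧ * h (proj₁ p) (proj₁ q) (proj₂ p) (proj₂ q))) ≡
    pow K * pow K * ∑∑ d (λ x y → ⟦ precedesᵇ x y ⟧ * UU (h x y))
  ∑∑-vertices h = begin
    ∑ vertices (λ p → ∑ vertices (λ q → g (proj₁ p) (proj₁ q) (proj₂ p) (proj₂ q)))
      ≡⟨ ∑-cartesianProduct (cube d) (cube K) (λ p → ∑ vertices (λ q → g (proj₁ p) (proj₁ q) (proj₂ p) (proj₂ q))) ⟩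
    ∑ (cube d) (λ x → ∑ (cube K) (λ s → ∑ vertices (λ q → g x (proj₁ q) s (proj₂ q))))
      ≡⟨ ∑-cong (cube d) (λ x → ∑-cong (cube K) (λ s → ∑-cartesianProduct (cube d) (cube K) (λ q → g x (proj₁ q) s (proj₂ q)))) ⟩
    ∑ (cube d) (λ x → ∑ (cube K) (λ s → ∑ (cube d) (λ y → ∑ (cube K) (λ t → g x y s t))))
      ≡⟨ ∑-cong (cube d) (λ x → ∑-swap (cube K) (cube d) (λ s y → ∑ (cube K) (λ t → g x y s t))) ⟩
    ∑∑ d (λ x y → ∑∑ K (g x y))
      ≡⟨ ∑∑-cong d inner ⟩
    ∑∑ d (λ x y → pow K * pow K * (⟦ precedesᵇ x y ⟧ * UU (h x y)))
      ≡⟨ ∑-cong (cube d) (λ x → ∑-* (cube d) (pow K * pow K) (λ y → ⟦ precedesᵇ x y ⟧ * UU (h x y))) ⟩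
    ∑ (cube d) (λ x → pow K * pow K * ∑ (cube d) (λ y → ⟦ precedesᵇ x y ⟧ * UU (h x y)))
      ≡⟨ ∑-* (cube d) (pow K * pow K) (λ x → ∑ (cube d) (λ y → ⟦ precedesᵇ x y ⟧ * UU (h x y))) ⟩
    pow K * pow K * ∑∑ d (λ x y → ⟦ precedesᵇ x y ⟧ * UU (h x y))
      ∎
    where
    open ≡-Reasoning
    g : Cube d → Cube d → Cube K → Cube K → ℚ
    g x y s t = ⟦ precedesᵇ x y ⟧ * h x y s t
    inner : ∀ x y → ∑∑ K (g x y) ≡ pow K * pow K * (⟦ precedesᵇ x y ⟧ * UU (h x y))
    inner x y = trans (∑∑-uniform K (g x y)) (cong (pow K * pow K *_)
      (trans (E-cong (uniform K) (λ s → E-* (uniform K) ⟦ precedesᵇ x y ⟧ (h x y s)))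
             (E-* (uniform K) ⟦ precedesᵇ x y ⟧ (λ s → E (uniform K) (h x y s)))))

  -- Linked vertices lie in different parts, and such vertices are ordered as their parts are.
  edge≡ : ∀ i k → edge blowUp (i , k) ≡ precedesᵇ (part i) (part k) ∧
                  compatible πs (part i) (part k) (proj₂ (vertex i)) (proj₂ (vertex k))
  edge≡ i k = equal (i Finₚ.<? k) (precedesᵇ (part i) (part k)) refl
    where
    c = compatible πs (part i) (part k) (proj₂ (vertex i)) (proj₂ (vertex k))
    equal : (i<?k : Dec (i Fin.< k)) → ∀ b → precedesᵇ (part i) (part k) ≡ b →
            does i<?k ∧ linked (vertex i) (vertex k) ≡ b ∧ c
    equal (yes i<k) true  eq = cong (λ b → not b ∧ c) (dec-false (part i ≟ᶜ part k)
      (precedesᵇ⇒≢ (part i) (part k) (subst T (sym eq) tt)))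
    equal (no i≮k)  true  eq = contradiction (part-reflects i k (subst T (sym eq) tt)) i≮k
    equal (no i≮k)  false eq = refl
    equal (yes i<k) false eq = not-linked (linked (vertex i) (vertex k)) refl
      where
      not-linked : ∀ l → linked (vertex i) (vertex k) ≡ l → l ≡ false
      not-linked false _  = refl
      not-linked true  l≡ = ⊥-elim (subst T eq (linked⇒precedes i k i<k (subst T (sym l≡) tt)))

  -- `section-pair` for the constant function 1 counts the compatible pairs of labels over each pair
  -- of points.
  e-blowUp : nat (e blowUp) ≡ pow K * pow K * ∑∑ d (λ x y → ⟦ precedesᵇ x y ⟧ * (weight πs x y * 1ℚ))
  e-blowUp = begin
    nat (e blowUp)
      ≡⟨ e≡∑ blowUp ⟩
    ∑ (pairs blowUp) (λ p → ⟦ edge blowUp p ⟧)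
      ≡⟨ ∑-cartesianProduct (allFin N) (allFin N) (λ p → ⟦ edge blowUp p ⟧) ⟩
    ∑ (allFin N) (λ i → ∑ (allFin N) (λ k → ⟦ edge blowUp (i , k) ⟧))
      ≡⟨ ∑-cong (allFin N) (λ i → ∑-cong (allFin N) (λ k → trans (cong ⟦_⟧ (edge≡ i k)) (guarded (vertex i) (vertex k)))) ⟩
    ∑ (allFin N) (λ i → ∑ (allFin N) (λ k → f (vertex i) (vertex k)))
      ≡⟨ ∑-cong (allFin N) (λ i → ∑-lookup vertices (f (vertex i))) ⟩
    ∑ (allFin N) (λ i → ∑ vertices (f (vertex i)))
      ≡⟨ ∑-lookup vertices (λ p → ∑ vertices (f p)) ⟩
    ∑ vertices (λ p → ∑ vertices (f p))
      ≡⟨ ∑∑-vertices (λ x y s t → ⟦ compatible πs x y s t ⟧ * 1ℚ) ⟩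
    pow K * pow K * ∑∑ d (λ x y → ⟦ precedesᵇ x y ⟧ * UU (λ s t → ⟦ compatible πs x y s t ⟧ * 1ℚ))
      ≡⟨ cong (pow K * pow K *_) (∑∑-cong d (λ x y → cong (⟦ precedesᵇ x y ⟧ *_)
           (trans (sym (section-pair πs x y (λ _ _ → 1ℚ))) (cong (weight πs x y *_) (E-const (section πs) 1ℚ))))) ⟩
    pow K * pow K * ∑∑ d (λ x y → ⟦ precedesᵇ x y ⟧ * (weight πs x y * 1ℚ))
      ∎
    where
    open ≡-Reasoning
    f : Vertex → Vertex → ℚ
    f p q = ⟦ precedesᵇ (proj₁ p) (proj₁ q) ⟧ * (⟦ compatible πs (proj₁ p) (proj₁ q) (proj₂ p) (proj₂ q) ⟧ * 1ℚ)
    guarded : ∀ p q → ⟦ precedesᵇ (proj₁ p) (proj₁ q) ∧ compatible πs (proj₁ p) (proj₁ q) (proj₂ p) (proj₂ q) ⟧ ≡ f p q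
    guarded p q = trans (⟦∧⟧ (precedesᵇ (proj₁ p) (proj₁ q)) (compatible πs (proj₁ p) (proj₁ q) (proj₂ p) (proj₂ q)))
      (cong (⟦ precedesᵇ (proj₁ p) (proj₁ q) ⟧ *_)
        (sym (ℚₚ.*-identityʳ ⟦ compatible πs (proj₁ p) (proj₁ q) (proj₂ p) (proj₂ q) ⟧)))

-- Trimming a subgraph

∑-punchIn : ∀ {n} (c : Fin (suc n)) f → ∑ (allFin (suc n)) f ≡ f c + ∑ (allFin n) (f ∘ Fin.punchIn c)
∑-punchIn {n}     zero    f = ∑-allFin-suc n f
∑-punchIn {suc n} (suc c) f = begin
  ∑ (allFin (suc (suc n))) f
    ≡⟨ ∑-allFin-suc (suc n) f ⟩
  f zero + ∑ (allFin (suc n)) (f ∘ suc)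
    ≡⟨ cong (f zero +_) (∑-punchIn c (f ∘ suc)) ⟩
  f zero + (f (suc c) + ∑ (allFin n) (f ∘ suc ∘ Fin.punchIn c))
    ≡⟨ eq (f zero) (f (suc c)) (∑ (allFin n) (f ∘ suc ∘ Fin.punchIn c)) ⟩
  f (suc c) + (f zero + ∑ (allFin n) (f ∘ suc ∘ Fin.punchIn c))
    ≡⟨ cong (f (suc c) +_) (∑-allFin-suc n (f ∘ Fin.punchIn (suc c))) ⟨
  f (suc c) + ∑ (allFin (suc n)) (f ∘ Fin.punchIn (suc c))
    ∎
  where
  open ≡-Reasoning
  eq : ∀ p q r → p + (q + r) ≡ q + (p + r)
  eq = solve-∀ ring

∑-injective : ∀ {m n} (ι : Fin m → Fin n) → (∀ {i k} → ι i ≡ ι k → i ≡ k) →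
              ∀ f → (∀ i → 0ℚ ≤ f i) → ∑ (allFin m) (f ∘ ι) ≤ ∑ (allFin n) f
∑-injective {zero}  {n} ι inj f 0≤f = 0≤∑ (allFin n) 0≤f
∑-injective {suc m} {zero} ι inj f 0≤f with () ← ι zero
∑-injective {suc m} {suc n} ι inj f 0≤f = begin
  ∑ (allFin (suc m)) (f ∘ ι)
    ≡⟨ ∑-allFin-suc m (f ∘ ι) ⟩
  f c + ∑ (allFin m) (f ∘ ι ∘ suc)
    ≡⟨ cong (f c +_) (∑-cong (allFin m) (λ i → cong f (sym (Finₚ.punchIn-punchOut (c≢ i))))) ⟩
  f c + ∑ (allFin m) (λ i → f (Fin.punchIn c (Fin.punchOut (c≢ i))))
    ≤⟨ ℚₚ.+-monoʳ-≤ (f c) (∑-injective (λ i → Fin.punchOut (c≢ i))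
         (λ {i} {k} eq → Finₚ.suc-injective (inj (Finₚ.punchOut-injective (c≢ i) (c≢ k) eq)))
         (f ∘ Fin.punchIn c) (λ i → 0≤f (Fin.punchIn c i))) ⟩
  f c + ∑ (allFin n) (f ∘ Fin.punchIn c)
    ≡⟨ ∑-punchIn c f ⟨
  ∑ (allFin (suc n)) f
    ∎
  where
  open ℚₚ.≤-Reasoning
  c = ι zero
  c≢ : ∀ i → c ≢ ι (suc i)
  c≢ i eq with () ← inj eq

∑-telescope : ∀ m (f : ℕ → ℚ) →
  ∑ (allFin m) (λ i → f (suc (toℕ i))) + f 0 ≡ ∑ (allFin m) (λ i → f (toℕ i)) + f m
∑-telescope zero    f = refl
∑-telescope (suc m) f = begin
  ∑ (allFin (suc m)) (λ i → f (suc (toℕ i))) + f 0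
    ≡⟨ cong (_+ f 0) (∑-allFin-suc m (λ i → f (suc (toℕ i)))) ⟩
  (f 1 + S₂) + f 0
    ≡⟨ eq₁ (f 1) S₂ (f 0) ⟩
  f 0 + (S₂ + f 1)
    ≡⟨ cong (f 0 +_) (∑-telescope m (f ∘ suc)) ⟩
  f 0 + (S₁ + f (suc m))
    ≡⟨ ℚₚ.+-assoc (f 0) S₁ (f (suc m)) ⟨
  (f 0 + S₁) + f (suc m)
    ≡⟨ cong (_+ f (suc m)) (∑-allFin-suc m (λ i → f (toℕ i))) ⟨
  ∑ (allFin (suc m)) (λ i → f (toℕ i)) + f (suc m)
    ∎
  where
  open ≡-Reasoning
  S₁ = ∑ (allFin m) (λ i → f (suc (toℕ i)))
  S₂ = ∑ (allFin m) (λ i → f (suc (suc (toℕ i))))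
  eq₁ : ∀ p q r → (p + q) + r ≡ r + (q + p)
  eq₁ = solve-∀ ring

-- A shift by one drops a nonnegative first value and adds one value past the end, which is at most
-- `M`.
∑-shift : ∀ m n M (P : ℕ → ℚ) → (∀ i → 0ℚ ≤ P i) → (∀ i → P i ≤ M) →
  ∑ (allFin m) (λ i → P (toℕ i ℕ.+ n)) ≤ ∑ (allFin m) (λ i → P (toℕ i)) + nat n * M
∑-shift m zero M P 0≤P P≤M = ℚₚ.≤-reflexive (trans
  (∑-cong (allFin m) (λ i → cong P (ℕₚ.+-identityʳ (toℕ i)))) (eq (∑ (allFin m) (λ i → P (toℕ i))) M))
  where
  eq : ∀ p q → p ≡ p + 0ℚ * q
  eq = solve-∀ ring
∑-shift m (suc n) M P 0≤P P≤M = begin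
  ∑ (allFin m) (λ i → P (toℕ i ℕ.+ suc n))
    ≡⟨ ∑-cong (allFin m) (λ i → cong P (ℕₚ.+-suc (toℕ i) n)) ⟩
  ∑ (allFin m) (λ i → P (suc (toℕ i ℕ.+ n)))
    ≤⟨ ≤-by (0≤+ (0≤P n) (≤⇒0≤- (P≤M (m ℕ.+ n))))
         (trans (eq₁ S M (P (m ℕ.+ n)))
         (trans (cong (_+ (M - P (m ℕ.+ n))) (sym (∑-telescope m (λ i → P (i ℕ.+ n)))))
                (ℚₚ.+-assoc (∑ (allFin m) (λ i → P (suc (toℕ i ℕ.+ n)))) (P n) (M - P (m ℕ.+ n))))) ⟩
  S + M
    ≤⟨ ℚₚ.+-monoˡ-≤ M (∑-shift m n M P 0≤P P≤M) ⟩
  (∑ (allFin m) (λ i → P (toℕ i)) + nat n * M) + M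
    ≡⟨ eq₂ (∑ (allFin m) (λ i → P (toℕ i))) (nat n) M ⟩
  ∑ (allFin m) (λ i → P (toℕ i)) + nat (suc n) * M
    ∎
  where
  open ℚₚ.≤-Reasoning
  S = ∑ (allFin m) (λ i → P (toℕ i ℕ.+ n))
  eq₁ : ∀ s M p → s + M ≡ (s + p) + (M - p)
  eq₁ = solve-∀ ring
  eq₂ : ∀ s n M → (s + n * M) + M ≡ s + (1ℚ + n) * M
  eq₂ = solve-∀ ring

∑-below : ∀ m n → ∑ (allFin m) (λ i → ⟦ toℕ i ℕ.<ᵇ n ⟧) ≤ nat n
∑-below zero    n       = 0≤nat n
∑-below (suc m) zero    = ℚₚ.≤-reflexive (∑-zero (allFin (suc m)))
∑-below (suc m) (suc n) = subst (_≤ nat (suc n)) (sym (∑-allFin-suc m (λ i → ⟦ toℕ i ℕ.<ᵇ suc n ⟧)))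
  (ℚₚ.+-monoʳ-≤ 1ℚ (∑-below m n))

-- Positions with room for n more positions before them and, in the same fibre of P, after them.
module Deep (n m M : ℕ) (P : ℕ → ℕ) (P-mono : ∀ {i k} → i ℕ.≤ k → P i ℕ.≤ P k) (P≤M : ∀ i → P i ℕ.≤ M) where

  IsDeep : ℕ → Set
  IsDeep i = n ℕ.≤ i × P (i ℕ.+ n) ≡ P i

  isDeep? : ∀ i → Dec (IsDeep i)
  isDeep? i = (n ℕₚ.≤? i) ×-dec (P (i ℕ.+ n) ℕₚ.≟ P i)

  shallow : ℕ → ℚ
  shallow i = ⟦ not (does (isDeep? i)) ⟧

  -- A shallow position is one of the first `n`, or `P` jumps within the next `n` positions, and a
  -- jump of natural numbers is at least 1.
  shallow≤ : ∀ i → shallow i ≤ ⟦ i ℕ.<ᵇ n ⟧ + (nat (P (i ℕ.+ n)) - nat (P i))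
  shallow≤ i = bound (n ℕₚ.≤? i) (P (i ℕ.+ n) ℕₚ.≟ P i)
    where
    0≤jump : 0ℚ ≤ nat (P (i ℕ.+ n)) - nat (P i)
    0≤jump = ≤⇒0≤- (nat-mono (P-mono (ℕₚ.m≤m+n i n)))
    bound : (a : Dec (n ℕ.≤ i)) (b : Dec (P (i ℕ.+ n) ≡ P i)) →
            ⟦ not (does a ∧ does b) ⟧ ≤ ⟦ i ℕ.<ᵇ n ⟧ + (nat (P (i ℕ.+ n)) - nat (P i))
    bound (yes _)   (yes _)  = 0≤+ (0≤⟦⟧ (i ℕ.<ᵇ n)) 0≤jump
    bound (yes _)   (no P≢P) = ≤-by (0≤+ (0≤⟦⟧ (i ℕ.<ᵇ n)) (≤⇒0≤- (nat-mono
                                 (ℕₚ.≤∧≢⇒< (P-mono (ℕₚ.m≤m+n i n)) (P≢P ∘ sym)))))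
      (eq ⟦ i ℕ.<ᵇ n ⟧ (nat (P (i ℕ.+ n))) (nat (P i)))
      where
      eq : ∀ a p q → a + (p - q) ≡ 1ℚ + (a + (p - (1ℚ + q)))
      eq = solve-∀ ring
    bound (no n≰i)  b = ≤-by 0≤jump (cong (λ c → ⟦ c ⟧ + (nat (P (i ℕ.+ n)) - nat (P i)))
      (dec-true (i ℕₚ.<? n) (ℕₚ.≰⇒> n≰i)))

  -- The jumps `P (i + n) - P i` add up to at most `n * M` by `∑-shift`, so the bound does not grow
  -- with the number `m` of positions. In the application `M` is `2^d`, independent of the length of
  -- the labels.
  ∑-shallow : ∑ (allFin m) (shallow ∘ toℕ) ≤ nat n * (1ℚ + nat M)
  ∑-shallow = begin
    ∑ (allFin m) (shallow ∘ toℕ)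
      ≤⟨ ∑-mono (allFin m) (shallow≤ ∘ toℕ) ⟩
    ∑ (allFin m) (λ i → ⟦ toℕ i ℕ.<ᵇ n ⟧ + (nat (P (toℕ i ℕ.+ n)) - nat (P (toℕ i))))
      ≡⟨ ∑-+ (allFin m) (λ i → ⟦ toℕ i ℕ.<ᵇ n ⟧) (λ i → nat (P (toℕ i ℕ.+ n)) - nat (P (toℕ i))) ⟩
    ∑ (allFin m) (λ i → ⟦ toℕ i ℕ.<ᵇ n ⟧) + ∑ (allFin m) (λ i → nat (P (toℕ i ℕ.+ n)) - nat (P (toℕ i)))
      ≤⟨ ℚₚ.+-mono-≤ (∑-below m n) jumps ⟩
    nat n + nat n * nat M
      ≡⟨ eq (nat n) (nat M) ⟩
    nat n * (1ℚ + nat M)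
      ∎
    where
    open ℚₚ.≤-Reasoning
    Q = nat ∘ P
    S = ∑ (allFin m) (λ i → Q (toℕ i))
    eq : ∀ n M → n + n * M ≡ n * (1ℚ + M)
    eq = solve-∀ ring
    eq′ : ∀ s t → (s + t) - s ≡ t
    eq′ = solve-∀ ring
    neg : ∀ p → - p ≡ - 1ℚ * p
    neg = solve-∀ ring
    jumps : ∑ (allFin m) (λ i → Q (toℕ i ℕ.+ n) - Q (toℕ i)) ≤ nat n * nat M
    jumps = begin
      ∑ (allFin m) (λ i → Q (toℕ i ℕ.+ n) - Q (toℕ i))
        ≡⟨ ∑-+ (allFin m) (λ i → Q (toℕ i ℕ.+ n)) (λ i → - Q (toℕ i)) ⟩
      ∑ (allFin m) (λ i → Q (toℕ i ℕ.+ n)) + ∑ (allFin m) (λ i → - Q (toℕ i))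
        ≡⟨ cong (∑ (allFin m) (λ i → Q (toℕ i ℕ.+ n)) +_) (trans (∑-cong (allFin m) (λ i → neg (Q (toℕ i))))
             (trans (∑-* (allFin m) (- 1ℚ) (λ i → Q (toℕ i))) (sym (neg S)))) ⟩
      ∑ (allFin m) (λ i → Q (toℕ i ℕ.+ n)) - S
        ≤⟨ ℚₚ.+-monoˡ-≤ (- S) (∑-shift m n (nat M) Q (λ i → 0≤nat (P i)) (λ i → nat-mono (P≤M i))) ⟩
      (S + nat n * nat M) - S
        ≡⟨ eq′ S (nat n * nat M) ⟩
      nat n * nat M
        ∎

-- Ranks in the cube and placing the vertices of a pattern

rank : ∀ {d} → Cube d → ℕ
rank []              = 0
rank {suc d} (b ∷ x) = (if b then 2 ℕ.^ d else 0) ℕ.+ rank x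

rank< : ∀ {d} (x : Cube d) → rank x ℕ.< 2 ℕ.^ d
rank< []                  = ℕ.s≤s ℕ.z≤n
rank< {suc d} (false ∷ x) = ℕₚ.≤-trans (rank< x) (ℕₚ.m≤m+n (2 ℕ.^ d) (2 ℕ.^ d ℕ.+ 0))
rank< {suc d} (true ∷ x)  = subst (λ k → 2 ℕ.^ d ℕ.+ rank x ℕ.< 2 ℕ.^ d ℕ.+ k) (sym (ℕₚ.+-identityʳ (2 ℕ.^ d)))
  (ℕₚ.+-monoʳ-< (2 ℕ.^ d) (rank< x))

rank-mono : ∀ {d} (x y : Cube d) → T (precedesᵇ x y) → rank x ℕ.< rank y
rank-mono []          []          ()
rank-mono {suc d} (false ∷ x) (true ∷ y)  _  = ℕₚ.≤-trans (rank< x) (ℕₚ.m≤m+n (2 ℕ.^ d) (rank y))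
rank-mono (false ∷ x) (false ∷ y) lt = rank-mono x y lt
rank-mono {suc d} (true ∷ x)  (true ∷ y)  lt = ℕₚ.+-monoʳ-< (2 ℕ.^ d) (rank-mono x y lt)

Placement : ∀ n → ℕ → ℕ → (Fin n → Maybe ℕ) → Set
Placement n m c prescribed = Σ[ g ∈ (Fin n → ℕ) ] (∀ {u v} → u Fin.< v → g u ℕ.< g v) ×
  (∀ u → c ℕ.≤ g u × g u ℕ.< m) × (∀ u {i} → prescribed u ≡ just i → g u ≡ i)

-- Values that are not prescribed (those of the isolated vertices of F) follow their predecessors
-- immediately.
place : ∀ n m c (prescribed : Fin n → Maybe ℕ) → c ℕ.+ n ℕ.≤ m →
  (∀ u {i} → prescribed u ≡ just i → c ℕ.+ toℕ u ℕ.≤ i × i ℕ.+ n ℕ.≤ toℕ u ℕ.+ m) →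
  (∀ u v {i k} → u Fin.< v → prescribed u ≡ just i → prescribed v ≡ just k → i ℕ.+ toℕ v ℕ.≤ k ℕ.+ toℕ u) →
  Placement n m c prescribed
place zero    m c prescribed fits room gaps =
  (λ ()) , (λ { {()} }) , (λ ()) , (λ ())
place (suc n) m c prescribed fits room gaps = extend (prescribed zero) refl
  where
  attach : ∀ i → c ℕ.≤ i → i ℕ.< m → (∀ {k} → prescribed zero ≡ just k → i ≡ k) → Placement n m (suc i) (prescribed ∘ suc) →
    Placement (suc n) m c prescribed
  attach i c≤i i<m here≡ (g , mono , bounds , values) = g⁺ , mono⁺ , bounds⁺ , values⁺
    where
    g⁺ : Fin (suc n) → ℕ
    g⁺ zero    = i
    g⁺ (suc u) = g u
    mono⁺ : ∀ {u v} → u Fin.< v → g⁺ u ℕ.< g⁺ v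
    mono⁺ {zero}  {suc v} _           = proj₁ (bounds v)
    mono⁺ {suc u} {suc v} (ℕ.s≤s u<v) = mono u<v
    bounds⁺ : ∀ u → c ℕ.≤ g⁺ u × g⁺ u ℕ.< m
    bounds⁺ zero    = c≤i , i<m
    bounds⁺ (suc u) = ℕₚ.≤-trans c≤i (ℕₚ.≤-trans (ℕₚ.n≤1+n i) (proj₁ (bounds u))) , proj₂ (bounds u)
    values⁺ : ∀ u {k} → prescribed u ≡ just k → g⁺ u ≡ k
    values⁺ zero    = here≡
    values⁺ (suc u) = values u
  rest : ∀ i → suc i ℕ.+ n ℕ.≤ m →
    (∀ u {k} → prescribed (suc u) ≡ just k → suc i ℕ.+ toℕ u ℕ.≤ k) → Placement n m (suc i) (prescribed ∘ suc)
  rest i fits′ room′ = place n m (suc i) (prescribed ∘ suc) fits′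
    (λ u {k} eq → room′ u eq , ℕ.s≤s⁻¹ (subst (ℕ._≤ suc (toℕ u) ℕ.+ m) (ℕₚ.+-suc k n) (proj₂ (room (suc u) eq))))
    (λ u v {i} {k} u<v eq eq′ → ℕ.s≤s⁻¹ (subst₂ ℕ._≤_ (ℕₚ.+-suc i (toℕ v)) (ℕₚ.+-suc k (toℕ u))
      (gaps (suc u) (suc v) (ℕ.s≤s u<v) eq eq′)))
  extend : ∀ p → prescribed zero ≡ p →
    Placement (suc n) m c prescribed
  extend nothing eq = attach c ℕₚ.≤-refl (ℕₚ.<-≤-trans (ℕₚ.m<m+n c (ℕ.s≤s ℕ.z≤n)) fits)
    (λ eq′ → case trans (sym eq) eq′ of λ ())
    (rest c (subst (ℕ._≤ m) (ℕₚ.+-suc c n) fits)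
      (λ u {k} eq′ → subst (ℕ._≤ k) (ℕₚ.+-suc c (toℕ u)) (proj₁ (room (suc u) eq′))))
  extend (just i) eq = attach i (subst (ℕ._≤ i) (ℕₚ.+-identityʳ c) (proj₁ (room zero eq)))
    (ℕₚ.<-≤-trans (ℕₚ.m<m+n i (ℕ.s≤s ℕ.z≤n)) (proj₂ (room zero eq)))
    (λ eq′ → just-injective (trans (sym eq) eq′))
    (rest i (subst (ℕ._≤ m) (ℕₚ.+-suc i n) (proj₂ (room zero eq)))
      (λ u {k} eq′ → subst₂ ℕ._≤_ (ℕₚ.+-suc i (toℕ u)) (ℕₚ.+-identityʳ k)
        (gaps zero (suc u) (ℕ.s≤s ℕ.z≤n) eq eq′)))

-- Transversals of a subgraph of the blow-up

precedes⇒precedesᵇ : ∀ {d} (ℓ : Fin d) x y → T (precedes ℓ x y) → T (precedesᵇ x y)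
precedes⇒precedesᵇ zero    (false ∷ x) (true ∷ y)  _ = tt
precedes⇒precedesᵇ (suc ℓ) (false ∷ x) (false ∷ y) p = precedes⇒precedesᵇ ℓ x y p
precedes⇒precedesᵇ (suc ℓ) (true ∷ x)  (true ∷ y)  p = precedes⇒precedesᵇ ℓ x y p

≺⇒rank< : ∀ {d} (x y : Cube d) → x ≺ y → rank x ℕ.< rank y
≺⇒rank< x y (ℓ , δ , eq) = rank-mono x y (precedes⇒precedesᵇ ℓ x y (IsDelta⇒precedes ℓ x y δ eq))

T-does : ∀ {P : Set} (p? : Dec P) → T (does p?) → P
T-does (yes p) _ = p

does-T : ∀ {P : Set} (p? : Dec P) → P → T (does p?)
does-T (yes _)  _ = tt
does-T (no ¬p) p = ⊥-elim (¬p p)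

module Subgraph {d : ℕ} (πs : Maps d) (n : ℕ) (G′ : OrderedGraph)
                (ι : BlowUp.blowUp πs contains G′) where

  open BlowUp πs
  open Embedding ι

  m = order G′

  at : Fin m → Vertex
  at i = vertex (to i)

  at-injective : ∀ {i k} → at i ≡ at k → i ≡ k
  at-injective eq = injective (vertex-injective eq)

  rank-at : ∀ {i k} → i Fin.< k → rank (proj₁ (at i)) ℕ.≤ rank (proj₁ (at k))
  rank-at {i} {k} i<k with vertex-◁ (monotone i<k)
  ... | inj₁ lt       = ℕₚ.<⇒≤ (rank-mono (proj₁ (at i)) (proj₁ (at k)) lt)
  ... | inj₂ (eq , _) = ℕₚ.≤-reflexive (cong rank eq)

  -- The default `2^d` past the last vertex exceeds every rank, so a deep position `i < m` also
  -- satisfies `i + n < m`.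
  rank-or-top : ∀ p → Dec (p ℕ.< m) → ℕ
  rank-or-top p (yes p<m) = rank (proj₁ (at (Fin.fromℕ< p<m)))
  rank-or-top p (no _)    = 2 ℕ.^ d

  P : ℕ → ℕ
  P p = rank-or-top p (p ℕₚ.<? m)

  P≤ : ∀ p → P p ℕ.≤ 2 ℕ.^ d
  P≤ p = bound (p ℕₚ.<? m)
    where
    bound : ∀ p<? → rank-or-top p p<? ℕ.≤ 2 ℕ.^ d
    bound (yes p<m) = ℕₚ.<⇒≤ (rank< (proj₁ (at (Fin.fromℕ< p<m))))
    bound (no _)    = ℕₚ.≤-refl

  P-mono : ∀ {p q} → p ℕ.≤ q → P p ℕ.≤ P q
  P-mono {p} {q} p≤q = bound (p ℕₚ.<? m) (q ℕₚ.<? m) (ℕₚ.m≤n⇒m<n∨m≡n p≤q)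
    where
    bound : ∀ p<? q<? → p ℕ.< q ⊎ p ≡ q → rank-or-top p p<? ℕ.≤ rank-or-top q q<?
    bound (yes p<m) (no _)    _          = ℕₚ.<⇒≤ (rank< (proj₁ (at (Fin.fromℕ< p<m))))
    bound (no p≮m)  (yes q<m) _          = contradiction (ℕₚ.≤-<-trans p≤q q<m) p≮m
    bound (no _)    (no _)    _          = ℕₚ.≤-refl
    bound (yes p<m) (yes q<m) (inj₁ p<q) = rank-at
      (subst₂ ℕ._<_ (sym (Finₚ.toℕ-fromℕ< p<m)) (sym (Finₚ.toℕ-fromℕ< q<m)) p<q)
    bound (yes p<m) (yes q<m) (inj₂ p≡q) = ℕₚ.≤-reflexive
      (cong (λ i → rank (proj₁ (at i))) (Finₚ.toℕ-injective
        (trans (Finₚ.toℕ-fromℕ< p<m) (trans p≡q (sym (Finₚ.toℕ-fromℕ< q<m))))))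

  P-at : ∀ i → P (toℕ i) ≡ rank (proj₁ (at i))
  P-at i = equal (toℕ i ℕₚ.<? m)
    where
    equal : ∀ i<? → rank-or-top (toℕ i) i<? ≡ rank (proj₁ (at i))
    equal (yes i<m) = cong (λ k → rank (proj₁ (at k))) (Finₚ.fromℕ<-toℕ i i<m)
    equal (no i≮m)  = contradiction (Finₚ.toℕ<n i) i≮m

  P-top : ∀ p → m ℕ.≤ p → P p ≡ 2 ℕ.^ d
  P-top p m≤p = equal (p ℕₚ.<? m)
    where
    equal : ∀ p<? → rank-or-top p p<? ≡ 2 ℕ.^ d
    equal (yes p<m) = contradiction p<m (ℕₚ.≤⇒≯ m≤p)
    equal (no _)    = refl

  open Deep n m (2 ℕ.^ d) P P-mono P≤

  -- The edges of `G′` between deep vertices, transferred to the blow-up: a section may select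
  -- vertices that `G′` lacks, and these simply carry no mark.
  Marked : Vertex → Vertex → Set
  Marked p q = ∃[ i ] ∃[ k ] (IsDeep (toℕ i) × IsDeep (toℕ k)) × (at i ≡ p × at k ≡ q) × T (adj (graph G′) i k)

  _≟ᵛ_ : (p q : Vertex) → Dec (p ≡ q)
  _≟ᵛ_ = Productₚ.≡-dec _≟ᶜ_ _≟ᶜ_

  marked? : ∀ p q → Dec (Marked p q)
  marked? p q = Finₚ.any? (λ i → Finₚ.any? (λ k →
    (isDeep? (toℕ i) ×-dec isDeep? (toℕ k)) ×-dec ((at i ≟ᵛ p) ×-dec (at k ≟ᵛ q)) ×-dec T? (adj (graph G′) i k)))

  marked : Vertex → Vertex → Bool
  marked p q = does (marked? p q)

  Marked-sym : ∀ {p q} → Marked p q → Marked q p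
  Marked-sym (i , k , (di , dk) , (eqi , eqk) , ik) =
    k , i , (dk , di) , (eqk , eqi) , subst T (adj-sym (graph G′) i k) ik

  Marked-irrefl : ∀ p → ¬ Marked p p
  Marked-irrefl p (i , k , _ , (eqi , eqk) , ik) with at-injective (trans eqi (sym eqk))
  ... | refl = subst T (adj-irrefl (graph G′) i) ik

  transversal : (Cube d → Cube K) → Graph (Cube d)
  transversal s = record
    { adj        = λ x y → marked (x , s x) (y , s y)
    ; adj-sym    = λ x y → does-⇔ (mk⇔ Marked-sym Marked-sym) (marked? (x , s x) (y , s y)) (marked? (y , s y) (x , s x))
    ; adj-irrefl = λ x → dec-false (marked? (x , s x) (x , s x)) (Marked-irrefl (x , s x)) }

  kept : Vertex → Vertex → ℚ
  kept p q = ⟦ precedesᵇ (proj₁ p) (proj₁ q) ⟧ *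
    (⟦ compatible πs (proj₁ p) (proj₁ q) (proj₂ p) (proj₂ q) ⟧ * ⟦ marked p q ⟧)

  0≤kept : ∀ p q → 0ℚ ≤ kept p q
  0≤kept p q = 0≤* (0≤⟦⟧ (precedesᵇ (proj₁ p) (proj₁ q)))
    (0≤* (0≤⟦⟧ (compatible πs (proj₁ p) (proj₁ q) (proj₂ p) (proj₂ q))) (0≤⟦⟧ (marked p q)))

  -- Either both ends are deep, and then the edge is marked and inherits order and compatibility
  -- from the blow-up, or a shallow end pays for it.
  edge≤ : ∀ i k → ⟦ edge G′ (i , k) ⟧ ≤ kept (at i) (at k) + (shallow (toℕ i) + shallow (toℕ k))
  edge≤ i k = bound (isDeep? (toℕ i)) (isDeep? (toℕ k))
    where
    p = at i
    q = at k
    a = precedesᵇ (proj₁ p) (proj₁ q)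
    b = compatible πs (proj₁ p) (proj₁ q) (proj₂ p) (proj₂ q)
    kept≡ : ⟦ a ∧ b ∧ marked p q ⟧ ≡ kept p q
    kept≡ = trans (⟦∧⟧ a (b ∧ marked p q)) (cong (⟦ a ⟧ *_) (⟦∧⟧ b (marked p q)))
    join : ∀ a b {c} → T (a ∧ b) → T c → T (a ∧ b ∧ c)
    join true true _ t = t
    keep : IsDeep (toℕ i) → IsDeep (toℕ k) → T (edge G′ (i , k)) → T (a ∧ b ∧ marked p q)
    keep di dk ik = join a b (subst T (edge≡ (to i) (to k)) (both (does (to i Finₚ.<? to k))
        (does-T (to i Finₚ.<? to k) (monotone i<k)) (edges adjacent)))
      (does-T (marked? p q) (i , k , (di , dk) , (refl , refl) , adjacent))
      where
      i<k = T-does (i Finₚ.<? k) (∧-proj₁ (does (i Finₚ.<? k)) ik)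
      adjacent : T (adj (graph G′) i k)
      adjacent = ∧-proj₂ (does (i Finₚ.<? k)) ik
      both : ∀ a {b} → T a → T b → T (a ∧ b)
      both true _ t = t
    1≤ : ∀ a b → 0ℚ ≤ a → 0ℚ ≤ b → ∀ c → ⟦ c ⟧ ≤ a + (1ℚ + b)
    1≤ a b 0≤a 0≤b c = ℚₚ.≤-trans (⟦⟧≤1 c) (≤-by (0≤+ 0≤a 0≤b) (eq a b))
      where
      eq : ∀ a b → a + (1ℚ + b) ≡ 1ℚ + (a + b)
      eq = solve-∀ ring
    bound : (x : Dec (IsDeep (toℕ i))) (y : Dec (IsDeep (toℕ k))) →
            ⟦ edge G′ (i , k) ⟧ ≤ kept p q + (⟦ not (does x) ⟧ + ⟦ not (does y) ⟧)
    bound (yes di) (yes dk) = subst (⟦ edge G′ (i , k) ⟧ ≤_) (trans kept≡ (eq (kept p q))) (⟦⟧-mono (keep di dk))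
      where
      eq : ∀ a → a ≡ a + (0ℚ + 0ℚ)
      eq = solve-∀ ring
    bound (no _)   y        = 1≤ (kept p q) ⟦ not (does y) ⟧ (0≤kept p q) (0≤⟦⟧ (not (does y))) (edge G′ (i , k))
    bound (yes _)  (no _)   = subst (λ z → ⟦ edge G′ (i , k) ⟧ ≤ kept p q + z) (ℚₚ.+-comm 1ℚ 0ℚ)
      (1≤ (kept p q) 0ℚ (0≤kept p q) ℚₚ.≤-refl (edge G′ (i , k)))

  -- Passing from the vertices of `G′` to all vertices of the blow-up only adds nonnegative terms.
  ∑-kept : ∑ (allFin m) (λ i → ∑ (allFin m) (λ k → kept (at i) (at k))) ≤
           pow K * pow K * ∑∑ d (λ x y → ⟦ precedesᵇ x y ⟧ *
             UU (λ s t → ⟦ compatible πs x y s t ⟧ * ⟦ marked (x , s) (y , t) ⟧))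
  ∑-kept = begin
    ∑ (allFin m) (λ i → ∑ (allFin m) (λ k → kept (at i) (at k)))
      ≤⟨ ∑-mono (allFin m) (λ i → ∑-injective to injective (λ k → kept (at i) (vertex k)) (λ k → 0≤kept (at i) (vertex k))) ⟩
    ∑ (allFin m) (λ i → ∑ (allFin N) (λ k → kept (at i) (vertex k)))
      ≤⟨ ∑-injective to injective (λ i → ∑ (allFin N) (λ k → kept (vertex i) (vertex k)))
           (λ i → 0≤∑ (allFin N) (λ k → 0≤kept (vertex i) (vertex k))) ⟩
    ∑ (allFin N) (λ i → ∑ (allFin N) (λ k → kept (vertex i) (vertex k)))
      ≡⟨ ∑-cong (allFin N) (λ i → ∑-lookup vertices (kept (vertex i))) ⟩
    ∑ (allFin N) (λ i → ∑ vertices (kept (vertex i)))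
      ≡⟨ ∑-lookup vertices (λ p → ∑ vertices (kept p)) ⟩
    ∑ vertices (λ p → ∑ vertices (kept p))
      ≡⟨ ∑∑-vertices (λ x y s t → ⟦ compatible πs x y s t ⟧ * ⟦ marked (x , s) (y , t) ⟧) ⟩
    pow K * pow K * ∑∑ d (λ x y → ⟦ precedesᵇ x y ⟧ *
      UU (λ s t → ⟦ compatible πs x y s t ⟧ * ⟦ marked (x , s) (y , t) ⟧))
      ∎
    where open ℚₚ.≤-Reasoning

  N≡ : nat N ≡ pow d * pow K
  N≡ = begin
    nat N                                         ≡⟨ ℚₚ.*-identityʳ (nat N) ⟨
    nat N * 1ℚ                                    ≡⟨ ∑-const vertices 1ℚ ⟨
    ∑ vertices (λ _ → 1ℚ)                         ≡⟨ ∑-cartesianProduct (cube d) (cube K) (λ _ → 1ℚ) ⟩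
    ∑ (cube d) (λ _ → ∑ (cube K) (λ _ → 1ℚ))      ≡⟨ ∑-cube d (λ _ → ∑ (cube K) (λ _ → 1ℚ)) ⟩
    pow d * E (uniform d) (λ _ → ∑ (cube K) (λ _ → 1ℚ))
      ≡⟨ cong (pow d *_) (E-const (uniform d) (∑ (cube K) (λ _ → 1ℚ))) ⟩
    pow d * ∑ (cube K) (λ _ → 1ℚ)
      ≡⟨ cong (pow d *_) (trans (∑-cube K (λ _ → 1ℚ)) (trans (cong (pow K *_) (E-const (uniform K) 1ℚ)) (ℚₚ.*-identityʳ (pow K)))) ⟩
    pow d * pow K                                 ∎
    where open ≡-Reasoning

  -- Bounds the pairs with a shallow end on a given side: `n * (1 + 2^d)` choices for that end by
  -- `∑-shallow`, and at most `2^d * 2^K` for the other. Both sides together give `lost + lost`.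
  lost : ℚ
  lost = pow d * pow K * (nat n * (1ℚ + pow d))

  m≤N : nat m ≤ pow d * pow K
  m≤N = subst (nat m ≤_) N≡ (nat-mono (Finₚ.injective⇒≤ injective))

  edges-kept : nat (e G′) ≤ pow K * pow K * ∑∑ d (λ x y → ⟦ precedesᵇ x y ⟧ *
    UU (λ s t → ⟦ compatible πs x y s t ⟧ * ⟦ marked (x , s) (y , t) ⟧)) + (lost + lost)
  edges-kept = begin
    nat (e G′)
      ≡⟨ e≡∑ G′ ⟩
    ∑ (pairs G′) (λ p → ⟦ edge G′ p ⟧)
      ≡⟨ ∑-cartesianProduct (allFin m) (allFin m) (λ p → ⟦ edge G′ p ⟧) ⟩
    ∑ (allFin m) (λ i → ∑ (allFin m) (λ k → ⟦ edge G′ (i , k) ⟧))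
      ≤⟨ ∑-mono (allFin m) (λ i → ∑-mono (allFin m) (edge≤ i)) ⟩
    ∑ (allFin m) (λ i → ∑ (allFin m) (λ k → kept (at i) (at k) + (sh i + sh k)))
      ≡⟨ ∑-cong (allFin m) (λ i → trans (∑-+ (allFin m) (λ k → kept (at i) (at k)) (λ k → sh i + sh k))
           (cong (∑ (allFin m) (λ k → kept (at i) (at k)) +_) (trans (∑-+ (allFin m) (λ _ → sh i) sh)
             (cong (_+ S) (∑-allFin-const m (sh i)))))) ⟩
    ∑ (allFin m) (λ i → ∑ (allFin m) (λ k → kept (at i) (at k)) + (nat m * sh i + S))
      ≡⟨ ∑-+ (allFin m) (λ i → ∑ (allFin m) (λ k → kept (at i) (at k))) (λ i → nat m * sh i + S) ⟩
    ∑ (allFin m) (λ i → ∑ (allFin m) (λ k → kept (at i) (at k))) + ∑ (allFin m) (λ i → nat m * sh i + S)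
      ≡⟨ cong (∑ (allFin m) (λ i → ∑ (allFin m) (λ k → kept (at i) (at k))) +_)
           (trans (∑-+ (allFin m) (λ i → nat m * sh i) (λ _ → S)) (cong₂ _+_ (∑-* (allFin m) (nat m) sh) (∑-allFin-const m S))) ⟩
    ∑ (allFin m) (λ i → ∑ (allFin m) (λ k → kept (at i) (at k))) + (nat m * S + nat m * S)
      ≤⟨ ℚₚ.+-mono-≤ ∑-kept (ℚₚ.+-mono-≤ mS≤ mS≤) ⟩
    pow K * pow K * ∑∑ d (λ x y → ⟦ precedesᵇ x y ⟧ *
      UU (λ s t → ⟦ compatible πs x y s t ⟧ * ⟦ marked (x , s) (y , t) ⟧)) + (lost + lost)
      ∎
    where
    open ℚₚ.≤-Reasoning
    sh : Fin m → ℚ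
    sh i = shallow (toℕ i)
    S = ∑ (allFin m) sh
    mS≤ : nat m * S ≤ lost
    mS≤ = ℚₚ.≤-trans (*-mono (0≤nat m) ∑-shallow)
      (subst₂ _≤_ (ℚₚ.*-comm bound (nat m)) (ℚₚ.*-comm bound (pow d * pow K)) (*-mono 0≤bound m≤N))
      where
      bound = nat n * (1ℚ + nat (2 ℕ.^ d))
      0≤bound : 0ℚ ≤ bound
      0≤bound = 0≤* (0≤nat n) (0≤+ 0≤1 (0≤nat (2 ℕ.^ d)))

  good-section : ∃[ s ] nat (e G′) ≤ pow K * pow K *
    ∑∑ d (λ x y → ⟦ precedesᵇ x y ⟧ * (weight πs x y * ⟦ adj (transversal s) x y ⟧)) + (lost + lost)
  good-section = proj₁ best , ℚₚ.≤-trans edges-kept (ℚₚ.+-monoˡ-≤ (lost + lost)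
    (*-mono (0≤* (ℚₚ.<⇒≤ (0<pow K)) (ℚₚ.<⇒≤ (0<pow K)))
      (subst (_≤ f (proj₁ best)) (section-∑∑ πs (λ x y → ⟦ precedesᵇ x y ⟧) (λ x y s t → ⟦ marked (x , s) (y , t) ⟧))
        (proj₂ best))))
    where
    f : (Cube d → Cube K) → ℚ
    f s = ∑∑ d (λ x y → ⟦ precedesᵇ x y ⟧ * (weight πs x y * ⟦ adj (transversal s) x y ⟧))
    best = attained (section πs) f

module Recover {d : ℕ} (πs : Maps d) (F G′ : OrderedGraph) (ι : BlowUp.blowUp πs contains G′) where

  private n = order F

  open BlowUp πs
  open Subgraph πs n G′ ι
  open Deep n m (2 ℕ.^ d) P P-mono P≤

  module _ (n≤m : n ℕ.≤ m) (s : Cube d → Cube K) (κ : transversal s containsᶜ F) where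

    open Embedding κ renaming (to to f; monotone to f-mono; edges to f-edges)

    label : Fin n → Vertex
    label u = f u , s (f u)

    Witness : Fin n → Set
    Witness u = ∃[ i ] IsDeep (toℕ i) × at i ≡ label u

    mark : ∀ {u v} → T (adj (graph F) u v) → Marked (label u) (label v)
    mark {u} {v} uv = T-does (marked? (label u) (label v)) (f-edges uv)

    witness : ∀ {u} → (∃[ v ] T (adj (graph F) u v)) → Witness u
    witness (v , uv) = let i , k , (di , dk) , (eqi , eqk) , ik = mark uv in i , di , eqi

    Nonisolated : Fin n → Set
    Nonisolated u = ∃[ v ] T (adj (graph F) u v)

    nonisolated? : ∀ u → Dec (Nonisolated u)
    nonisolated? u = Finₚ.any? (λ v → T? (adj (graph F) u v))

    prescribe : ∀ {u} → Dec (Nonisolated u) → Maybe ℕ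
    prescribe (yes uv) = just (toℕ (proj₁ (witness uv)))
    prescribe (no _)   = nothing

    -- A marked edge at `u` proves that `label u` is a deep vertex of `G′`. For an isolated `u`
    -- there is no such evidence, and its position stays open.
    prescribed : Fin n → Maybe ℕ
    prescribed u = prescribe (nonisolated? u)

    prescribed-just : ∀ u {p} → prescribed u ≡ just p → Σ[ w ∈ Witness u ] toℕ (proj₁ w) ≡ p
    prescribed-just u = case (nonisolated? u)
      where
      case : ∀ {p} (u? : Dec (Nonisolated u)) → prescribe u? ≡ just p → Σ[ w ∈ Witness u ] toℕ (proj₁ w) ≡ p
      case (yes uv) eq = witness uv , just-injective eq

    prescribed-nonisolated : ∀ u → Nonisolated u → Σ[ w ∈ Witness u ] prescribed u ≡ just (toℕ (proj₁ w))
    prescribed-nonisolated u uv = case (nonisolated? u)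
      where
      case : (u? : Dec (Nonisolated u)) → Σ[ w ∈ Witness u ] prescribe u? ≡ just (toℕ (proj₁ w))
      case (yes uv′) = witness uv′ , refl
      case (no ¬uv)  = contradiction uv ¬uv

    room : ∀ u {p} → prescribed u ≡ just p → toℕ u ℕ.≤ p × p ℕ.+ n ℕ.≤ toℕ u ℕ.+ m
    room u eq with prescribed-just u eq
    ... | (i , (n≤i , flat) , _) , refl =
      ℕₚ.≤-trans (ℕₚ.<⇒≤ (Finₚ.toℕ<n u)) n≤i ,
      ℕₚ.≤-trans (ℕₚ.<⇒≤ (ℕₚ.≰⇒> not-top)) (ℕₚ.m≤n+m m (toℕ u))
      where
      not-top : ¬ m ℕ.≤ toℕ i ℕ.+ n
      not-top m≤ = ℕₚ.<-irrefl (trans (sym (P-at i)) (trans (sym flat) (P-top (toℕ i ℕ.+ n) m≤)))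
                               (rank< (proj₁ (at i)))

    -- `P` is constant on the `n` positions after a deep one, whereas the rank of `f v` is larger
    -- than that of `f u`. So the position of `v` is more than `n` further on, which leaves space
    -- for all vertices of `F` in between.
    gaps : ∀ u v {p q} → u Fin.< v → prescribed u ≡ just p → prescribed v ≡ just q →
           p ℕ.+ toℕ v ℕ.≤ q ℕ.+ toℕ u
    gaps u v u<v equ eqv with prescribed-just u equ | prescribed-just v eqv
    ... | (i , (_ , flat) , eqi) , refl | (k , _ , eqk) , refl = ℕₚ.≤-trans
      (ℕₚ.+-monoʳ-≤ (toℕ i) (ℕₚ.<⇒≤ (Finₚ.toℕ<n v)))
      (ℕₚ.≤-trans (ℕₚ.<⇒≤ (ℕₚ.≰⇒> far)) (ℕₚ.m≤m+n (toℕ k) (toℕ u)))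
      where
      rank-i = trans (P-at i) (cong (rank ∘ proj₁) eqi)
      rank-k = trans (P-at k) (cong (rank ∘ proj₁) eqk)
      far : ¬ toℕ k ℕ.≤ toℕ i ℕ.+ n
      far k≤ = ℕₚ.<⇒≱ (≺⇒rank< (f u) (f v) (f-mono u<v))
        (subst₂ ℕ._≤_ rank-k (trans flat rank-i) (P-mono k≤))

    placement : Placement n m 0 prescribed
    placement = place n m 0 prescribed n≤m room gaps

    g : Fin n → ℕ
    g = proj₁ placement

    g<m : ∀ u → g u ℕ.< m
    g<m u = proj₂ (proj₁ (proj₂ (proj₂ placement)) u)

    φ : Fin n → Fin m
    φ u = Fin.fromℕ< (g<m u)

    φ-mono : ∀ {u v} → u Fin.< v → φ u Fin.< φ v
    φ-mono {u} {v} u<v = subst₂ ℕ._<_ (sym (Finₚ.toℕ-fromℕ< (g<m u))) (sym (Finₚ.toℕ-fromℕ< (g<m v)))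
      (proj₁ (proj₂ placement) u<v)

    at-φ : ∀ u → Nonisolated u → at (φ u) ≡ label u
    at-φ u uv = let (i , _ , eqi) , eq = prescribed-nonisolated u uv in
      trans (cong at (Finₚ.toℕ-injective (trans (Finₚ.toℕ-fromℕ< (g<m u)) (proj₂ (proj₂ (proj₂ placement)) u eq)))) eqi

    φ-edges : ∀ {u v} → T (adj (graph F) u v) → T (adj (graph G′) (φ u) (φ v))
    φ-edges {u} {v} uv = let i , k , _ , (eqi , eqk) , ik = mark uv in
      subst₂ (λ x y → T (adj (graph G′) x y))
        (at-injective (trans eqi (sym (at-φ u (v , uv)))))
        (at-injective (trans eqk (sym (at-φ v (u , subst T (adj-sym (graph F) u v) uv)))))
        ik

    recover : G′ contains F
    recover = record
      { to = φ ; injective = strict⇒injective φ φ-mono ; monotone = φ-mono ; edges = φ-edges }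

  -- Serves to exclude a `G′` with fewer vertices than `F`: its edges are so few that the allowance
  -- for lost edges already covers them.
  few-edges : m ℕ.< n → nat (e G′) ≤ lost + lost
  few-edges m<n = begin
    nat (e G′)                      ≤⟨ nat-mono (e≤order² G′) ⟩
    nat (m ℕ.* m)                   ≡⟨ nat-* m m ⟩
    nat m * nat m                   ≤⟨ *-mono (0≤nat m) (nat-mono (ℕₚ.<⇒≤ m<n)) ⟩
    nat m * nat n                   ≡⟨ ℚₚ.*-comm (nat m) (nat n) ⟩
    nat n * nat m                   ≤⟨ *-mono (0≤nat n) m≤N ⟩
    nat n * (pow d * pow K)
      ≤⟨ ≤-by (0≤* (0≤nat n) (0≤* (0≤* (0≤pow d) (0≤pow K)) (0≤+ 0≤1 (0≤+ (0≤pow d) (0≤pow d)))))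
              (eq (nat n) (pow d) (pow K)) ⟩
    lost + lost                     ∎
    where
    open ℚₚ.≤-Reasoning
    0≤pow : ∀ k → 0ℚ ≤ pow k
    0≤pow k = 0≤nat (2 ℕ.^ k)
    eq : ∀ n p k → p * k * (n * (1ℚ + p)) + p * k * (n * (1ℚ + p)) ≡
                   n * (p * k) + n * (p * k * (1ℚ + (p + p)))
    eq = solve-∀ ring

-- The lower bound on the threshold

lower<upper : ∀ x {p r} → lower x p → upper x r → p < r
lower<upper x {p} {r} p<x x<r = ℚₚ.≰⇒> (λ r≤p → disjoint x r (below r≤p , x<r))
  where
  below : r ≤ p → lower x r
  below r≤p with ℚₚ.<-cmp r p
  ... | tri< r<p _ _  = Equivalence.from (lower-rounded x r) (p , r<p , p<x)
  ... | tri≈ _ refl _ = p<x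
  ... | tri> _ _ p<r  = contradiction p<r (≤⇒≯ r≤p)

n≤2^n : ∀ n → n ℕ.≤ 2 ℕ.^ n
n≤2^n zero    = ℕ.z≤n
n≤2^n (suc n) = ℕₚ.+-mono-≤ (ℕₚ.m^n>0 2 n) (ℕₚ.≤-trans (n≤2^n n) (ℕₚ.m≤m+n (2 ℕ.^ n) 0))

above : ∀ {d} → ℚ → (Fin d → ℚ) → Subset d
above β f = Vec.tabulate (λ ℓ → does (β ℚₚ.≤? f ℓ))

-- A Markov-type bound: a level in `above β f` counts at most 1, any other at most `β`.
∑≤above : ∀ d β (f : Fin d → ℚ) → 0ℚ ≤ β → (∀ ℓ → f ℓ ≤ 1ℚ) →
          ∑ (allFin d) f ≤ nat ∣ above β f ∣ + nat d * β
∑≤above zero    β f 0≤β f≤1 = ℚₚ.≤-reflexive (eq β)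
  where
  eq : ∀ b → 0ℚ ≡ 0ℚ + 0ℚ * b
  eq = solve-∀ ring
∑≤above (suc d) β f 0≤β f≤1 = subst (_≤ nat ∣ above β f ∣ + nat (suc d) * β) (sym (∑-allFin-suc d f))
  (bound (β ℚₚ.≤? f zero))
  where
  L = above β (f ∘ suc)
  IH = ∑≤above d β (f ∘ suc) 0≤β (f≤1 ∘ suc)
  eq₁ : ∀ l n b → (1ℚ + l) + (1ℚ + n) * b ≡ 1ℚ + (l + n * b) + b
  eq₁ = solve-∀ ring
  eq₀ : ∀ l n b → l + (1ℚ + n) * b ≡ b + (l + n * b)
  eq₀ = solve-∀ ring
  bound : (p? : Dec (β ≤ f zero)) →
          f zero + ∑ (allFin d) (f ∘ suc) ≤ nat ∣ does p? ∷ L ∣ + nat (suc d) * β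
  bound (yes _)   = ℚₚ.≤-trans (ℚₚ.+-mono-≤ (f≤1 zero) IH) (≤-by 0≤β (eq₁ (nat ∣ L ∣) (nat d) β))
  bound (no β≰f₀) = subst (f zero + ∑ (allFin d) (f ∘ suc) ≤_) (sym (eq₀ (nat ∣ L ∣) (nat d) β))
    (ℚₚ.+-mono-≤ (ℚₚ.<⇒≤ (ℚₚ.≰⇒> β≰f₀)) IH)

∈-above : ∀ {d} β (f : Fin d → ℚ) ℓ → ℓ ∈ₛ above β f → β ≤ f ℓ
∈-above β f ℓ ℓ∈ = T-does (β ℚₚ.≤? f ℓ) (subst T (sym
  (trans (sym (Vecₚ.lookup∘tabulate (λ ℓ → does (β ℚₚ.≤? f ℓ)) ℓ)) (Vecₚ.[]=⇒lookup ℓ∈))) tt)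

-- Half of the gap between `β` and `q`. One half pays for the lost edges; the other makes at least a
-- fraction `θ` of the levels `β`-dense.
θ : ℚ → ℚ → ℚ
θ β q = ½ * (q - β)

slack : ℕ → ℕ → ℚ
slack n d = nat n * (1ℚ + pow d)

-- The dimension `d` comes first, so that `θ * d` levels are at least `C`. Then `k` is chosen: for
-- fixed `d` the lost edges form a share of order `2^-K` of all edges, and `k ≤ K ≤ 2^K`. The 4 in
-- `k-large` is 2 for the two ends of an edge times 2 for the `½` in `W`.
module Lower (F : OrderedGraph) (α : ℝ) (C : ℕ)
  (force : ∀ (d : ℕ) (H : Graph (Cube d)) → Rich α C H → H containsᶜ F)
  (β q : ℚ) (α<β : upper α β) (0≤β : 0ℚ ≤ β) (β<q : β < q)
  (d k : ℕ) (d-large : nat C ≤ θ β q * nat d) (0<d : 0ℚ < nat d)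
  (k-large : nat 4 * slack (order F) d ≤ θ β q * nat d * nat k) where

  n = order F
  πs = padded d k
  open BlowUp πs
  G = blowUp

  -- The number of edges of the blow-up at each level.
  W : ℚ
  W = pow K * pow K * (½ * pow d)

  0<W : 0ℚ < W
  0<W = 0<* (0<* (0<pow K) (0<pow K)) (0<* (ℚₚ.positive⁻¹ ½) (0<pow d))

  0<θ : 0ℚ < θ β q
  0<θ = 0<* (ℚₚ.positive⁻¹ ½) (<⇒0<- β<q)

  e-G : nat (e G) ≡ W * nat d
  e-G = begin
    nat (e G)
      ≡⟨ e-blowUp ⟩
    pow K * pow K * ∑∑ d (λ x y → ⟦ precedesᵇ x y ⟧ * (weight πs x y * 1ℚ))
      ≡⟨ cong (pow K * pow K *_) (weighted-sum-padded d k (λ _ _ → 1ℚ)) ⟩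
    pow K * pow K * (½ * pow d * levelSum {d} (λ _ _ → 1ℚ))
      ≡⟨ cong (λ z → pow K * pow K * (½ * pow d * z)) (trans
           (∑-cong (allFin d) (λ ℓ → E-const (levelMean ℓ) 1ℚ)) (∑-allFin-const d 1ℚ)) ⟩
    pow K * pow K * (½ * pow d * (nat d * 1ℚ))
      ≡⟨ eq (pow K) (pow d) (nat d) ⟩
    W * nat d
      ∎
    where
    open ≡-Reasoning
    eq : ∀ K p d → K * K * (½ * p * (d * 1ℚ)) ≡ K * K * (½ * p) * d
    eq = solve-∀ ring

  0<e : 0ℚ < nat (e G)
  0<e = subst (0ℚ <_) (sym e-G) (0<* 0<W 0<d)

  k≤K : k ℕ.≤ K
  k≤K = subst (k ℕ.≤_) (sym (trans (Listₚ.length-++ (maps d)) (cong (length (maps d) ℕ.+_) (Listₚ.length-replicate k))))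
    (ℕₚ.m≤n+m k (length (maps d)))

  lost≤ : pow d * pow K * slack n d + pow d * pow K * slack n d ≤ θ β q * (W * nat d)
  lost≤ = ≤-by (0≤* (0≤* 0≤½ (0≤* (ℚₚ.<⇒≤ (0<pow d)) (ℚₚ.<⇒≤ (0<pow K)))) (≤⇒0≤- k-large′))
    (eq (θ β q) (pow K) (pow d) (nat d) (slack n d))
    where
    k-large′ : nat 4 * slack n d ≤ θ β q * nat d * pow K
    k-large′ = ℚₚ.≤-trans k-large (*-mono (ℚₚ.<⇒≤ (0<* 0<θ 0<d)) (nat-mono (ℕₚ.≤-trans k≤K (n≤2^n K))))
    eq : ∀ t K p d b → t * (K * K * (½ * p) * d) ≡
         (p * K * b + p * K * b) + ½ * (p * K) * (t * d * K - (1ℚ + (1ℚ + (1ℚ + (1ℚ + 0ℚ)))) * b)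
    eq = solve-∀ ring

  module _ (G′ : OrderedGraph) (ι : G contains G′) (dense : nat (e G) * q ≤ nat (e G′)) where

    open Subgraph πs n G′ ι

    dense′ : W * nat d * q ≤ nat (e G′)
    dense′ = subst (λ z → z * q ≤ nat (e G′)) e-G dense

    large : n ℕ.≤ m
    large = ℕₚ.≮⇒≥ (λ m<n → ≤⇒≯
      (ℚₚ.≤-trans dense′ (ℚₚ.≤-trans (Recover.few-edges πs F G′ ι m<n) lost≤))
      (<-by (0<* (0<* 0<W 0<d) (ℚₚ.≤-<-trans 0≤β (<-by 0<θ (eq₁ β q)))) (eq₂ (W * nat d) β q)))
      where
      eq₁ : ∀ b q → ½ * (q + b) ≡ b + ½ * (q - b)
      eq₁ = solve-∀ ring
      eq₂ : ∀ w b q → w * q ≡ ½ * (q - b) * w + w * (½ * (q + b))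
      eq₂ = solve-∀ ring

    module _ (s : Cube d → Cube K) (kept-edges : nat (e G′) ≤ pow K * pow K *
      ∑∑ d (λ x y → ⟦ precedesᵇ x y ⟧ * (weight πs x y * ⟦ adj (transversal s) x y ⟧)) + (lost + lost)) where

      H = transversal s

      ls : ℚ
      ls = levelSum {d} (λ x y → ⟦ adj H x y ⟧)

      kept-edges′ : nat (e G′) ≤ W * ls + (lost + lost)
      kept-edges′ = subst (λ z → nat (e G′) ≤ z + (lost + lost))
        (trans (cong (pow K * pow K *_) (weighted-sum-padded d k (λ x y → ⟦ adj H x y ⟧)))
               (sym (ℚₚ.*-assoc (pow K * pow K) (½ * pow d) ls)))
        kept-edges

      ls≥ : nat d * (β + θ β q) ≤ ls
      ls≥ = *-cancel-≤ 0<W (≤-by (0≤+ (0≤+ (≤⇒0≤- dense′) (≤⇒0≤- kept-edges′)) (≤⇒0≤- lost≤))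
        (eq W (nat d) β q ls (nat (e G′)) (lost + lost)))
        where
        eq : ∀ w d b q l e t → w * l ≡ w * (d * (b + ½ * (q - b))) +
             ((e - w * d * q) + ((w * l + t) - e) + (½ * (q - b) * (w * d) - t))
        eq = solve-∀ ring

      f : Fin d → ℚ
      f = density-level H

      f≤1 : ∀ ℓ → f ℓ ≤ 1ℚ
      f≤1 ℓ = subst (f ℓ ≤_) (E-const (levelMean ℓ) 1ℚ) (E-mono (levelMean ℓ) (λ p → ⟦⟧≤1 (adj H (proj₁ p) (proj₂ p))))

      C≤ : C ℕ.≤ ∣ above β f ∣
      C≤ = nat-cancel-≤ (ℚₚ.≤-trans d-large
        (≤-by (≤⇒0≤- (ℚₚ.≤-trans ls≥ (∑≤above d β f 0≤β f≤1))) (eq (nat d) β (θ β q) (nat ∣ above β f ∣))))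
        where
        eq : ∀ d b t l → l ≡ t * d + ((l + d * b) - d * (b + t))
        eq = solve-∀ ring

      rich : Rich α C H
      rich = above β f , C≤ , λ ℓ ℓ∈ p p<α → ℚₚ.<-≤-trans (lower<upper α p<α α<β)
        (subst (β ≤_) (sym (levelEdges/τ H ℓ)) (∈-above β f ℓ ℓ∈))

      contained : G′ contains F
      contained = Recover.recover πs F G′ ι large s (force d H rich)

    dense-contains : G′ contains F
    dense-contains = contained (proj₁ good-section) (proj₂ good-section)

  instance
    e-nonZero : NonZero (e G)
    e-nonZero = ℕ.>-nonZero (nat-cancel-< 0<e)

  relativeDensity<q : ∀ r → IsRelativeDensity F G r → r < q
  relativeDensity<q r (inj₁ ((G′ , ι , free , eq) , _)) = ℚₚ.≰⇒> (λ q≤r → free (dense-contains G′ ι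
    (subst (nat (e G) * q ≤_) (trans (cong (nat (e G) *_) eq) (/-nat (e G′) (e G))) (*-mono (0≤nat (e G)) q≤r))))
  relativeDensity<q r (inj₂ (_ , refl)) = ℚₚ.≤-<-trans 0≤β β<q

  ρ<q : ρ< F q
  ρ<q = fromℚ (proj₁ ρ) , density G (proj₁ ρ) (proj₂ ρ) , relativeDensity<q (proj₁ ρ) (proj₂ ρ)
    where ρ = relativeDensity F G

-- A rational `β` strictly between `α` and `q` replaces the cut `α`: comparing densities with `β` is
-- decidable, so the set of dense levels can be formed, and `α < β` makes them `α`-rich.
⊆ρ< : ∀ F {q} → infimum (ForcingRange F) q → ρ< F q
⊆ρ< F {q} (α , (0≤α , _ , C , force) , α<q) = below (Equivalence.to (upper-rounded α q) α<q)
  where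
  below : ∃[ β ] β < q × upper α β → ρ< F q
  below (β , β<q , α<β) = at-dimension (archimedean-* (nat C) (θ β q) 0<θ)
    where
    0<θ : 0ℚ < θ β q
    0<θ = 0<* (ℚₚ.positive⁻¹ ½) (<⇒0<- β<q)
    0≤β : 0ℚ ≤ β
    0≤β = ℚₚ.≮⇒≥ (λ β<0 → ℚₚ.<-irrefl refl (lower<upper α (0≤α β β<0) α<β))
    at-dimension : ∃[ d ] nat C ≤ θ β q * nat d → ρ< F q
    -- One dimension more than the bound asks for, so that there is at least one level even if
    -- `C = 0`.
    at-dimension (d , C≤) = with-padding (archimedean-* (nat 4 * slack (order F) (suc d)) (θ β q * nat (suc d)) 0<θd)
      where
      0<θd : 0ℚ < θ β q * nat (suc d)
      0<θd = 0<* 0<θ (0<nat (suc d))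
      with-padding : ∃[ k ] nat 4 * slack (order F) (suc d) ≤ θ β q * nat (suc d) * nat k → ρ< F q
      with-padding (k , k-large) = Lower.ρ<q F α C force β q α<β 0≤β β<q (suc d) k
        (ℚₚ.≤-trans C≤ (*-mono (ℚₚ.<⇒≤ 0<θ) (nat-mono (ℕₚ.n≤1+n d)))) (0<nat (suc d)) k-large

theorem1p2 : (F : OrderedGraph) →
    ρ< F ≐ infimum (λ α → fromℚ 0ℚ ≤ᵣ α × α ≤ᵣ fromℚ 1ℚ ×
      ∃[ C ] (∀ (d : ℕ) (H : Graph (Cube d)) → Rich α C H → H containsᶜ F))
theorem1p2 F = ρ<⊆ F , ⊆ρ< F
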